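{- Let $\mathbb{T}=(\Sigma,E)$ be a cartesian theory, let $\mathbb{T}^+=(\Sigma,\,E\uplus E^{op}\uplus I_{OLCH})$ be the associated Frobenius theory, and let $\mathbf{C}$ be a cartesian bicategory of relations. Then the category of Frobenius models of $\mathbb{T}^+$ in $\mathbf{C}$ is isomorphic to the category of cartesian models of $\mathbb{T}$ in the category $\mathsf{Map}(\mathbf{C})$ of maps of $\mathbf{C}$: $$\mathsf{Mod_{FROB}}(\mathbb{T}^+,\mathbf{C})\;\cong\;\mathsf{Mod_{CAR}}(\mathbb{T},\mathsf{Map}(\mathbf{C})).$$
   Context: Composition is written in diagrammatic order, $f;g$ meaning first $f$ then $g$; coherence isomorphisms of monoidal categories are suppressed (treat monoidal categories as strict, and monoidal functors as preserving the monoidal structure strictly, so that a model is determined by the image of $1$ and of the generators). **Props.** A prop is a symmetric strict monoidal category with objects the natural numbers and $m\oplus n=m+n$ on objects. An ordered prop is a prop whose homsets are posets, with $;$ and $\oplus$ monotone. A signature $\Sigma$ is a set of generators $o:n\to m$; $\Sigma$-terms are built from generators, $\mathrm{id}_0$, $\mathrm{id}_1$ and the symmetry $\sigma_{1,1}:2\to 2$ by $;$ and $\oplus$. The prop freely generated by $(\Sigma,E)$ ($E$ a set of pairs of terms of equal type) has as arrows terms modulo the laws of symmetric strict monoidal categories and the congruence generated by $E$. The ordered prop freely generated by $(\Sigma,I)$, $I$ a set of inequations $t\le t'$, has as arrows $\Sigma$-terms (modulo the laws of symmetric strict monoidal categories), preordered by the smallest preorder containing $I$ that is preserved by $;$ and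 $\oplus$, and then quotiented by the equivalence induced by the preorder. An equation stands for two inequations; $E^{op}$ is the set of reversed pairs of $E$. **Comonoid and monoid.** Let $\Delta:1\to2$, $!:1\to0$, $\nabla:2\to1$, $?:0\to1$ be generators. Put $\Delta_0=\mathrm{id}_0$, $\Delta_{n+1}=(\Delta\oplus\Delta_n);(\mathrm{id}_1\oplus\sigma_{1,n}\oplus\mathrm{id}_n)$, $!_0=\mathrm{id}_0$, $!_{n+1}=!\oplus!_n$, and dually $\nabla_n$, $?_n$. **Cartesian theories.** A cartesian theory $\mathbb{T}=(\Sigma,E)$ consists of a signature $\Sigma$ of generators $o:n\to1$ and a set $E$ of pairs $(t,t':n\to1)$ of arrows of the prop freely generated by $\Sigma\uplus\{\Delta,!\}$ subject to: $(\Delta,!)$ is a commutative comonoid, and $o;\Delta=\Delta_n;(o\oplus o)$, $o;!=!_n$ for each $o:n\to1$ in $\Sigma$. $\mathcal{L}_{\mathbb{T}}$ is the prop freely generated by the same data with the additional equations $E$. For a cartesian category $\mathbf{D}$ (symmetric monoidal, with monoidal product the categorical product), $\mathsf{Mod_{CAR}}(\mathbb{T},\mathbf{D})$ is the category of product-preserving functors $\mathcal{L}_{\mathbb{T}}\to\mathbf{D}$ and monoidal natural transformations. **Cartesian bicategories of relations.** A cartesian bicategory of relations is a poset-enriched symmetric monoidal category $(\mathbf{C},\oplus,I)$ with, for every object $n$, a cocommutative comonoid $\Delta_n:n\to n\oplus n$, $!_n:n\to I$ and a commutative monoid $\nabla_n:n\oplus n\to n$, $?_n:I\to n$, compatible with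 $\oplus$ (i.e. $\Delta_{m\oplus n}=(\Delta_m\oplus\Delta_n);(\mathrm{id}\oplus\sigma_{m,n}\oplus\mathrm{id})$, $!_{m\oplus n}=!_m\oplus!_n$, and dually), such that $\nabla_n;\Delta_n\le\mathrm{id}_{n\oplus n}$, $\mathrm{id}_n\le\Delta_n;\nabla_n$, $?_n;!_n\le\mathrm{id}_I$, $\mathrm{id}_n\le!_n;?_n$, $(\Delta_n\oplus\mathrm{id}_n);(\mathrm{id}_n\oplus\nabla_n)=\nabla_n;\Delta_n=(\mathrm{id}_n\oplus\Delta_n);(\nabla_n\oplus\mathrm{id}_n)$, and every arrow $R:m\to n$ satisfies $R;\Delta_n\le\Delta_m;(R\oplus R)$ and $R;!_n\le!_m$. A cartesian bifunctor is a poset-enriched symmetric monoidal functor preserving $\Delta_n$ and $!_n$ (hence also $\nabla_n,?_n$). A map is an arrow $R:m\to n$ with $R;\Delta_n=\Delta_m;(R\oplus R)$ and $R;!_n=!_m$. $\mathsf{Map}(\mathbf{C})$ is the subcategory of $\mathbf{C}$ with all objects and the maps as arrows; it is a cartesian category with product $\oplus$. **Frobenius theories.** A Frobenius theory $(\Sigma,I)$ is a signature $\Sigma$ (generators of arbitrary arity and coarity) with a set $I$ of inequations between arrows of the ordered prop freely generated by $\Sigma\uplus\{\Delta,!,\nabla,?\}$ subject to: $I_{CW}$ ($(\Delta,!)$ is a commutative comonoid, $(\nabla,?)$ is a commutative monoid, and the displayed inequations relating $\Delta,!,\nabla,?$ above hold for $n=1$) and $I_{LCH}$ ($o;\Delta_m\le\Delta_n;(o\oplus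 o)$ and $o;!_m\le!_n$ for each $o:n\to m$ in $\Sigma$). $\mathcal{F}_{(\Sigma,I)}$ is the ordered prop freely generated by the same data with the additional inequations $I$; it is a cartesian bicategory of relations. For a cartesian bicategory of relations $\mathbf{C}$, $\mathsf{Mod_{FROB}}((\Sigma,I),\mathbf{C})$ has as objects the cartesian bifunctors $F:\mathcal{F}_{(\Sigma,I)}\to\mathbf{C}$ and as morphisms $F\to G$ families of arrows $\alpha_n:Fn\to Gn$ of $\mathbf{C}$ ($n\in\mathbb{N}$) with $Ff;\alpha_m\le\alpha_n;Gf$ for all $f:n\to m$, $\alpha_{n+m}=\alpha_n\oplus\alpha_m$ and $\alpha_0=\mathrm{id}$. **The theory $\mathbb{T}^+$.** For a cartesian theory $\mathbb{T}=(\Sigma,E)$, $I_{OLCH}$ consists of $!_n\le o;!$ and $\Delta_n;(o\oplus o)\le o;\Delta$ for each generator $o:n\to1$ in $\Sigma$. -}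

module Defs where

open import Level using (Level; _⊔_; 0ℓ) renaming (suc to lsuc)
open import Data.Empty using (⊥)
open import Data.Nat using (ℕ; zero; suc; _+_)
open import Data.Nat.Properties using (+-assoc; +-identityʳ)
open import Data.Product using (Σ; _×_; _,_; proj₁; proj₂)
open import Relation.Binary using (IsEquivalence; IsPartialOrder)
open import Relation.Binary.PropositionalEquality
  using (_≡_; refl; sym; trans; cong; cong₂)

private
  variable
    o ℓ e o′ ℓ′ e′ r r′ s i h h′ : Level

record Category (o ℓ e : Level) : Set (lsuc (o ⊔ ℓ ⊔ e)) where
  infix  4 _≈_ _≋_
  infixr 5 _⨾_ _⨾[_]_
  field
    Obj : Set o
    Hom : Obj → Obj → Set ℓ
    _≈_ : ∀ {A B} → Hom A B → Hom A B → Set e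
    id  : ∀ {A} → Hom A A
    _⨾_ : ∀ {A B C} → Hom A B → Hom B C → Hom A C
    isEquivalence : ∀ {A B} → IsEquivalence (_≈_ {A} {B})
    ⨾-cong    : ∀ {A B C} {f f′ : Hom A B} {g g′ : Hom B C} →
                f ≈ f′ → g ≈ g′ → f ⨾ g ≈ f′ ⨾ g′
    identityˡ : ∀ {A B} {f : Hom A B} → id ⨾ f ≈ f
    identityʳ : ∀ {A B} {f : Hom A B} → f ⨾ id ≈ f
    assoc     : ∀ {A B C D} {f : Hom A B} {g : Hom B C} {h : Hom C D} →
                (f ⨾ g) ⨾ h ≈ f ⨾ (g ⨾ h)

  open module ≈ {A B : Obj} = IsEquivalence (isEquivalence {A} {B}) public
    renaming (refl to ≈-refl; sym to ≈-sym; trans to ≈-trans)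
    using ()

  -- Strict monoidal structure equates objects that are not definitionally
  -- equal.  `f ≋ g` says that f and g have equal (≡) domains and codomains and
  -- are equal arrows; `coe p` is the identity arrow along an equality of
  -- objects, and `f ⨾[ p ] g` composes across such an equality.  By axiom K the
  -- choice of p is immaterial, so no coherence conditions are needed.
  data _≋_ {A B} (f : Hom A B) : ∀ {A′ B′} → Hom A′ B′ → Set (ℓ ⊔ e) where
    ≈⇒≋ : {g : Hom A B} → f ≈ g → f ≋ g

  coe : ∀ {A B} → A ≡ B → Hom A B
  coe refl = id

  _⨾[_]_ : ∀ {A B B′ C} → Hom A B → B ≡ B′ → Hom B′ C → Hom A C
  f ⨾[ p ] g = f ⨾ (coe p ⨾ g)

record StrictSMC (o ℓ e : Level) : Set (lsuc (o ⊔ ℓ ⊔ e)) where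
  infixr 6 _⊕₀_ _⊕₁_
  field
    category : Category o ℓ e
  open Category category public
  field
    I    : Obj
    _⊕₀_ : Obj → Obj → Obj
    ⊕₀-assoc     : ∀ A B C → (A ⊕₀ B) ⊕₀ C ≡ A ⊕₀ (B ⊕₀ C)
    ⊕₀-identityˡ : ∀ A → I ⊕₀ A ≡ A
    ⊕₀-identityʳ : ∀ A → A ⊕₀ I ≡ A
    _⊕₁_ : ∀ {A B C D} → Hom A B → Hom C D → Hom (A ⊕₀ C) (B ⊕₀ D)
    ⊕-cong : ∀ {A B C D} {f f′ : Hom A B} {g g′ : Hom C D} →
             f ≈ f′ → g ≈ g′ → f ⊕₁ g ≈ f′ ⊕₁ g′
    ⊕-id   : ∀ {A B} → id {A} ⊕₁ id {B} ≈ id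
    ⊕-⨾    : ∀ {A B C A′ B′ C′} {f : Hom A B} {g : Hom B C}
             {f′ : Hom A′ B′} {g′ : Hom B′ C′} →
             (f ⨾ g) ⊕₁ (f′ ⨾ g′) ≈ (f ⊕₁ f′) ⨾ (g ⊕₁ g′)
    ⊕-assoc : ∀ {A A′ B B′ C C′}
              {f : Hom A A′} {g : Hom B B′} {h : Hom C C′} →
              (f ⊕₁ g) ⊕₁ h ≋ f ⊕₁ (g ⊕₁ h)
    ⊕-identityˡ : ∀ {A B} {f : Hom A B} → id {I} ⊕₁ f ≋ f
    ⊕-identityʳ : ∀ {A B} {f : Hom A B} → f ⊕₁ id {I} ≋ f
    σ : ∀ A B → Hom (A ⊕₀ B) (B ⊕₀ A)
    σ-natural : ∀ {A A′ B B′} {f : Hom A A′} {g : Hom B B′} →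
                (f ⊕₁ g) ⨾ σ A′ B′ ≈ σ A B ⨾ (g ⊕₁ f)
    σ-involutive : ∀ {A B} → σ A B ⨾ σ B A ≈ id
    σ-hexagon : ∀ {A B C} →
                σ A (B ⊕₀ C) ≋
                (σ A B ⊕₁ id {C}) ⨾[ ⊕₀-assoc B A C ] (id {B} ⊕₁ σ A C)

  mid-eq : ∀ A B C D → (A ⊕₀ B) ⊕₀ (C ⊕₀ D) ≡ A ⊕₀ ((B ⊕₀ C) ⊕₀ D)
  mid-eq A B C D = trans (⊕₀-assoc A B (C ⊕₀ D))
                         (cong (A ⊕₀_) (sym (⊕₀-assoc B C D)))

  -- id ⊕ σ ⊕ id, re-bracketed
  mid : ∀ A B C D → Hom ((A ⊕₀ B) ⊕₀ (C ⊕₀ D)) ((A ⊕₀ C) ⊕₀ (B ⊕₀ D))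
  mid A B C D = coe (mid-eq A B C D) ⨾
                ((id {A} ⊕₁ (σ B C ⊕₁ id {D})) ⨾
                 coe (sym (mid-eq A C B D)))

module HetProperties {o ℓ e : Level} (C : Category o ℓ e) where
  open Category C

  hrefl : ∀ {A B} {f : Hom A B} → f ≋ f
  hrefl = ≈⇒≋ ≈-refl

  hsym : ∀ {A B A′ B′} {f : Hom A B} {g : Hom A′ B′} → f ≋ g → g ≋ f
  hsym (≈⇒≋ p) = ≈⇒≋ (≈-sym p)

  htrans : ∀ {A B A′ B′ A″ B″} {f : Hom A B} {g : Hom A′ B′}
           {h : Hom A″ B″} → f ≋ g → g ≋ h → f ≋ h
  htrans (≈⇒≋ p) (≈⇒≋ q) = ≈⇒≋ (≈-trans p q)

  ≋⇒≈ : ∀ {A B} {f g : Hom A B} → f ≋ g → f ≈ g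
  ≋⇒≈ (≈⇒≋ p) = p

  dom≡ : ∀ {A B A′ B′} {f : Hom A B} {g : Hom A′ B′} → f ≋ g → A ≡ A′
  dom≡ (≈⇒≋ _) = refl

  cod≡ : ∀ {A B A′ B′} {f : Hom A B} {g : Hom A′ B′} → f ≋ g → B ≡ B′
  cod≡ (≈⇒≋ _) = refl

  infixr 2 _≈⟨_⟩_ _≋⟨_⟩_ _≋˘⟨_⟩_
  infix  3 _∎

  _≈⟨_⟩_ : ∀ {A B} (f : Hom A B) {g h : Hom A B} → f ≈ g → g ≈ h → f ≈ h
  _ ≈⟨ p ⟩ q = ≈-trans p q

  _≋⟨_⟩_ : ∀ {A B A′ B′ A″ B″} (f : Hom A B) {g : Hom A′ B′}
           {h : Hom A″ B″} → f ≋ g → g ≋ h → f ≋ h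
  _ ≋⟨ p ⟩ q = htrans p q

  _≋˘⟨_⟩_ : ∀ {A B A′ B′ A″ B″} (f : Hom A B) {g : Hom A′ B′}
            {h : Hom A″ B″} → g ≋ f → g ≋ h → f ≋ h
  _ ≋˘⟨ p ⟩ q = htrans (hsym p) q

  _∎ : ∀ {A B} (f : Hom A B) → f ≋ f
  _ ∎ = hrefl

  ⨾-cong≋ : ∀ {A B D A′ B′ D′} {f : Hom A B} {g : Hom B D}
            {f′ : Hom A′ B′} {g′ : Hom B′ D′} →
            f ≋ f′ → g ≋ g′ → f ⨾ g ≋ f′ ⨾ g′
  ⨾-cong≋ (≈⇒≋ p) (≈⇒≋ q) = ≈⇒≋ (⨾-cong p q)

  coe≋id : ∀ {A B} (p : A ≡ B) → coe p ≋ id {A}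
  coe≋id refl = hrefl

  coe≋id′ : ∀ {A B} (p : A ≡ B) → coe p ≋ id {B}
  coe≋id′ refl = hrefl

  ⨾-coe : ∀ {A B B′} {f : Hom A B} (p : B ≡ B′) → f ⨾ coe p ≋ f
  ⨾-coe refl = ≈⇒≋ identityʳ

  coe-⨾ : ∀ {A B A′} {f : Hom A B} (p : A′ ≡ A) → coe p ⨾ f ≋ f
  coe-⨾ refl = ≈⇒≋ identityˡ

  infixr 5 _⨾⟦_⟧_

  -- _⨾[_]_, sealed so that unification can recover its arguments
  abstract
    _⨾⟦_⟧_ : ∀ {A B B′ D} → Hom A B → B ≡ B′ → Hom B′ D → Hom A D
    f ⨾⟦ p ⟧ g = f ⨾[ p ] g

    ⨾⟦⟧≋⨾[] : ∀ {A B B′ D} {f : Hom A B} {p : B ≡ B′} {g : Hom B′ D} →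
              f ⨾⟦ p ⟧ g ≋ f ⨾[ p ] g
    ⨾⟦⟧≋⨾[] = hrefl

    ⨾≋⨾⟦⟧ : ∀ {A B D} {f : Hom A B} {g : Hom B D} → f ⨾ g ≋ f ⨾⟦ refl ⟧ g
    ⨾≋⨾⟦⟧ = ≈⇒≋ (⨾-cong ≈-refl (≈-sym identityˡ))

  via : ∀ {A B B₁ D A′ B′ B₁′ D′} {f : Hom A B} {g : Hom B₁ D}
        {f′ : Hom A′ B′} {g′ : Hom B₁′ D′} →
        f ≋ f′ → B ≡ B₁ → g ≋ g′ → B′ ≡ B₁′
  via p q r = trans (sym (cod≡ p)) (trans q (dom≡ r))

  ⨾⟦⟧-cong : ∀ {A B B₁ D A′ B′ B₁′ D′} {f : Hom A B} {g : Hom B₁ D}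
             {f′ : Hom A′ B′} {g′ : Hom B₁′ D′} {q : B ≡ B₁}
             (p : f ≋ f′) (r : g ≋ g′) →
             f ⨾⟦ q ⟧ g ≋ f′ ⨾⟦ via p q r ⟧ g′
  ⨾⟦⟧-cong {q = refl} (≈⇒≋ p) (≈⇒≋ r) =
    htrans (hsym ⨾≋⨾⟦⟧) (htrans (≈⇒≋ (⨾-cong p r)) ⨾≋⨾⟦⟧)

  ⨾⟦⟧-cong′ : ∀ {A B B₁ D A′ B′ B₁′ D′} {f : Hom A B} {g : Hom B₁ D}
              {f′ : Hom A′ B′} {g′ : Hom B₁′ D′} (q : B ≡ B₁) (q′ : B′ ≡ B₁′) →
              f ≋ f′ → g ≋ g′ →
              f ⨾⟦ q ⟧ g ≋ f′ ⨾⟦ q′ ⟧ g′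
  ⨾⟦⟧-cong′ refl refl (≈⇒≋ p) (≈⇒≋ r) =
    htrans (hsym ⨾≋⨾⟦⟧) (htrans (≈⇒≋ (⨾-cong p r)) ⨾≋⨾⟦⟧)

  ⨾⟦⟧-assoc : ∀ {A B B′ D D′ E} {f : Hom A B} {g : Hom B′ D} {h : Hom D′ E}
              {p : B ≡ B′} {q : D ≡ D′} →
              (f ⨾⟦ p ⟧ g) ⨾⟦ q ⟧ h ≋ f ⨾⟦ p ⟧ (g ⨾⟦ q ⟧ h)
  ⨾⟦⟧-assoc {p = refl} {q = refl} =
    htrans (hsym (htrans (⨾-cong≋ ⨾≋⨾⟦⟧ hrefl) ⨾≋⨾⟦⟧))
      (htrans (≈⇒≋ assoc) (htrans (⨾-cong≋ hrefl ⨾≋⨾⟦⟧) ⨾≋⨾⟦⟧))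

  idˡ≋ : ∀ {B B′ D} {f : Hom B′ D} {p : B ≡ B′} → id {B} ⨾⟦ p ⟧ f ≋ f
  idˡ≋ {p = refl} = htrans (hsym ⨾≋⨾⟦⟧) (≈⇒≋ identityˡ)

  idʳ≋ : ∀ {A B B′} {f : Hom A B} {p : B ≡ B′} → f ⨾⟦ p ⟧ id {B′} ≋ f
  idʳ≋ {p = refl} = htrans (hsym ⨾≋⨾⟦⟧) (≈⇒≋ identityʳ)

  id≋ : ∀ {A B} → A ≡ B → id {A} ≋ id {B}
  id≋ refl = hrefl

module SMCProperties {o ℓ e : Level} (S : StrictSMC o ℓ e) where
  open StrictSMC S
  open HetProperties category

  ⊕≋ : ∀ {A B D E A′ B′ D′ E′} {f : Hom A B} {g : Hom D E}
       {f′ : Hom A′ B′} {g′ : Hom D′ E′} →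
       f ≋ f′ → g ≋ g′ → f ⊕₁ g ≋ f′ ⊕₁ g′
  ⊕≋ (≈⇒≋ p) (≈⇒≋ q) = ≈⇒≋ (⊕-cong p q)

  id⊕id≋ : ∀ {A B} → id {A} ⊕₁ id {B} ≋ id {A ⊕₀ B}
  id⊕id≋ = ≈⇒≋ ⊕-id

  ⊕-⨾⟦⟧ : ∀ {A B B₁ D A′ B′ B₁′ D′} {f : Hom A B} {g : Hom B₁ D}
          {h : Hom A′ B′} {k : Hom B₁′ D′} {p : B ≡ B₁} {q : B′ ≡ B₁′} →
          (f ⨾⟦ p ⟧ g) ⊕₁ (h ⨾⟦ q ⟧ k) ≋
          (f ⊕₁ h) ⨾⟦ cong₂ _⊕₀_ p q ⟧ (g ⊕₁ k)
  ⊕-⨾⟦⟧ {p = refl} {q = refl} =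
    htrans (hsym (⊕≋ ⨾≋⨾⟦⟧ ⨾≋⨾⟦⟧)) (htrans (≈⇒≋ ⊕-⨾) ⨾≋⨾⟦⟧)

  ⊕-⨾⟦⟧ˡ : ∀ {A B B₁ D X} {f : Hom A B} {g : Hom B₁ D} {p : B ≡ B₁} →
           (f ⨾⟦ p ⟧ g) ⊕₁ id {X} ≋
           (f ⊕₁ id {X}) ⨾⟦ cong (_⊕₀ X) p ⟧ (g ⊕₁ id {X})
  ⊕-⨾⟦⟧ˡ {p = refl} = htrans (⊕≋ hrefl (hsym (idˡ≋ {p = refl}))) ⊕-⨾⟦⟧

  ⊕-⨾⟦⟧ʳ : ∀ {A B B₁ D X} {f : Hom A B} {g : Hom B₁ D} {p : B ≡ B₁} →
           id {X} ⊕₁ (f ⨾⟦ p ⟧ g) ≋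
           (id {X} ⊕₁ f) ⨾⟦ cong (X ⊕₀_) p ⟧ (id {X} ⊕₁ g)
  ⊕-⨾⟦⟧ʳ {p = refl} = htrans (⊕≋ (hsym (idˡ≋ {p = refl})) hrefl) ⊕-⨾⟦⟧

  split₁ : ∀ {A B D E} {f : Hom A B} {g : Hom D E} →
           (f ⊕₁ id) ⨾ (id ⊕₁ g) ≈ f ⊕₁ g
  split₁ = ≈-trans (≈-sym ⊕-⨾) (⊕-cong identityʳ identityˡ)

  split₂ : ∀ {A B D E} {f : Hom A B} {g : Hom D E} →
           (id ⊕₁ g) ⨾ (f ⊕₁ id) ≈ f ⊕₁ g
  split₂ = ≈-trans (≈-sym ⊕-⨾) (⊕-cong identityˡ identityʳ)

  σ≋ : ∀ {A B A′ B′} → A ≡ A′ → B ≡ B′ → σ A B ≋ σ A′ B′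
  σ≋ refl refl = hrefl

  assoc4 : ∀ {A B D E A′ B′ D′ E′} {f : Hom A A′} {g : Hom B B′}
           {h : Hom D D′} {k : Hom E E′} →
           (f ⊕₁ g) ⊕₁ (h ⊕₁ k) ≋ f ⊕₁ ((g ⊕₁ h) ⊕₁ k)
  assoc4 = htrans ⊕-assoc (⊕≋ hrefl (hsym ⊕-assoc))

  mid≋ : ∀ {A B D E} → mid A B D E ≋ id {A} ⊕₁ (σ B D ⊕₁ id {E})
  mid≋ {A} {B} {D} {E} =
    htrans (coe-⨾ (mid-eq A B D E)) (⨾-coe (sym (mid-eq A D B E)))

  mid-natural : ∀ {A B D E A′ B′ D′ E′} {f : Hom A A′} {g : Hom B B′}
                {h : Hom D D′} {k : Hom E E′} →
                ((f ⊕₁ g) ⊕₁ (h ⊕₁ k)) ⨾ mid A′ B′ D′ E′ ≈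
                mid A B D E ⨾ ((f ⊕₁ h) ⊕₁ (g ⊕₁ k))
  mid-natural = ≋⇒≈ (htrans (⨾-cong≋ assoc4 mid≋)
    (htrans (≈⇒≋ slide) (hsym (⨾-cong≋ mid≋ assoc4))))
    where
    slide : ∀ {A B D E A′ B′ D′ E′} {f : Hom A A′} {g : Hom B B′}
            {h : Hom D D′} {k : Hom E E′} →
            (f ⊕₁ ((g ⊕₁ h) ⊕₁ k)) ⨾ (id ⊕₁ (σ B′ D′ ⊕₁ id)) ≈
            (id ⊕₁ (σ B D ⊕₁ id)) ⨾ (f ⊕₁ ((h ⊕₁ g) ⊕₁ k))
    slide = ≈-trans (≈-sym ⊕-⨾) (≈-trans
      (⊕-cong (≈-trans identityʳ (≈-sym identityˡ))
        (≈-trans (≈-sym ⊕-⨾) (≈-trans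
          (⊕-cong σ-natural (≈-trans identityʳ (≈-sym identityˡ))) ⊕-⨾)))
      ⊕-⨾)

  mid-inverse : ∀ {A B D E} → mid A B D E ⨾ mid A D B E ≈ id
  mid-inverse = ≋⇒≈ (htrans (⨾-cong≋ mid≋ mid≋) (htrans
    (≈⇒≋ (≈-trans (≈-sym ⊕-⨾) (⊕-cong identityˡ
      (≈-trans (≈-sym ⊕-⨾) (⊕-cong σ-involutive identityˡ)))))
    (htrans (⊕≋ hrefl (⊕≋ (hsym id⊕id≋) hrefl))
      (htrans (hsym assoc4) (htrans (⊕≋ id⊕id≋ id⊕id≋) id⊕id≋)))))

  σ-hexagon⟦⟧ : ∀ {A B X} →
                σ A (B ⊕₀ X) ≋
                (σ A B ⊕₁ id {X}) ⨾⟦ ⊕₀-assoc B A X ⟧ (id {B} ⊕₁ σ A X)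
  σ-hexagon⟦⟧ = htrans σ-hexagon (hsym ⨾⟦⟧≋⨾[])

  σ-identityʳ : ∀ {A} → σ A I ≋ id {A}
  σ-identityʳ {A} = htrans (hsym step) (id≋ (⊕₀-identityˡ A))
    where
    p : I ⊕₀ A ≡ A ⊕₀ I
    p = trans (⊕₀-identityˡ A) (sym (⊕₀-identityʳ A))
    idem : σ A I ≋ σ A I ⨾⟦ p ⟧ σ A I
    idem = htrans (σ≋ refl (sym (⊕₀-identityˡ I))) (htrans σ-hexagon⟦⟧
      (⨾⟦⟧-cong′ (⊕₀-assoc I A I) p ⊕-identityʳ ⊕-identityˡ))
    step : id {I ⊕₀ A} ≋ σ A I
    step =
      _ ≋˘⟨ ≈⇒≋ σ-involutive ⟩
      _ ≋⟨ ⨾-cong≋ (hrefl {f = σ I A}) idem ⟩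
      _ ≋⟨ ⨾≋⨾⟦⟧ ⟩
      _ ≋˘⟨ ⨾⟦⟧-assoc ⟩
      _ ≋⟨ ⨾⟦⟧-cong (htrans (hsym ⨾≋⨾⟦⟧) (≈⇒≋ σ-involutive)) hrefl ⟩
      _ ≋⟨ idˡ≋ ⟩
      σ A I ∎

  σ-identityˡ : ∀ {A} → σ I A ≋ id {A}
  σ-identityˡ {A} =
    _ ≋˘⟨ ≈⇒≋ identityʳ ⟩
    _ ≋˘⟨ ⨾-cong≋ hrefl (htrans (σ-identityʳ {A}) (id≋ (sym (⊕₀-identityʳ A)))) ⟩
    _ ≋⟨ ≈⇒≋ σ-involutive ⟩
    _ ≋⟨ id≋ (⊕₀-identityˡ A) ⟩
    id ∎

  σ-hexagon′ : ∀ {A B X} →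
               σ (A ⊕₀ B) X ≋
               (id {A} ⊕₁ σ B X) ⨾⟦ sym (⊕₀-assoc A X B) ⟧ (σ A X ⊕₁ id {B})
  σ-hexagon′ {A} {B} {X} = htrans (≈⇒≋ unique) (htrans Z≋ (hsym ⨾⟦⟧≋⨾[]))
    where
    q : (A ⊕₀ X) ⊕₀ B ≡ A ⊕₀ (X ⊕₀ B)
    q = ⊕₀-assoc A X B
    Y : Hom ((X ⊕₀ A) ⊕₀ B) (A ⊕₀ (B ⊕₀ X))
    Y = (σ X A ⊕₁ id {B}) ⨾[ q ] (id {A} ⊕₁ σ X B)
    Y⁻ : Hom (A ⊕₀ (B ⊕₀ X)) ((X ⊕₀ A) ⊕₀ B)
    Y⁻ = (id {A} ⊕₁ σ B X) ⨾[ sym q ] (σ A X ⊕₁ id {B})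
    a : (A ⊕₀ B) ⊕₀ X ≡ A ⊕₀ (B ⊕₀ X)
    a = ⊕₀-assoc A B X
    b : (X ⊕₀ A) ⊕₀ B ≡ X ⊕₀ (A ⊕₀ B)
    b = ⊕₀-assoc X A B
    Z : Hom ((A ⊕₀ B) ⊕₀ X) (X ⊕₀ (A ⊕₀ B))
    Z = coe a ⨾ (Y⁻ ⨾ coe b)
    Z≋ : Z ≋ Y⁻
    Z≋ = htrans (coe-⨾ a) (⨾-coe b)
    cancel : ∀ {P Q Q′ R} {f : Hom P Q} {g : Hom Q′ R} {g⁻ : Hom R Q′}
             {f⁻ : Hom Q P} (r : Q ≡ Q′) → f ⨾ f⁻ ≈ id → g ⨾ g⁻ ≈ id →
             (f ⨾[ r ] g) ⨾ (g⁻ ⨾[ sym r ] f⁻) ≈ id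
    cancel refl u v = ≈-trans
      (⨾-cong (⨾-cong ≈-refl identityˡ) (⨾-cong ≈-refl identityˡ))
      (≈-trans assoc (≈-trans (⨾-cong ≈-refl (≈-trans (≈-sym assoc)
        (≈-trans (⨾-cong v ≈-refl) identityˡ))) u))
    YY⁻ : Y ⨾ Y⁻ ≈ id
    YY⁻ = cancel q
      (≈-trans (≈-sym ⊕-⨾) (≈-trans (⊕-cong σ-involutive identityˡ) ⊕-id))
      (≈-trans (≈-sym ⊕-⨾) (≈-trans (⊕-cong identityˡ σ-involutive) ⊕-id))
    σZ : σ X (A ⊕₀ B) ⨾ Z ≈ id
    σZ = ≋⇒≈ (htrans (⨾-cong≋ σ-hexagon Z≋) (htrans (≈⇒≋ YY⁻) (id≋ b)))
    unique : σ (A ⊕₀ B) X ≈ Z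
    unique = ≈-trans (≈-sym identityʳ) (≈-trans (⨾-cong ≈-refl (≈-sym σZ))
      (≈-trans (≈-sym assoc) (≈-trans (⨾-cong σ-involutive ≈-refl) identityˡ)))

  mid-unitˡ : ∀ {B D} → mid I I B D ≋ id {B ⊕₀ D}
  mid-unitˡ = htrans mid≋ (htrans ⊕-identityˡ
    (htrans (⊕≋ σ-identityˡ hrefl) id⊕id≋))

  mid-unitʳ : ∀ {A B} → mid A B I I ≋ id {A ⊕₀ B}
  mid-unitʳ = htrans mid≋ (htrans (⊕≋ hrefl (htrans ⊕-identityʳ σ-identityʳ))
    id⊕id≋)

  mid-unit-mid : ∀ {A D} → mid A I I D ≋ id {A ⊕₀ D}
  mid-unit-mid = htrans mid≋ (htrans
    (⊕≋ hrefl (htrans (⊕≋ σ-identityˡ hrefl) ⊕-identityˡ)) id⊕id≋)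

  mid-assoc : ∀ {A A′ B B′ C C′} →
              (id {A ⊕₀ A′} ⊕₁ mid B B′ C C′) ⨾ mid A A′ (B ⊕₀ C) (B′ ⊕₀ C′) ≋
              (mid A A′ B B′ ⊕₁ id {C ⊕₀ C′}) ⨾ mid (A ⊕₀ B) (A′ ⊕₀ B′) C C′
  mid-assoc {A} {A′} {B} {B′} {C} {C′} =
    _ ≋⟨ ⨾≋⨾⟦⟧ ⟩
    _ ≋⟨ ⨾⟦⟧-cong′ refl lhs-eq left₁ left₂ ⟩
    _ ≋˘⟨ ⊕-⨾⟦⟧ʳ ⟩
    _ ≋˘⟨ ⊕≋ hrefl ⊕-⨾⟦⟧ˡ ⟩
    _ ≋⟨ ⊕≋ hrefl (⊕≋ core hrefl) ⟩
    _ ≋⟨ ⊕≋ hrefl ⊕-⨾⟦⟧ˡ ⟩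
    _ ≋⟨ ⊕-⨾⟦⟧ʳ ⟩
    _ ≋⟨ ⨾⟦⟧-cong′ rhs-eq refl (hsym right₁) (hsym right₂) ⟩
    _ ≋˘⟨ ⨾≋⨾⟦⟧ ⟩
    _ ∎
    where
    p : A′ ⊕₀ (B ⊕₀ (C ⊕₀ B′)) ≡ (A′ ⊕₀ (B ⊕₀ C)) ⊕₀ B′
    p = trans (cong (A′ ⊕₀_) (sym (⊕₀-assoc B C B′)))
              (sym (⊕₀-assoc A′ (B ⊕₀ C) B′))
    q : ((B ⊕₀ A′) ⊕₀ B′) ⊕₀ C ≡ B ⊕₀ ((A′ ⊕₀ B′) ⊕₀ C)
    q = trans (cong (_⊕₀ C) (⊕₀-assoc B A′ B′)) (⊕₀-assoc B (A′ ⊕₀ B′) C)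
    lhs-eq : A ⊕₀ ((A′ ⊕₀ (B ⊕₀ (C ⊕₀ B′))) ⊕₀ C′) ≡
             A ⊕₀ (((A′ ⊕₀ (B ⊕₀ C)) ⊕₀ B′) ⊕₀ C′)
    lhs-eq = cong (A ⊕₀_) (cong (_⊕₀ C′) p)
    rhs-eq : A ⊕₀ ((((B ⊕₀ A′) ⊕₀ B′) ⊕₀ C) ⊕₀ C′) ≡
             A ⊕₀ ((B ⊕₀ ((A′ ⊕₀ B′) ⊕₀ C)) ⊕₀ C′)
    rhs-eq = cong (A ⊕₀_) (cong (_⊕₀ C′) q)
    left₁ : id {A ⊕₀ A′} ⊕₁ mid B B′ C C′ ≋
            id {A} ⊕₁ ((id {A′} ⊕₁ (id {B} ⊕₁ σ B′ C)) ⊕₁ id {C′})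
    left₁ = htrans (⊕≋ (hsym id⊕id≋) mid≋) (htrans ⊕-assoc
      (⊕≋ hrefl (htrans (⊕≋ hrefl (hsym ⊕-assoc)) (hsym ⊕-assoc))))
    left₂ : mid A A′ (B ⊕₀ C) (B′ ⊕₀ C′) ≋
            id {A} ⊕₁ ((σ A′ (B ⊕₀ C) ⊕₁ id {B′}) ⊕₁ id {C′})
    left₂ = htrans mid≋ (⊕≋ hrefl (htrans (⊕≋ hrefl (hsym id⊕id≋))
      (hsym ⊕-assoc)))
    right₁ : mid A A′ B B′ ⊕₁ id {C ⊕₀ C′} ≋
             id {A} ⊕₁ (((σ A′ B ⊕₁ id {B′}) ⊕₁ id {C}) ⊕₁ id {C′})
    right₁ = htrans (⊕≋ mid≋ (hsym id⊕id≋)) (htrans ⊕-assoc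
      (⊕≋ hrefl (hsym ⊕-assoc)))
    right₂ : mid (A ⊕₀ B) (A′ ⊕₀ B′) C C′ ≋
             id {A} ⊕₁ ((id {B} ⊕₁ σ (A′ ⊕₀ B′) C) ⊕₁ id {C′})
    right₂ = htrans mid≋ (htrans (⊕≋ (hsym id⊕id≋) hrefl) (htrans ⊕-assoc
      (⊕≋ hrefl (hsym ⊕-assoc))))
    core₁ : (id {A′} ⊕₁ (id {B} ⊕₁ σ B′ C)) ⨾⟦ p ⟧
            (σ A′ (B ⊕₀ C) ⊕₁ id {B′}) ≋
            (σ A′ B ⊕₁ σ B′ C) ⨾⟦ trans (sym (⊕₀-assoc (B ⊕₀ A′) C B′))
              (cong (_⊕₀ B′) (⊕₀-assoc B A′ C)) ⟧
            ((id {B} ⊕₁ σ A′ C) ⊕₁ id {B′})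
    core₁ =
      _ ≋⟨ ⨾⟦⟧-cong hrefl (htrans (⊕≋ σ-hexagon⟦⟧ hrefl) ⊕-⨾⟦⟧ˡ) ⟩
      _ ≋˘⟨ ⨾⟦⟧-assoc ⟩
      _ ≋⟨ ⨾⟦⟧-cong (htrans (⨾⟦⟧-cong′ _ refl
             (htrans (hsym ⊕-assoc) (⊕≋ id⊕id≋ hrefl))
             (htrans ⊕-assoc (⊕≋ hrefl id⊕id≋)))
             (htrans (hsym ⨾≋⨾⟦⟧) (≈⇒≋ split₂))) hrefl ⟩
      _ ≋⟨ ⨾⟦⟧-cong′ _ _ hrefl hrefl ⟩
      _ ∎
    core : (id {A′} ⊕₁ (id {B} ⊕₁ σ B′ C)) ⨾⟦ p ⟧
           (σ A′ (B ⊕₀ C) ⊕₁ id {B′}) ≋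
           ((σ A′ B ⊕₁ id {B′}) ⊕₁ id {C}) ⨾⟦ q ⟧
           (id {B} ⊕₁ σ (A′ ⊕₀ B′) C)
    core = htrans core₁ (hsym (
      _ ≋⟨ ⨾⟦⟧-cong hrefl (htrans (⊕≋ hrefl σ-hexagon′) ⊕-⨾⟦⟧ʳ) ⟩
      _ ≋˘⟨ ⨾⟦⟧-assoc ⟩
      _ ≋⟨ ⨾⟦⟧-cong (htrans (⨾⟦⟧-cong′ _ refl
             (htrans ⊕-assoc (⊕≋ hrefl id⊕id≋))
             (htrans (hsym ⊕-assoc) (⊕≋ id⊕id≋ hrefl)))
             (htrans (hsym ⨾≋⨾⟦⟧) (≈⇒≋ split₁))) (hsym ⊕-assoc) ⟩
      _ ≋⟨ ⨾⟦⟧-cong′ _ _ hrefl hrefl ⟩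
      _ ∎))

  σ-block : ∀ {A A′ B B′} →
            σ (A ⊕₀ A′) (B ⊕₀ B′) ≈
            mid A A′ B B′ ⨾ ((σ A B ⊕₁ σ A′ B′) ⨾ mid B A B′ A′)
  σ-block {A} {A′} {B} {B′} = ≋⇒≈ (
    _ ≋⟨ σ-hexagon′ ⟩
    _ ≋⟨ ⨾⟦⟧-cong (htrans (⊕≋ hrefl σ-hexagon⟦⟧) ⊕-⨾⟦⟧ʳ)
                  (htrans (⊕≋ σ-hexagon⟦⟧ hrefl) ⊕-⨾⟦⟧ˡ) ⟩
    _ ≋⟨ ⨾⟦⟧-assoc ⟩
    _ ≋⟨ ⨾⟦⟧-cong′ _ refl (hsym mid≋)
           (htrans (hsym ⨾⟦⟧-assoc) (⨾⟦⟧-cong′ _ refl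
             (htrans (⨾⟦⟧-cong′ _ refl
                (htrans (hsym ⊕-assoc) (⊕≋ id⊕id≋ hrefl))
                (htrans ⊕-assoc (⊕≋ hrefl id⊕id≋)))
                (htrans (hsym ⨾≋⨾⟦⟧) (≈⇒≋ split₂)))
             (htrans ⊕-assoc (hsym mid≋)))) ⟩
    _ ≋˘⟨ htrans ⨾≋⨾⟦⟧ (⨾⟦⟧-cong′ refl refl hrefl ⨾≋⨾⟦⟧) ⟩
    _ ∎)

  mid-σ : ∀ {A A′ B B′} →
          mid A A′ B B′ ⨾ (σ A B ⊕₁ σ A′ B′) ≈
          σ (A ⊕₀ A′) (B ⊕₀ B′) ⨾ mid B B′ A A′
  mid-σ = ≈-sym (≈-trans (⨾-cong σ-block ≈-refl) (≈-trans assoc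
    (⨾-cong ≈-refl (≈-trans assoc
      (≈-trans (⨾-cong ≈-refl mid-inverse) identityʳ)))))

  ⨾-congˡ : ∀ {A B D} {f : Hom A B} {g g′ : Hom B D} →
            g ≈ g′ → f ⨾ g ≈ f ⨾ g′
  ⨾-congˡ = ⨾-cong ≈-refl

  ⨾-congʳ : ∀ {A B D} {f f′ : Hom A B} {g : Hom B D} →
            f ≈ f′ → f ⨾ g ≈ f′ ⨾ g
  ⨾-congʳ p = ⨾-cong p ≈-refl

  pull : ∀ {A B D E} {f : Hom A B} {g : Hom B D} {h : Hom A D}
         {k : Hom D E} → f ⨾ g ≈ h → f ⨾ (g ⨾ k) ≈ h ⨾ k
  pull p = ≈-trans (≈-sym assoc) (⨾-congʳ p)

  exchange : ∀ {A B B′ D E} {f : Hom A B} {g : Hom B D} {f′ : Hom A B′}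
             {g′ : Hom B′ D} {k : Hom D E} →
             f ⨾ g ≈ f′ ⨾ g′ → f ⨾ (g ⨾ k) ≈ f′ ⨾ (g′ ⨾ k)
  exchange p = ≈-trans (pull p) assoc

  ⨾-id≋ : ∀ {A B D X} {f : Hom A B} {g : Hom B D} → g ≋ id {X} → f ⨾ g ≋ f
  ⨾-id≋ (≈⇒≋ p) = ≈⇒≋ (≈-trans (⨾-congˡ p) identityʳ)

  inverse≋ : ∀ {A B A′ B′} {f : Hom A B} {f⁻ : Hom B A} {g : Hom A′ B′}
             {g⁻ : Hom B′ A′} → f⁻ ⨾ f ≈ id → g ⨾ g⁻ ≈ id → f ≋ g → f⁻ ≋ g⁻
  inverse≋ p q (≈⇒≋ r) = ≈⇒≋ (≈-trans (≈-sym identityʳ) (≈-trans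
    (⨾-congˡ (≈-trans (≈-sym q) (⨾-congʳ (≈-sym r)))) (≈-trans
    (pull p) identityˡ)))

  ⊕-idˡ-⨾ : ∀ {A B D X} {f : Hom A B} {g : Hom B D} →
            (id {X} ⊕₁ f) ⨾ (id ⊕₁ g) ≈ id ⊕₁ (f ⨾ g)
  ⊕-idˡ-⨾ = ≈-trans (≈-sym ⊕-⨾) (⊕-cong identityˡ ≈-refl)

  ⊕-idʳ-⨾ : ∀ {A B D X} {f : Hom A B} {g : Hom B D} →
            (f ⊕₁ id {X}) ⨾ (g ⊕₁ id) ≈ (f ⨾ g) ⊕₁ id
  ⊕-idʳ-⨾ = ≈-trans (≈-sym ⊕-⨾) (⊕-cong ≈-refl identityˡ)

  id⊕mid-inverse : ∀ {X A B D E} →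
                   (id {X} ⊕₁ mid A B D E) ⨾ (id ⊕₁ mid A D B E) ≈ id
  id⊕mid-inverse = ≈-trans ⊕-idˡ-⨾ (≈-trans (⊕-cong ≈-refl mid-inverse) ⊕-id)

  mid⊕id-inverse : ∀ {X A B D E} →
                   (mid A B D E ⊕₁ id {X}) ⨾ (mid A D B E ⊕₁ id) ≈ id
  mid⊕id-inverse = ≈-trans ⊕-idʳ-⨾ (≈-trans (⊕-cong mid-inverse ≈-refl) ⊕-id)

  mid-coassoc : ∀ {A A′ B B′ C C′} →
    mid A (B ⊕₀ C) A′ (B′ ⊕₀ C′) ⨾ (id {A ⊕₀ A′} ⊕₁ mid B C B′ C′) ≋
    mid (A ⊕₀ B) C (A′ ⊕₀ B′) C′ ⨾ (mid A B A′ B′ ⊕₁ id {C ⊕₀ C′})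
  mid-coassoc = inverse≋
    (≈-trans assoc (≈-trans (⨾-congˡ (pull id⊕mid-inverse))
      (≈-trans (⨾-congˡ identityˡ) mid-inverse)))
    (≈-trans assoc (≈-trans (⨾-congˡ (pull mid-inverse))
      (≈-trans (⨾-congˡ identityˡ) mid⊕id-inverse)))
    mid-assoc

  mid-coσ : ∀ {A A′ B B′} →
            mid A A′ B B′ ⨾ σ (A ⊕₀ B) (A′ ⊕₀ B′) ≈
            (σ A A′ ⊕₁ σ B B′) ⨾ mid A′ A B′ B
  mid-coσ = ≈-trans (⨾-congˡ (≈-trans (≈-sym identityʳ)
    (≈-trans (⨾-congˡ (≈-sym mid-inverse)) (≈-trans
      (exchange (≈-sym mid-σ)) ≈-refl))))
    (≈-trans (pull mid-inverse) identityˡ)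

  mid-unit₁ : ∀ {A B} → mid I A I B ≋ id {A ⊕₀ B}
  mid-unit₁ = htrans mid≋ (htrans ⊕-identityˡ
    (htrans (⊕≋ σ-identityʳ hrefl) id⊕id≋))

  mid-unit₂ : ∀ {A B} → mid A I B I ≋ id {A ⊕₀ B}
  mid-unit₂ = htrans mid≋ (htrans (⊕≋ hrefl (htrans ⊕-identityʳ σ-identityˡ))
    id⊕id≋)

record Comonoid (S : StrictSMC o ℓ e) (A : StrictSMC.Obj S) :
                Set (ℓ ⊔ e) where
  open StrictSMC S
  field
    Δ : Hom A (A ⊕₀ A)
    ! : Hom A I
    Δ-assoc     : Δ ⨾ (Δ ⊕₁ id) ≋ Δ ⨾ (id ⊕₁ Δ)
    Δ-identityˡ : Δ ⨾ (! ⊕₁ id) ≋ id {A}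
    Δ-identityʳ : Δ ⨾ (id ⊕₁ !) ≋ id {A}
    Δ-comm      : Δ ⨾ σ A A ≈ Δ

-- The unit is written ¿ since Agda reserves the question mark.
record Monoid (S : StrictSMC o ℓ e) (A : StrictSMC.Obj S) :
              Set (ℓ ⊔ e) where
  open StrictSMC S
  field
    ∇ : Hom (A ⊕₀ A) A
    ¿ : Hom I A
    ∇-assoc     : (∇ ⊕₁ id) ⨾ ∇ ≋ (id ⊕₁ ∇) ⨾ ∇
    ∇-identityˡ : (¿ ⊕₁ id) ⨾ ∇ ≋ id {A}
    ∇-identityʳ : (id ⊕₁ ¿) ⨾ ∇ ≋ id {A}
    ∇-comm      : σ A A ⨾ ∇ ≈ ∇

module ComonoidProperties {o ℓ e : Level} (S : StrictSMC o ℓ e) where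
  open StrictSMC S
  open HetProperties category
  open SMCProperties S
  open Comonoid

  unitComonoid : Comonoid S I
  unitComonoid = record
    { Δ = coe u
    ; ! = id
    ; Δ-assoc = ⨾-cong≋ hrefl (htrans (⊕≋ (coe≋id u) hrefl)
        (htrans (⊕≋ hrefl (hsym (coe≋id u)))
        (≈⇒≋ ≈-refl)))
    ; Δ-identityˡ = htrans (⨾-id≋ id⊕id≋) (coe≋id u)
    ; Δ-identityʳ = htrans (⨾-id≋ id⊕id≋) (coe≋id u)
    ; Δ-comm = ≋⇒≈ (⨾-id≋ (σ-identityˡ {I}))
    }
    where
    u : I ≡ I ⊕₀ I
    u = sym (⊕₀-identityˡ I)

  _⊕Δ_ : ∀ {A B} → Hom A (A ⊕₀ A) → Hom B (B ⊕₀ B) →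
         Hom (A ⊕₀ B) ((A ⊕₀ B) ⊕₀ (A ⊕₀ B))
  _⊕Δ_ {A} {B} δ δ′ = (δ ⊕₁ δ′) ⨾ mid A A B B

  _⊕!_ : ∀ {A B} → Hom A I → Hom B I → Hom (A ⊕₀ B) I
  ε ⊕! ε′ = (ε ⊕₁ ε′) ⨾ coe (⊕₀-identityˡ I)

  ⊕!≋ : ∀ {A B} {ε : Hom A I} {ε′ : Hom B I} → ε ⊕! ε′ ≋ ε ⊕₁ ε′
  ⊕!≋ = ⨾-coe (⊕₀-identityˡ I)

  ⊕Δ-cong : ∀ {A B} {δ δ₁ : Hom A (A ⊕₀ A)} {δ′ δ₁′ : Hom B (B ⊕₀ B)} →
            δ ≈ δ₁ → δ′ ≈ δ₁′ → δ ⊕Δ δ′ ≈ δ₁ ⊕Δ δ₁′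
  ⊕Δ-cong p q = ⨾-congʳ (⊕-cong p q)

  ⊕Δ-assoc : ∀ {A B D} {δ : Hom A (A ⊕₀ A)} {δ′ : Hom B (B ⊕₀ B)}
             {δ″ : Hom D (D ⊕₀ D)} →
             δ ⊕Δ (δ′ ⊕Δ δ″) ≋ (δ ⊕Δ δ′) ⊕Δ δ″
  ⊕Δ-assoc =
    _ ≋⟨ ≈⇒≋ (≈-trans (⨾-congʳ (≈-trans (⊕-cong (≈-sym identityʳ) ≈-refl) ⊕-⨾))
           assoc) ⟩
    _ ≋⟨ ⨾-cong≋ (hsym ⊕-assoc) mid-assoc ⟩
    _ ≋⟨ ≈⇒≋ (pull (≈-trans (≈-sym ⊕-⨾) (⊕-cong ≈-refl identityʳ))) ⟩
    _ ∎

  module _ {A B : Obj} (X : Comonoid S A) (Y : Comonoid S B) where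
    private
      δ : Hom (A ⊕₀ B) ((A ⊕₀ B) ⊕₀ (A ⊕₀ B))
      δ = Δ X ⊕Δ Δ Y

    ⊕Δ-⨾ : ∀ {P Q P′ Q′} {f : Hom A P} {g : Hom A Q} {f′ : Hom B P′}
           {g′ : Hom B Q′} →
           (Δ X ⊕Δ Δ Y) ⨾ ((f ⊕₁ f′) ⊕₁ (g ⊕₁ g′)) ≈
           ((Δ X ⨾ (f ⊕₁ g)) ⊕₁ (Δ Y ⨾ (f′ ⊕₁ g′))) ⨾ mid P Q P′ Q′
    ⊕Δ-⨾ = ≈-trans assoc (≈-trans (⨾-congˡ (≈-sym mid-natural))
      (pull (≈-sym ⊕-⨾)))

    private
      assocˡ : δ ⨾ (δ ⊕₁ id) ≈
               ((Δ X ⨾ (Δ X ⊕₁ id)) ⊕₁ (Δ Y ⨾ (Δ Y ⊕₁ id))) ⨾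
               (mid _ _ _ _ ⨾ (mid A A B B ⊕₁ id))
      assocˡ = ≈-trans (⨾-congˡ (≈-sym ⊕-idʳ-⨾))
        (≈-trans (pull (≈-trans (⨾-congˡ (⊕-cong ≈-refl (≈-sym ⊕-id))) ⊕Δ-⨾))
          assoc)

      assocʳ : δ ⨾ (id ⊕₁ δ) ≈
               ((Δ X ⨾ (id ⊕₁ Δ X)) ⊕₁ (Δ Y ⨾ (id ⊕₁ Δ Y))) ⨾
               (mid _ _ _ _ ⨾ (id ⊕₁ mid A A B B))
      assocʳ = ≈-trans (⨾-congˡ (≈-sym ⊕-idˡ-⨾))
        (≈-trans (pull (≈-trans (⨾-congˡ (⊕-cong (≈-sym ⊕-id) ≈-refl)) ⊕Δ-⨾))
          assoc)

    _⊕-comonoid_ : Comonoid S (A ⊕₀ B)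
    _⊕-comonoid_ = record
      { Δ = δ
      ; ! = ! X ⊕! ! Y
      ; Δ-assoc = htrans (≈⇒≋ assocˡ) (htrans
          (⨾-cong≋ (⊕≋ (Δ-assoc X) (Δ-assoc Y)) (hsym mid-coassoc))
          (hsym (≈⇒≋ assocʳ)))
      ; Δ-identityˡ = htrans (⨾-cong≋ hrefl (⊕≋ ⊕!≋ (hsym id⊕id≋)))
          (htrans (≈⇒≋ ⊕Δ-⨾) (htrans (⨾-id≋ mid-unit₁)
            (htrans (⊕≋ (Δ-identityˡ X) (Δ-identityˡ Y)) id⊕id≋)))
      ; Δ-identityʳ = htrans (⨾-cong≋ hrefl (⊕≋ (hsym id⊕id≋) ⊕!≋))
          (htrans (≈⇒≋ ⊕Δ-⨾) (htrans (⨾-id≋ mid-unit₂)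
            (htrans (⊕≋ (Δ-identityʳ X) (Δ-identityʳ Y)) id⊕id≋)))
      ; Δ-comm = ≈-trans assoc (≈-trans (⨾-congˡ mid-coσ)
          (pull (≈-trans (≈-sym ⊕-⨾) (⊕-cong (Δ-comm X) (Δ-comm Y)))))
      }

    σ-copy : σ A B ⨾ (Δ Y ⊕Δ Δ X) ≈ (Δ X ⊕Δ Δ Y) ⨾ (σ A B ⊕₁ σ A B)
    σ-copy = ≈-trans (exchange (≈-sym σ-natural))
      (≈-trans (⨾-congˡ (≈-sym mid-σ)) (≈-sym assoc))

  module _ {A : Obj} (X : Comonoid S A) where

    Δ-copy : Δ X ⨾ (Δ X ⊕Δ Δ X) ≈ Δ X ⨾ (Δ X ⊕₁ Δ X)
    Δ-copy = ≋⇒≈ (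
      _ ≋˘⟨ ≈⇒≋ assoc ⟩
      _ ≋⟨ ⨾-cong≋ four mid≋ ⟩
      _ ≋⟨ ≈⇒≋ assoc ⟩
      _ ≋⟨ ≈⇒≋ (⨾-congˡ (≈-trans ⊕-idˡ-⨾ (⊕-cong ≈-refl (≈-trans assoc
             (⨾-congˡ (≈-trans ⊕-idʳ-⨾ (⊕-cong (Δ-comm X) ≈-refl))))))) ⟩
      _ ≋˘⟨ four ⟩
      _ ∎)
      where
      four : Δ X ⨾ (Δ X ⊕₁ Δ X) ≋
             Δ X ⨾ (id ⊕₁ (Δ X ⨾ (Δ X ⊕₁ id)))
      four =
        _ ≋˘⟨ ≈⇒≋ (⨾-congˡ split₁) ⟩
        _ ≋˘⟨ ≈⇒≋ assoc ⟩
        _ ≋⟨ ⨾-cong≋ (Δ-assoc X) (htrans (⊕≋ (hsym id⊕id≋) hrefl) ⊕-assoc) ⟩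
        _ ≋⟨ ≈⇒≋ assoc ⟩
        _ ≋⟨ ≈⇒≋ (⨾-congˡ ⊕-idˡ-⨾) ⟩
        _ ≋˘⟨ ⨾-cong≋ hrefl (⊕≋ hrefl (Δ-assoc X)) ⟩
        _ ∎

    Δ-discard : Δ X ⨾ (! X ⊕₁ ! X) ≋ ! X
    Δ-discard =
      _ ≋˘⟨ ≈⇒≋ (⨾-congˡ split₁) ⟩
      _ ≋˘⟨ ≈⇒≋ assoc ⟩
      _ ≋⟨ ⨾-cong≋ (Δ-identityˡ X) ⊕-identityˡ ⟩
      _ ≋⟨ ≈⇒≋ identityˡ ⟩
      _ ∎

opposite : StrictSMC o ℓ e → StrictSMC o ℓ e
opposite S = record
  { category = op
  ; I = I
  ; _⊕₀_ = _⊕₀_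
  ; ⊕₀-assoc = ⊕₀-assoc
  ; ⊕₀-identityˡ = ⊕₀-identityˡ
  ; ⊕₀-identityʳ = ⊕₀-identityʳ
  ; _⊕₁_ = _⊕₁_
  ; ⊕-cong = ⊕-cong
  ; ⊕-id = ⊕-id
  ; ⊕-⨾ = ⊕-⨾
  ; ⊕-assoc = to-op ⊕-assoc
  ; ⊕-identityˡ = to-op ⊕-identityˡ
  ; ⊕-identityʳ = to-op ⊕-identityʳ
  ; σ = λ A B → σ B A
  ; σ-natural = ≈-sym σ-natural
  ; σ-involutive = σ-involutive
  ; σ-hexagon = λ {A} {B} {C} → to-op (htrans σ-hexagon′ (htrans ⨾⟦⟧≋⨾[]
      (≈⇒≋ (≈-trans (⨾-cong ≈-refl (⨾-cong (coe-sym (⊕₀-assoc B A C)) ≈-refl))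
        (≈-sym assoc)))))
  }
  where
  open StrictSMC S
  open HetProperties category
  open SMCProperties S
  op : Category _ _ _
  op = record
    { Obj = Obj
    ; Hom = λ A B → Hom B A
    ; _≈_ = _≈_
    ; id = id
    ; _⨾_ = λ f g → g ⨾ f
    ; isEquivalence = isEquivalence
    ; ⨾-cong = λ p q → ⨾-cong q p
    ; identityˡ = identityʳ
    ; identityʳ = identityˡ
    ; assoc = ≈-sym assoc
    }
  to-op : ∀ {A B A′ B′} {f : Hom A B} {g : Hom A′ B′} →
          f ≋ g → Category._≋_ op f g
  to-op (≈⇒≋ p) = Category.≈⇒≋ p
  coe-sym : ∀ {A B} (p : A ≡ B) → coe (sym p) ≈ Category.coe op p
  coe-sym refl = ≈-refl

module MonoidProperties {o ℓ e : Level} (S : StrictSMC o ℓ e) where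
  open StrictSMC S
  open HetProperties category
  open SMCProperties S
  private
    module Op = StrictSMC (opposite S)
    module OpH = HetProperties Op.category
    module OpC = ComonoidProperties (opposite S)

    to-op : ∀ {A B A′ B′} {f : Hom A B} {g : Hom A′ B′} → f ≋ g → f Op.≋ g
    to-op (≈⇒≋ p) = Op.≈⇒≋ p

    from-op : ∀ {A B A′ B′} {f : Hom A B} {g : Hom A′ B′} → f Op.≋ g → f ≋ g
    from-op (Op.≈⇒≋ p) = ≈⇒≋ p

    op-monoid : ∀ {A} → Monoid S A → Comonoid (opposite S) A
    op-monoid M = record
      { Δ = ∇ ; ! = ¿
      ; Δ-assoc = to-op ∇-assoc
      ; Δ-identityˡ = to-op ∇-identityˡ
      ; Δ-identityʳ = to-op ∇-identityʳ
      ; Δ-comm = ∇-comm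
      }
      where open Monoid M

    monoid-op : ∀ {A} → Comonoid (opposite S) A → Monoid S A
    monoid-op X = record
      { ∇ = Δ ; ¿ = !
      ; ∇-assoc = from-op Δ-assoc
      ; ∇-identityˡ = from-op Δ-identityˡ
      ; ∇-identityʳ = from-op Δ-identityʳ
      ; ∇-comm = Δ-comm
      }
      where open Comonoid X

    mid-op : ∀ {A B D E} → Op.mid A B D E ≈ mid A D B E
    mid-op {A} {B} {D} {E} = ≋⇒≈ (htrans
      (from-op (SMCProperties.mid≋ (opposite S) {A} {B} {D} {E})) (hsym mid≋))

  resp-monoid : ∀ {A} (M : Monoid S A) {μ η} →
                μ ≈ Monoid.∇ M → η ≈ Monoid.¿ M → Monoid S A
  resp-monoid M {μ} {η} p q = record
    { ∇ = μ ; ¿ = η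
    ; ∇-assoc = htrans (≈⇒≋ (⨾-cong (⊕-cong p ≈-refl) p))
        (htrans ∇-assoc (≈⇒≋ (≈-sym (⨾-cong (⊕-cong ≈-refl p) p))))
    ; ∇-identityˡ = htrans (≈⇒≋ (⨾-cong (⊕-cong q ≈-refl) p)) ∇-identityˡ
    ; ∇-identityʳ = htrans (≈⇒≋ (⨾-cong (⊕-cong ≈-refl q) p)) ∇-identityʳ
    ; ∇-comm = ≈-trans (⨾-congˡ p) (≈-trans ∇-comm (≈-sym p))
    }
    where open Monoid M

  resp-comonoid : ∀ {A} (X : Comonoid S A) {δ ε} →
                  δ ≈ Comonoid.Δ X → ε ≈ Comonoid.! X → Comonoid S A
  resp-comonoid X {δ} {ε} p q = record
    { Δ = δ ; ! = ε
    ; Δ-assoc = htrans (≈⇒≋ (⨾-cong p (⊕-cong p ≈-refl)))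
        (htrans Δ-assoc (≈⇒≋ (≈-sym (⨾-cong p (⊕-cong ≈-refl p)))))
    ; Δ-identityˡ = htrans (≈⇒≋ (⨾-cong p (⊕-cong q ≈-refl))) Δ-identityˡ
    ; Δ-identityʳ = htrans (≈⇒≋ (⨾-cong p (⊕-cong ≈-refl q))) Δ-identityʳ
    ; Δ-comm = ≈-trans (⨾-congʳ p) (≈-trans Δ-comm (≈-sym p))
    }
    where open Comonoid X

  _⊕∇_ : ∀ {A B} → Hom (A ⊕₀ A) A → Hom (B ⊕₀ B) B →
         Hom ((A ⊕₀ B) ⊕₀ (A ⊕₀ B)) (A ⊕₀ B)
  _⊕∇_ {A} {B} μ μ′ = mid A B A B ⨾ (μ ⊕₁ μ′)

  ⊕∇-cong : ∀ {A B} {μ μ₁ : Hom (A ⊕₀ A) A} {μ′ μ₁′ : Hom (B ⊕₀ B) B} →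
            μ ≈ μ₁ → μ′ ≈ μ₁′ → μ ⊕∇ μ′ ≈ μ₁ ⊕∇ μ₁′
  ⊕∇-cong p q = ⨾-congˡ (⊕-cong p q)

  ⊕∇-assoc : ∀ {A B D} {μ : Hom (A ⊕₀ A) A} {μ′ : Hom (B ⊕₀ B) B}
             {μ″ : Hom (D ⊕₀ D) D} →
             μ ⊕∇ (μ′ ⊕∇ μ″) ≋ (μ ⊕∇ μ′) ⊕∇ μ″
  ⊕∇-assoc =
    _ ≋⟨ ≈⇒≋ (≈-trans (⨾-congˡ (≈-trans (⊕-cong (≈-sym identityˡ) ≈-refl) ⊕-⨾))
           (≈-sym assoc)) ⟩
    _ ≋⟨ ⨾-cong≋ mid-coassoc (hsym ⊕-assoc) ⟩
    _ ≋⟨ ≈⇒≋ (≈-trans assoc (⨾-congˡ (≈-trans (≈-sym ⊕-⨾)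
           (⊕-cong ≈-refl identityˡ)))) ⟩
    _ ∎

  _⊕¿_ : ∀ {A B} → Hom I A → Hom I B → Hom I (A ⊕₀ B)
  η ⊕¿ η′ = coe (sym (⊕₀-identityˡ I)) ⨾ (η ⊕₁ η′)

  ⊕¿≋ : ∀ {A B} {η : Hom I A} {η′ : Hom I B} → η ⊕¿ η′ ≋ η ⊕₁ η′
  ⊕¿≋ = coe-⨾ (sym (⊕₀-identityˡ I))

  unitMonoid : Monoid S I
  unitMonoid = resp-monoid (monoid-op OpC.unitComonoid) {coe u} {id}
    (≋⇒≈ (htrans (coe≋id′ u) (hsym (from-op (OpH.coe≋id (sym u)))))) ≈-refl
    where
    u : I ⊕₀ I ≡ I
    u = ⊕₀-identityˡ I

  _⊕-monoid_ : ∀ {A B} → Monoid S A → Monoid S B → Monoid S (A ⊕₀ B)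
  M ⊕-monoid N = resp-monoid
    (monoid-op (op-monoid M OpC.⊕-comonoid op-monoid N))
    {∇ M ⊕∇ ∇ N} {¿ M ⊕¿ ¿ N}
    (⨾-congʳ (≈-sym mid-op))
    (≋⇒≈ (htrans ⊕¿≋ (hsym (from-op (OpC.⊕!≋ {ε = ¿ M} {ε′ = ¿ N})))))
    where open Monoid

  ∇-merge : ∀ {A} (M : Monoid S A) → let open Monoid M in
            (∇ ⊕∇ ∇) ⨾ ∇ ≈ (∇ ⊕₁ ∇) ⨾ ∇
  ∇-merge M = ≈-trans (⨾-congʳ (⨾-congʳ (≈-sym mid-op)))
    (OpC.Δ-copy (op-monoid M))

  ¿-merge : ∀ {A} (M : Monoid S A) → let open Monoid M in
            (¿ ⊕₁ ¿) ⨾ ∇ ≋ ¿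
  ¿-merge M = from-op (OpC.Δ-discard (op-monoid M))

record OrderedSMC (o ℓ e r : Level) : Set (lsuc (o ⊔ ℓ ⊔ e ⊔ r)) where
  infix 4 _≤_
  field
    smc : StrictSMC o ℓ e
  open StrictSMC smc public
  field
    _≤_ : ∀ {A B} → Hom A B → Hom A B → Set r
    isPartialOrder : ∀ {A B} → IsPartialOrder (_≈_ {A} {B}) _≤_
    ⨾-mono : ∀ {A B C} {f f′ : Hom A B} {g g′ : Hom B C} →
             f ≤ f′ → g ≤ g′ → f ⨾ g ≤ f′ ⨾ g′
    ⊕-mono : ∀ {A B C D} {f f′ : Hom A B} {g g′ : Hom C D} →
             f ≤ f′ → g ≤ g′ → f ⊕₁ g ≤ f′ ⊕₁ g′

  open module ≤ {A B : Obj} = IsPartialOrder (isPartialOrder {A} {B}) public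
    renaming (refl to ≤-refl; trans to ≤-trans; antisym to ≤-antisym;
              reflexive to ≈⇒≤)
    using ()

record FrobeniusStructure (O : OrderedSMC o ℓ e r) (A : OrderedSMC.Obj O) :
                          Set (ℓ ⊔ e ⊔ r) where
  open OrderedSMC O
  field
    comonoid : Comonoid smc A
    monoid   : Monoid smc A
  open Comonoid comonoid public
  open Monoid monoid public
  field
    ∇Δ≤id : ∇ ⨾ Δ ≤ id
    id≤Δ∇ : id ≤ Δ ⨾ ∇
    ¿!≤id : ¿ ⨾ ! ≤ id
    id≤!¿ : id ≤ ! ⨾ ¿
    frobeniusˡ : (Δ ⊕₁ id) ⨾[ ⊕₀-assoc A A A ] (id ⊕₁ ∇) ≈ ∇ ⨾ Δ
    frobeniusʳ : (id ⊕₁ Δ) ⨾[ sym (⊕₀-assoc A A A) ] (∇ ⊕₁ id) ≈ ∇ ⨾ Δ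

record CartesianBicategory (o ℓ e r : Level) : Set (lsuc (o ⊔ ℓ ⊔ e ⊔ r)) where
  field
    orderedSMC : OrderedSMC o ℓ e r
  open OrderedSMC orderedSMC public
  field
    frobenius : ∀ A → FrobeniusStructure orderedSMC A
  module Frobenius (A : Obj) = FrobeniusStructure (frobenius A)
  open Frobenius public using (Δ; !; ∇; ¿)
  field
    Δ-⊕ : ∀ A B → Δ (A ⊕₀ B) ≈ (Δ A ⊕₁ Δ B) ⨾ mid A A B B
    !-⊕ : ∀ A B → ! (A ⊕₀ B) ≋ ! A ⊕₁ ! B
    ∇-⊕ : ∀ A B → ∇ (A ⊕₀ B) ≈ mid A B A B ⨾ (∇ A ⊕₁ ∇ B)
    ¿-⊕ : ∀ A B → ¿ (A ⊕₀ B) ≋ ¿ A ⊕₁ ¿ B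
    Δ-lax : ∀ {A B} (R : Hom A B) → R ⨾ Δ B ≤ Δ A ⨾ (R ⊕₁ R)
    !-lax : ∀ {A B} (R : Hom A B) → R ⨾ ! B ≤ ! A

module FrobeniusProperties {o ℓ e r : Level} (O : OrderedSMC o ℓ e r) where
  open OrderedSMC O
  open HetProperties category
  open SMCProperties smc
  open ComonoidProperties smc
  open MonoidProperties smc
  open FrobeniusStructure

  ⨾-monoˡ : ∀ {A B D} {f : Hom A B} {g g′ : Hom B D} →
            g ≤ g′ → f ⨾ g ≤ f ⨾ g′
  ⨾-monoˡ = ⨾-mono ≤-refl

  ⨾-monoʳ : ∀ {A B D} {f f′ : Hom A B} {g : Hom B D} →
            f ≤ f′ → f ⨾ g ≤ f′ ⨾ g
  ⨾-monoʳ p = ⨾-mono p ≤-refl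

  ≤-respˡ : ∀ {A B} {f f′ g : Hom A B} → f ≈ f′ → f′ ≤ g → f ≤ g
  ≤-respˡ p q = ≤-trans (≈⇒≤ p) q

  ≤-respʳ : ∀ {A B} {f g g′ : Hom A B} → f ≤ g′ → g ≈ g′ → f ≤ g
  ≤-respʳ p q = ≤-trans p (≈⇒≤ (≈-sym q))

  resp-frobenius : ∀ {A} (X : FrobeniusStructure O A) {δ ε μ η} →
                   δ ≈ Δ X → ε ≈ ! X → μ ≈ ∇ X → η ≈ ¿ X →
                   FrobeniusStructure O A
  resp-frobenius X {δ} {ε} {μ} {η} p q p′ q′ = record
    { comonoid = resp-comonoid (comonoid X) p q
    ; monoid   = resp-monoid (monoid X) p′ q′
    ; ∇Δ≤id = ≤-respˡ (⨾-cong p′ p) (∇Δ≤id X)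
    ; id≤Δ∇ = ≤-respʳ (id≤Δ∇ X) (⨾-cong p p′)
    ; ¿!≤id = ≤-respˡ (⨾-cong q′ q) (¿!≤id X)
    ; id≤!¿ = ≤-respʳ (id≤!¿ X) (⨾-cong q q′)
    ; frobeniusˡ = ≈-trans
        (⨾-cong (⊕-cong p ≈-refl) (⨾-congˡ (⊕-cong ≈-refl p′)))
        (≈-trans (frobeniusˡ X) (≈-sym (⨾-cong p′ p)))
    ; frobeniusʳ = ≈-trans
        (⨾-cong (⊕-cong ≈-refl p) (⨾-congˡ (⊕-cong p′ ≈-refl)))
        (≈-trans (frobeniusʳ X) (≈-sym (⨾-cong p′ p)))
    }

  unitFrobenius : FrobeniusStructure O I
  unitFrobenius = record
    { comonoid = unitComonoid
    ; monoid = unitMonoid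
    ; ∇Δ≤id = ≈⇒≤ (≋⇒≈ (htrans (⨾-coe (sym u)) (coe≋id u)))
    ; id≤Δ∇ = ≈⇒≤ (≈-sym (≋⇒≈ (htrans (⨾-coe u) (coe≋id (sym u)))))
    ; ¿!≤id = ≈⇒≤ identityˡ
    ; id≤!¿ = ≈⇒≤ (≈-sym identityˡ)
    ; frobeniusˡ = ≋⇒≈ (htrans (hsym (⨾⟦⟧≋⨾[] {p = ⊕₀-assoc I I I})) (htrans
        (⨾⟦⟧-cong (htrans (⊕≋ (coe≋id (sym u)) hrefl) id⊕id≋) hrefl)
        (htrans idˡ≋ (htrans ⊕-identityˡ
          (hsym (⨾-coe (sym u)))))))
    ; frobeniusʳ = ≋⇒≈ (htrans (hsym (⨾⟦⟧≋⨾[] {p = sym (⊕₀-assoc I I I)})) (htrans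
        (⨾⟦⟧-cong (htrans (⊕≋ hrefl (coe≋id (sym u))) id⊕id≋) hrefl)
        (htrans idˡ≋ (htrans ⊕-identityʳ
          (hsym (⨾-coe (sym u)))))))
    }
    where
    u : I ⊕₀ I ≡ I
    u = ⊕₀-identityˡ I

  module _ {A B : Obj} (X : FrobeniusStructure O A)
           (Y : FrobeniusStructure O B) where
    private
      δ : Hom (A ⊕₀ B) ((A ⊕₀ B) ⊕₀ (A ⊕₀ B))
      δ = Δ X ⊕Δ Δ Y
      μ : Hom ((A ⊕₀ B) ⊕₀ (A ⊕₀ B)) (A ⊕₀ B)
      μ = ∇ X ⊕∇ ∇ Y

      between : μ ⨾ δ ≈ mid A B A B ⨾
                (((∇ X ⨾ Δ X) ⊕₁ (∇ Y ⨾ Δ Y)) ⨾ mid A A B B)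
      between = ≈-trans assoc (⨾-congˡ (pull (≈-sym ⊕-⨾)))

      u : I ⊕₀ I ≡ I
      u = ⊕₀-identityˡ I

      -- conjugating a commuting square by inverses of two of its sides
      conjugate : ∀ {P Q R T U V} {M : Hom Q P} {M⁻ : Hom P Q} {m : Hom P R}
                  {c′ : Hom R T} {c : Hom Q U} {N : Hom U V} {n : Hom V T}
                  {n⁻ : Hom T V} → M ⨾ (m ⨾ c′) ≈ c ⨾ (N ⨾ n) →
                  M⁻ ⨾ M ≈ id → n ⨾ n⁻ ≈ id →
                  M⁻ ⨾ (c ⨾ N) ≈ m ⨾ (c′ ⨾ n⁻)
      conjugate sq p q =
        ≈-trans (⨾-congˡ (⨾-congˡ (≈-trans (≈-sym identityʳ)
          (⨾-congˡ (≈-sym q)))))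
        (≈-trans (⨾-congˡ (≈-trans (⨾-congˡ (≈-sym assoc))
          (≈-trans (≈-sym assoc) (⨾-congʳ (≈-sym sq)))))
        (≈-trans (≈-sym assoc) (≈-trans (⨾-congʳ (≈-trans (pull p) identityˡ))
          assoc)))

      assemble : ∀ {P₁ P₂ P₃ P₄ P₅ P₆ P₇ P₈ P₉ P₁₀}
        {P : Hom P₁ P₂} {M : Hom P₂ P₃} {c : Hom P₃ P₄} {N : Hom P₄ P₅}
        {Q : Hom P₅ P₆} {m : Hom P₂ P₇} {c′ : Hom P₇ P₈} {n : Hom P₈ P₅}
        {m₀ : Hom P₁ P₉} {P′ : Hom P₉ P₇} {Q′ : Hom P₈ P₁₀} {n₀ : Hom P₁₀ P₆}
        {F : Hom P₉ P₁₀} →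
        M ⨾ (c ⨾ N) ≈ m ⨾ (c′ ⨾ n) → P ⨾ m ≈ m₀ ⨾ P′ → n ⨾ Q ≈ Q′ ⨾ n₀ →
        P′ ⨾ (c′ ⨾ Q′) ≈ F →
        (P ⨾ M) ⨾ (c ⨾ (N ⨾ Q)) ≈ m₀ ⨾ (F ⨾ n₀)
      assemble {P = P} {M} {c} {N} {Q} {m} {c′} {n} {m₀} {P′} {Q′} {n₀} p q r t =
        ≋⇒≈ (
        _ ≋⟨ ≈⇒≋ assoc ⟩
        P ⨾ (M ⨾ (c ⨾ (N ⨾ Q)))
          ≋⟨ ≈⇒≋ (⨾-congˡ (≈-trans (⨾-congˡ (≈-sym assoc)) (pull p))) ⟩
        P ⨾ ((m ⨾ (c′ ⨾ n)) ⨾ Q)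
          ≋⟨ ≈⇒≋ (⨾-congˡ (≈-trans assoc (⨾-congˡ (≈-trans assoc
               (⨾-congˡ r))))) ⟩
        P ⨾ (m ⨾ (c′ ⨾ (Q′ ⨾ n₀)))
          ≋⟨ ≈⇒≋ (exchange q) ⟩
        m₀ ⨾ (P′ ⨾ (c′ ⨾ (Q′ ⨾ n₀)))
          ≋⟨ ≈⇒≋ (⨾-congˡ (≈-trans (⨾-congˡ (≈-sym assoc)) (pull t))) ⟩
        _ ∎)

      AB : Obj
      AB = A ⊕₀ B

      ⊕a : ((A ⊕₀ A) ⊕₀ A) ⊕₀ ((B ⊕₀ B) ⊕₀ B) ≡
           (A ⊕₀ (A ⊕₀ A)) ⊕₀ (B ⊕₀ (B ⊕₀ B))
      ⊕a = cong₂ _⊕₀_ (⊕₀-assoc A A A) (⊕₀-assoc B B B)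

      ⊕a⁻ : (A ⊕₀ (A ⊕₀ A)) ⊕₀ (B ⊕₀ (B ⊕₀ B)) ≡
            ((A ⊕₀ A) ⊕₀ A) ⊕₀ ((B ⊕₀ B) ⊕₀ B)
      ⊕a⁻ = cong₂ _⊕₀_ (sym (⊕₀-assoc A A A)) (sym (⊕₀-assoc B B B))

      coe-⊕ : ∀ {P Q P′ Q′} (p : P ≡ Q) (q : P′ ≡ Q′) →
              coe (cong₂ _⊕₀_ p q) ≈ coe p ⊕₁ coe q
      coe-⊕ refl refl = ≈-sym ⊕-id

      parallel : ∀ {P P₁ P₂ P₃ Q Q₁ Q₂ Q₃} {f : Hom P P₁} {g : Hom P₂ P₃}
                 {f′ : Hom Q Q₁} {g′ : Hom Q₂ Q₃} {h h′}
                 (p : P₁ ≡ P₂) (q : Q₁ ≡ Q₂) →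
                 f ⨾[ p ] g ≈ h → f′ ⨾[ q ] g′ ≈ h′ →
                 (f ⊕₁ f′) ⨾ (coe (cong₂ _⊕₀_ p q) ⨾ (g ⊕₁ g′)) ≈ h ⊕₁ h′
      parallel p q s t = ≈-trans
        (⨾-congˡ (≈-trans (⨾-congʳ (coe-⊕ p q)) (≈-sym ⊕-⨾)))
        (≈-trans (≈-sym ⊕-⨾) (⊕-cong s t))

      frobˡ : (δ ⊕₁ id) ⨾[ ⊕₀-assoc AB AB AB ] (id ⊕₁ μ) ≈ μ ⨾ δ
      frobˡ = ≈-trans (⨾-cong
        (≈-sym (≈-trans (⨾-congʳ (⊕-cong ≈-refl ⊕-id)) ⊕-idʳ-⨾))
        (⨾-congˡ (≈-sym (≈-trans (⨾-congˡ (⊕-cong ⊕-id ≈-refl)) ⊕-idˡ-⨾))))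
        (≈-trans (assemble
          (conjugate (≋⇒≈ (htrans (⨾-cong≋ hrefl (⨾-coe ⊕a))
              (htrans (hsym mid-assoc) (hsym (coe-⨾ (⊕₀-assoc AB AB AB))))))
            mid⊕id-inverse mid-inverse)
          mid-natural (≈-sym mid-natural)
          (parallel (⊕₀-assoc A A A) (⊕₀-assoc B B B)
            (frobeniusˡ X) (frobeniusˡ Y)))
        (≈-sym between))

      frobʳ : (id ⊕₁ δ) ⨾[ sym (⊕₀-assoc AB AB AB) ] (μ ⊕₁ id) ≈ μ ⨾ δ
      frobʳ = ≈-trans (⨾-cong
        (≈-sym (≈-trans (⨾-congʳ (⊕-cong ⊕-id ≈-refl)) ⊕-idˡ-⨾))
        (⨾-congˡ (≈-sym (≈-trans (⨾-congˡ (⊕-cong ≈-refl ⊕-id)) ⊕-idʳ-⨾))))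
        (≈-trans (assemble
          (conjugate (≋⇒≈ (htrans (⨾-cong≋ hrefl (⨾-coe ⊕a⁻))
              (htrans mid-assoc (hsym (coe-⨾ (sym (⊕₀-assoc AB AB AB)))))))
            id⊕mid-inverse mid-inverse)
          mid-natural (≈-sym mid-natural)
          (parallel (sym (⊕₀-assoc A A A)) (sym (⊕₀-assoc B B B))
            (frobeniusʳ X) (frobeniusʳ Y)))
        (≈-sym between))

    _⊕-frobenius_ : FrobeniusStructure O (A ⊕₀ B)
    _⊕-frobenius_ = record
      { comonoid = comonoid X ⊕-comonoid comonoid Y
      ; monoid = monoid X ⊕-monoid monoid Y
      ; ∇Δ≤id = ≤-respˡ between (≤-respʳ
          (⨾-monoˡ (⨾-monoʳ (≤-trans (⊕-mono (∇Δ≤id X) (∇Δ≤id Y))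
            (≈⇒≤ ⊕-id))))
          (≈-sym (≈-trans (⨾-congˡ identityˡ) mid-inverse)))
      ; id≤Δ∇ = ≤-respʳ (≤-respˡ (≈-sym ⊕-id)
          (⊕-mono (id≤Δ∇ X) (id≤Δ∇ Y)))
          (≈-trans assoc (≈-trans (⨾-congˡ (≈-trans (pull mid-inverse)
            identityˡ)) (≈-sym ⊕-⨾)))
      ; ¿!≤id = ≤-respˡ
          (≈-trans assoc (⨾-congˡ (pull (≈-sym ⊕-⨾))))
          (≤-respʳ
            (⨾-monoˡ (⨾-monoʳ (≤-trans (⊕-mono (¿!≤id X) (¿!≤id Y))
              (≈⇒≤ ⊕-id))))
            (≋⇒≈ (hsym (htrans (coe-⨾ (sym u))
              (htrans (≈⇒≋ identityˡ) (coe≋id′ u))))))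
      ; id≤!¿ = ≤-respʳ (≤-respˡ (≈-sym ⊕-id)
          (⊕-mono (id≤!¿ X) (id≤!¿ Y)))
          (≈-trans (≋⇒≈ (⨾-cong≋ ⊕!≋ ⊕¿≋)) (≈-sym ⊕-⨾))
      ; frobeniusˡ = frobˡ
      ; frobeniusʳ = frobʳ
      }

  module _ {A : Obj} (X : FrobeniusStructure O A) where
    private
      ε : Hom (A ⊕₀ A) I
      ε = ! X ⊕! ! X

    ∇-Δ-lax : ∇ X ⨾ Δ X ≤ (Δ X ⊕Δ Δ X) ⨾ (∇ X ⊕₁ ∇ X)
    ∇-Δ-lax = ≤-respˡ (≈-sym identityˡ) (≤-trans
      (⨾-monoʳ (id≤Δ∇ (X ⊕-frobenius X)))
      (≤-respˡ (≈-trans assoc (⨾-congˡ (≈-trans (pull (∇-merge (monoid X)))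
        assoc)))
      (⨾-monoˡ (≤-trans (⨾-monoˡ (∇Δ≤id X)) (≈⇒≤ identityʳ)))))

    ∇-!-lax : ∇ X ⨾ ! X ≤ ε
    ∇-!-lax = ≤-respˡ (≈-sym identityˡ) (≤-trans
      (⨾-monoʳ (id≤!¿ (X ⊕-frobenius X)))
      (≤-respˡ (≈-trans assoc (⨾-congˡ (pull (≋⇒≈
        (htrans (⨾-cong≋ ⊕¿≋ hrefl) (¿-merge (monoid X)))))))
      (≤-trans (⨾-monoˡ (¿!≤id X)) (≈⇒≤ identityʳ))))

    ¿-Δ-lax : ¿ X ⨾ Δ X ≤ ¿ X ⊕¿ ¿ X
    ¿-Δ-lax = ≤-respˡ (≈-sym identityʳ) (≤-trans
      (⨾-monoˡ (id≤!¿ (X ⊕-frobenius X)))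
      (≤-respˡ (≈-trans assoc (≈-trans (⨾-congˡ (pull (≋⇒≈
        (htrans (⨾-cong≋ hrefl ⊕!≋) (Δ-discard (comonoid X))))))
        (≈-sym assoc)))
      (≤-trans (⨾-monoʳ (¿!≤id X)) (≈⇒≤ identityˡ))))

record IsCartesian (S : StrictSMC o ℓ e) : Set (o ⊔ ℓ ⊔ e) where
  open StrictSMC S
  field
    !        : ∀ {A} → Hom A I
    !-unique : ∀ {A} (f : Hom A I) → f ≈ !

  π₁ : ∀ A B → Hom (A ⊕₀ B) A
  π₁ A B = (id {A} ⊕₁ ! {B}) ⨾ coe (⊕₀-identityʳ A)

  π₂ : ∀ A B → Hom (A ⊕₀ B) B
  π₂ A B = (! {A} ⊕₁ id {B}) ⨾ coe (⊕₀-identityˡ B)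

  field
    ⟨_,_⟩    : ∀ {X A B} → Hom X A → Hom X B → Hom X (A ⊕₀ B)
    project₁ : ∀ {X A B} (f : Hom X A) (g : Hom X B) →
               ⟨ f , g ⟩ ⨾ π₁ A B ≈ f
    project₂ : ∀ {X A B} (f : Hom X A) (g : Hom X B) →
               ⟨ f , g ⟩ ⨾ π₂ A B ≈ g
    unique   : ∀ {X A B} (f : Hom X A) (g : Hom X B) (h : Hom X (A ⊕₀ B)) →
               h ⨾ π₁ A B ≈ f → h ⨾ π₂ A B ≈ g → h ≈ ⟨ f , g ⟩

record CartesianCategory (o ℓ e : Level) : Set (lsuc (o ⊔ ℓ ⊔ e)) where
  field
    smc         : StrictSMC o ℓ e
    isCartesian : IsCartesian smc
  open StrictSMC smc public
  open IsCartesian isCartesian public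

-- A strict symmetric monoidal category with natural comonoids is cartesian.
module Fox {o ℓ e : Level} (S : StrictSMC o ℓ e)
           (X : ∀ A → Comonoid S A) where
  open StrictSMC S
  open HetProperties category
  open SMCProperties S
  open Comonoid

  module _ (Δ-⊕ : ∀ A B → Δ (X (A ⊕₀ B)) ≈
                          (Δ (X A) ⊕₁ Δ (X B)) ⨾ mid A A B B)
           (Δ-natural : ∀ {A B} (f : Hom A B) →
                        f ⨾ Δ (X B) ≈ Δ (X A) ⨾ (f ⊕₁ f))
           (!-natural : ∀ {A B} (f : Hom A B) → f ⨾ ! (X B) ≈ ! (X A))
           where
    private
      !-I : ! (X I) ≈ id
      !-I = ≈-trans (≈-sym identityˡ) (≈-trans (⨾-congʳ (≈-sym inverse))
        (≈-trans assoc (≈-trans (⨾-congˡ (≈-trans assoc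
          (⨾-congˡ (!-natural (! (X I)))))) inverse)))
        where
        u : I ⊕₀ I ≡ I
        u = ⊕₀-identityˡ I
        inverse : Δ (X I) ⨾ (coe u ⨾ ! (X I)) ≈ id
        inverse = ≋⇒≈ (htrans (⨾-cong≋ hrefl (htrans (coe-⨾ u)
          (hsym ⊕-identityʳ))) (Δ-identityˡ (X I)))

      p₁ : ∀ A B → Hom (A ⊕₀ B) A
      p₁ A B = (id {A} ⊕₁ ! (X B)) ⨾ coe (⊕₀-identityʳ A)

      p₂ : ∀ A B → Hom (A ⊕₀ B) B
      p₂ A B = (! (X A) ⊕₁ id {B}) ⨾ coe (⊕₀-identityˡ B)

      pair : ∀ {Y A B} → Hom Y A → Hom Y B → Hom Y (A ⊕₀ B)
      pair {Y} f g = Δ (X Y) ⨾ (f ⊕₁ g)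

      pair-p₁ : ∀ {Y A B} (f : Hom Y A) (g : Hom Y B) →
                pair f g ⨾ p₁ A B ≈ f
      pair-p₁ {Y} {A} f g = ≋⇒≈ (
        _ ≋⟨ ≈⇒≋ assoc ⟩
        _ ≋⟨ ≈⇒≋ (⨾-congˡ (pull (≈-trans (≈-sym ⊕-⨾)
               (≈-trans (⊕-cong identityʳ (!-natural g)) (≈-sym split₂))))) ⟩
        _ ≋⟨ ⨾-cong≋ hrefl (htrans (⨾-coe (⊕₀-identityʳ A)) hrefl) ⟩
        _ ≋˘⟨ ≈⇒≋ assoc ⟩
        _ ≋⟨ ⨾-cong≋ (Δ-identityʳ (X Y)) ⊕-identityʳ ⟩
        _ ≋⟨ ≈⇒≋ identityˡ ⟩
        f ∎)

      pair-p₂ : ∀ {Y A B} (f : Hom Y A) (g : Hom Y B) →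
                pair f g ⨾ p₂ A B ≈ g
      pair-p₂ {Y} {A} {B} f g = ≋⇒≈ (
        _ ≋⟨ ≈⇒≋ assoc ⟩
        _ ≋⟨ ≈⇒≋ (⨾-congˡ (pull (≈-trans (≈-sym ⊕-⨾)
               (≈-trans (⊕-cong (!-natural f) identityʳ) (≈-sym split₁))))) ⟩
        _ ≋⟨ ⨾-cong≋ hrefl (htrans (⨾-coe (⊕₀-identityˡ B)) hrefl) ⟩
        _ ≋˘⟨ ≈⇒≋ assoc ⟩
        _ ≋⟨ ⨾-cong≋ (Δ-identityˡ (X Y)) ⊕-identityˡ ⟩
        _ ≋⟨ ≈⇒≋ identityˡ ⟩
        g ∎)

      pair-id : ∀ {A B} → pair (p₁ A B) (p₂ A B) ≈ id
      pair-id {A} {B} = ≋⇒≈ (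
        _ ≋⟨ ⨾-cong≋ (≈⇒≋ (Δ-⊕ A B))
               (⊕≋ (⨾-coe (⊕₀-identityʳ A)) (⨾-coe (⊕₀-identityˡ B))) ⟩
        _ ≋⟨ ≈⇒≋ (ComonoidProperties.⊕Δ-⨾ S (X A) (X B)) ⟩
        _ ≋⟨ ⨾-id≋ mid-unit-mid ⟩
        _ ≋⟨ ⊕≋ (Δ-identityʳ (X A)) (Δ-identityˡ (X B)) ⟩
        _ ≋⟨ id⊕id≋ ⟩
        _ ∎)

    cartesian : IsCartesian S
    cartesian = record
      { ! = λ {A} → ! (X A)
      ; !-unique = λ f → ≈-trans (≈-sym identityʳ)
          (≈-trans (⨾-congˡ (≈-sym !-I)) (!-natural f))
      ; ⟨_,_⟩ = pair
      ; project₁ = pair-p₁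
      ; project₂ = pair-p₂
      ; unique = λ f g h p q → ≈-sym (≈-trans
          (⨾-congˡ (⊕-cong (≈-sym p) (≈-sym q)))
          (≈-trans (⨾-congˡ ⊕-⨾) (≈-trans (exchange (≈-sym (Δ-natural h)))
          (≈-trans (⨾-congˡ pair-id) identityʳ))))
      }

module Maps {o ℓ e r : Level} (C : CartesianBicategory o ℓ e r) where
  open CartesianBicategory C

  record IsMap {A B} (R : Hom A B) : Set e where
    field
      Δ-hom : R ⨾ Δ B ≈ Δ A ⨾ (R ⊕₁ R)
      !-hom : R ⨾ ! B ≈ ! A
  open IsMap

  open HetProperties category
  open SMCProperties smc
  open ComonoidProperties smc using (_⊕!_; ⊕!≋)
  open FrobeniusProperties orderedSMC

  leftAdjoint⇒map : ∀ {A B} {L : Hom A B} {R : Hom B A} →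
                    id ≤ L ⨾ R → R ⨾ L ≤ id → IsMap L
  leftAdjoint⇒map {A} {B} {L} {R} unit counit = record
    { Δ-hom = ≤-antisym (Δ-lax L) (≤-respˡ (≈-sym identityˡ) (≤-trans
        (⨾-monoʳ unit) (≤-respˡ assoc (⨾-monoˡ
          (≤-respˡ (≈-sym assoc) (≤-trans (⨾-monoʳ (Δ-lax R))
          (≤-respˡ assoc (≤-trans (⨾-monoˡ (≤-respˡ (≈-sym ⊕-⨾)
            (≤-trans (⊕-mono counit counit) (≈⇒≤ ⊕-id))))
            (≈⇒≤ identityʳ)))))))))
    ; !-hom = ≤-antisym (!-lax L) (≤-respˡ (≈-sym identityˡ) (≤-trans
        (⨾-monoʳ unit) (≤-respˡ assoc (⨾-monoˡ (!-lax R)))))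
    }

  id-map : ∀ {A} → IsMap (id {A})
  id-map = leftAdjoint⇒map (≈⇒≤ (≈-sym identityˡ)) (≈⇒≤ identityˡ)

  ⨾-map : ∀ {A B D} {f : Hom A B} {g : Hom B D} →
          IsMap f → IsMap g → IsMap (f ⨾ g)
  ⨾-map p q = record
    { Δ-hom = ≈-trans assoc (≈-trans (⨾-congˡ (Δ-hom q))
        (≈-trans (exchange (Δ-hom p)) (⨾-congˡ (≈-sym ⊕-⨾))))
    ; !-hom = ≈-trans assoc (≈-trans (⨾-congˡ (!-hom q)) (!-hom p))
    }

  !-⊕≈ : ∀ {A B} → ! (A ⊕₀ B) ≈ ! A ⊕! ! B
  !-⊕≈ {A} {B} = ≋⇒≈ (htrans (!-⊕ A B) (hsym ⊕!≋))

  ⊕-map : ∀ {A B A′ B′} {f : Hom A B} {g : Hom A′ B′} →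
          IsMap f → IsMap g → IsMap (f ⊕₁ g)
  ⊕-map {A} {B} {A′} {B′} p q = record
    { Δ-hom = ≈-trans (⨾-congˡ (Δ-⊕ B B′)) (≈-trans (pull (≈-sym ⊕-⨾))
        (≈-trans (⨾-congʳ (≈-trans (⊕-cong (Δ-hom p) (Δ-hom q)) ⊕-⨾))
        (≈-trans assoc (≈-trans (⨾-congˡ mid-natural)
        (≈-trans (≈-sym assoc) (⨾-congʳ (≈-sym (Δ-⊕ A A′))))))))
    ; !-hom = ≈-trans (⨾-congˡ !-⊕≈) (≈-trans (pull (≈-trans (≈-sym ⊕-⨾)
        (⊕-cong (!-hom p) (!-hom q)))) (≈-sym !-⊕≈))
    }

  σ-map : ∀ {A B} → IsMap (σ A B)
  σ-map = leftAdjoint⇒map (≈⇒≤ (≈-sym σ-involutive)) (≈⇒≤ σ-involutive)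

  Δ-map : ∀ {A} → IsMap (Δ A)
  Δ-map {A} = leftAdjoint⇒map (Frobenius.id≤Δ∇ A) (Frobenius.∇Δ≤id A)

  !-map : ∀ {A} → IsMap (! A)
  !-map {A} = leftAdjoint⇒map (Frobenius.id≤!¿ A) (Frobenius.¿!≤id A)

  mapCategory : Category o (ℓ ⊔ e) e
  mapCategory = record
    { Obj = Obj
    ; Hom = λ A B → Σ (Hom A B) IsMap
    ; _≈_ = λ f g → proj₁ f ≈ proj₁ g
    ; id = id , id-map
    ; _⨾_ = λ (f , p) (g , q) → f ⨾ g , ⨾-map p q
    ; isEquivalence = record
        { refl = ≈-refl ; sym = ≈-sym ; trans = ≈-trans }
    ; ⨾-cong = ⨾-cong
    ; identityˡ = identityˡ
    ; identityʳ = identityʳ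
    ; assoc = assoc
    }

  private
    module M = Category mapCategory

  lift≋ : ∀ {A B A′ B′} {f : M.Hom A B} {g : M.Hom A′ B′} →
          proj₁ f ≋ proj₁ g → f M.≋ g
  lift≋ p = go (dom≡ p) (cod≡ p) p
    where
    go : ∀ {A B A′ B′} {f : M.Hom A B} {g : M.Hom A′ B′} →
         A ≡ A′ → B ≡ B′ → proj₁ f ≋ proj₁ g → f M.≋ g
    go refl refl q = M.≈⇒≋ (≋⇒≈ q)

  lower≋ : ∀ {A B A′ B′} {f : M.Hom A B} {g : M.Hom A′ B′} →
           f M.≋ g → proj₁ f ≋ proj₁ g
  lower≋ (M.≈⇒≋ p) = ≈⇒≋ p

  proj₁-coe : ∀ {A B} (p : A ≡ B) → proj₁ (M.coe p) ≈ coe p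
  proj₁-coe refl = ≈-refl

  mapSMC : StrictSMC o (ℓ ⊔ e) e
  mapSMC = record
    { category = mapCategory
    ; I = I
    ; _⊕₀_ = _⊕₀_
    ; ⊕₀-assoc = ⊕₀-assoc
    ; ⊕₀-identityˡ = ⊕₀-identityˡ
    ; ⊕₀-identityʳ = ⊕₀-identityʳ
    ; _⊕₁_ = λ (f , p) (g , q) → f ⊕₁ g , ⊕-map p q
    ; ⊕-cong = ⊕-cong
    ; ⊕-id = ⊕-id
    ; ⊕-⨾ = ⊕-⨾
    ; ⊕-assoc = lift≋ ⊕-assoc
    ; ⊕-identityˡ = lift≋ ⊕-identityˡ
    ; ⊕-identityʳ = lift≋ ⊕-identityʳ
    ; σ = λ A B → σ A B , σ-map
    ; σ-natural = σ-natural
    ; σ-involutive = σ-involutive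
    ; σ-hexagon = λ {A} {B} {D} → lift≋ (htrans σ-hexagon
        (≈⇒≋ (⨾-congˡ (⨾-congʳ (≈-sym (proj₁-coe (⊕₀-assoc B A D)))))))
    }

  mapComonoid : ∀ A → Comonoid mapSMC A
  mapComonoid A = record
    { Δ = Δ A , Δ-map
    ; ! = ! A , !-map
    ; Δ-assoc = lift≋ (Frobenius.Δ-assoc A)
    ; Δ-identityˡ = lift≋ (Frobenius.Δ-identityˡ A)
    ; Δ-identityʳ = lift≋ (Frobenius.Δ-identityʳ A)
    ; Δ-comm = Frobenius.Δ-comm A
    }

  mid-proj₁ : ∀ A B D E → proj₁ (StrictSMC.mid mapSMC A B D E) ≈ mid A B D E
  mid-proj₁ A B D E = ⨾-cong (proj₁-coe (mid-eq A B D E))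
    (⨾-congˡ (proj₁-coe (sym (mid-eq A D B E))))

  mapCartesian : IsCartesian mapSMC
  mapCartesian = Fox.cartesian mapSMC mapComonoid
    (λ A B → ≈-trans (Δ-⊕ A B) (⨾-congˡ (≈-sym (mid-proj₁ A A B B))))
    (λ (_ , p) → Δ-hom p) (λ (_ , p) → !-hom p)

Map : CartesianBicategory o ℓ e r → CartesianCategory o (ℓ ⊔ e) e
Map C = record
  { smc = Maps.mapSMC C ; isCartesian = Maps.mapCartesian C }

Signature : (s : Level) → Set (lsuc s)
Signature s = ℕ → ℕ → Set s

infixr 5 _⨟_
infixr 6 _⊗_

data Term (S : Signature s) : ℕ → ℕ → Set s where
  gen : ∀ {m n} → S m n → Term S m n
  id₀ : Term S 0 0
  id₁ : Term S 1 1
  σ₁₁ : Term S 2 2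
  _⨟_ : ∀ {l m n} → Term S l m → Term S m n → Term S l n
  _⊗_ : ∀ {m n p q} → Term S m n → Term S p q → Term S (m + p) (n + q)

mapTerm : ∀ {s′} {S : Signature s} {S′ : Signature s′} →
          (∀ {m n} → S m n → S′ m n) →
          ∀ {m n} → Term S m n → Term S′ m n
mapTerm h (gen g) = gen (h g)
mapTerm h id₀     = id₀
mapTerm h id₁     = id₁
mapTerm h σ₁₁     = σ₁₁
mapTerm h (t ⨟ u) = mapTerm h t ⨟ mapTerm h u
mapTerm h (t ⊗ u) = mapTerm h t ⊗ mapTerm h u

module _ {S : Signature s} where

  idₜ : ∀ n → Term S n n
  idₜ zero    = id₀
  idₜ (suc n) = id₁ ⊗ idₜ n

  coeₜ : ∀ {m n} → m ≡ n → Term S m n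
  coeₜ {m} refl = idₜ m

  -- σ₁ n is the symmetry σ 1 n, moving one wire past n
  σ₁ : ∀ n → Term S (1 + n) (n + 1)
  σ₁ zero    = id₁
  σ₁ (suc n) = (σ₁₁ ⊗ idₜ n) ⨟ (id₁ ⊗ σ₁ n)

  σₜ : ∀ m n → Term S (m + n) (n + m)
  σₜ zero    n = coeₜ (sym (+-identityʳ n))
  σₜ (suc m) n = (id₁ ⊗ σₜ m n) ⨟ ((σ₁ n ⊗ idₜ m) ⨟ coeₜ (+-assoc n 1 m))

  Δₙ : Term S 1 2 → ∀ n → Term S n (n + n)
  Δₙ δ zero    = id₀
  Δₙ δ (suc n) = (δ ⊗ Δₙ δ n) ⨟
                 ((id₁ ⊗ (σₜ 1 n ⊗ idₜ n)) ⨟ coeₜ (cong suc (+-assoc n 1 n)))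

  !ₙ : Term S 1 0 → ∀ n → Term S n 0
  !ₙ ε zero    = id₀
  !ₙ ε (suc n) = ε ⊗ !ₙ ε n

  ∇ₙ : Term S 2 1 → ∀ n → Term S (n + n) n
  ∇ₙ μ zero    = id₀
  ∇ₙ μ (suc n) = coeₜ (cong suc (sym (+-assoc n 1 n))) ⨟
                 ((id₁ ⊗ (σₜ n 1 ⊗ idₜ n)) ⨟ (μ ⊗ ∇ₙ μ n))

  ¿ₙ : Term S 0 1 → ∀ n → Term S 0 n
  ¿ₙ η zero    = id₀
  ¿ₙ η (suc n) = η ⊗ ¿ₙ η n

  data SMCLaw : ∀ {m n} → Term S m n → Term S m n → Set s where
    identityˡ : ∀ {m n} {t : Term S m n} → SMCLaw (idₜ m ⨟ t) t
    identityʳ : ∀ {m n} {t : Term S m n} → SMCLaw (t ⨟ idₜ n) t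
    assoc     : ∀ {k l m n} {t : Term S k l} {u : Term S l m}
                {v : Term S m n} →
                SMCLaw ((t ⨟ u) ⨟ v) (t ⨟ (u ⨟ v))
    ⊗-id      : ∀ m n → SMCLaw (idₜ m ⊗ idₜ n) (idₜ (m + n))
    ⊗-⨟       : ∀ {l m n l′ m′ n′} {t : Term S l m} {u : Term S m n}
                {t′ : Term S l′ m′} {u′ : Term S m′ n′} →
                SMCLaw ((t ⨟ u) ⊗ (t′ ⨟ u′)) ((t ⊗ t′) ⨟ (u ⊗ u′))
    ⊗-assoc   : ∀ {l l′ m m′ n n′} {t : Term S l l′} {u : Term S m m′}
                {v : Term S n n′} →
                SMCLaw (((t ⊗ u) ⊗ v) ⨟ coeₜ (+-assoc l′ m′ n′))
                       (coeₜ (+-assoc l m n) ⨟ (t ⊗ (u ⊗ v)))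
    ⊗-identityˡ : ∀ {m n} {t : Term S m n} → SMCLaw (id₀ ⊗ t) t
    ⊗-identityʳ : ∀ {m n} {t : Term S m n} →
                  SMCLaw ((t ⊗ id₀) ⨟ coeₜ (+-identityʳ n))
                         (coeₜ (+-identityʳ m) ⨟ t)
    σ-natural    : ∀ {m m′ n n′} {t : Term S m m′} {u : Term S n n′} →
                   SMCLaw ((t ⊗ u) ⨟ σₜ m′ n′) (σₜ m n ⨟ (u ⊗ t))
    σ-involutive : ∀ m n → SMCLaw (σₜ m n ⨟ σₜ n m) (idₜ (m + n))
    σ-hexagon    : ∀ l m n →
                   SMCLaw (σₜ l (m + n) ⨟ coeₜ (+-assoc m n l))
                          (coeₜ (sym (+-assoc l m n)) ⨟
                           ((σₜ l m ⊗ idₜ n) ⨟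
                            (coeₜ (+-assoc m l n) ⨟ (idₜ m ⊗ σₜ l n))))

TermRel : Signature s → (r : Level) → Set (s ⊔ lsuc r)
TermRel S r = ∀ {m n} → Term S m n → Term S m n → Set r

data Equal {S : Signature s} (R : TermRel S r) :
           ∀ {m n} → Term S m n → Term S m n → Set (s ⊔ r) where
  law     : ∀ {m n} {t u : Term S m n} → SMCLaw t u → Equal R t u
  base    : ∀ {m n} {t u : Term S m n} → R t u → Equal R t u
  ≈-refl  : ∀ {m n} {t : Term S m n} → Equal R t t
  ≈-sym   : ∀ {m n} {t u : Term S m n} → Equal R t u → Equal R u t
  ≈-trans : ∀ {m n} {t u v : Term S m n} →
           Equal R t u → Equal R u v → Equal R t v
  ⨟-cong  : ∀ {l m n} {t t′ : Term S l m} {u u′ : Term S m n} →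
           Equal R t t′ → Equal R u u′ → Equal R (t ⨟ u) (t′ ⨟ u′)
  ⊗-cong  : ∀ {m n p q} {t t′ : Term S m n} {u u′ : Term S p q} →
           Equal R t t′ → Equal R u u′ → Equal R (t ⊗ u) (t′ ⊗ u′)

NoEquations : (S : Signature s) → TermRel S 0ℓ
NoEquations S _ _ = ⊥

-- Reflexivity is an instance of `smc`: this is the least preorder on terms
-- modulo the laws of symmetric strict monoidal categories that contains R and is
-- preserved by ⨟ and ⊗.  Arrows of the ordered prop are terms identified when
-- Below holds in both directions (`FrobeniusSyntax._≃_`).
data Below {S : Signature s} (R : TermRel S r) :
           ∀ {m n} → Term S m n → Term S m n → Set (s ⊔ r) where
  smc     : ∀ {m n} {t u : Term S m n} →
           Equal (NoEquations S) t u → Below R t u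
  base    : ∀ {m n} {t u : Term S m n} → R t u → Below R t u
  ≤-trans : ∀ {m n} {t u v : Term S m n} →
           Below R t u → Below R u v → Below R t v
  ⨟-mono  : ∀ {l m n} {t t′ : Term S l m} {u u′ : Term S m n} →
           Below R t t′ → Below R u u′ → Below R (t ⨟ u) (t′ ⨟ u′)
  ⊗-mono  : ∀ {m n p q} {t t′ : Term S m n} {u u′ : Term S p q} →
           Below R t t′ → Below R u u′ → Below R (t ⊗ u) (t′ ⊗ u′)

module Presented
  {s r : Level} (S : Signature s)
  (_~_ : ∀ {m n} → Term S m n → Term S m n → Set r)
  (~-isEquivalence : ∀ {m n} → IsEquivalence (_~_ {m} {n}))
  (~-⨟ : ∀ {l m n} {t t′ : Term S l m} {u u′ : Term S m n} →
         t ~ t′ → u ~ u′ → (t ⨟ u) ~ (t′ ⨟ u′))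
  (~-⊗ : ∀ {m n p q} {t t′ : Term S m n} {u u′ : Term S p q} →
         t ~ t′ → u ~ u′ → (t ⊗ u) ~ (t′ ⊗ u′))
  (~-law : ∀ {m n} {t u : Term S m n} → SMCLaw t u → t ~ u)
  where

  termCategory : Category 0ℓ s r
  termCategory = record
    { Obj = ℕ
    ; Hom = Term S
    ; _≈_ = _~_
    ; id = λ {n} → idₜ n
    ; _⨾_ = _⨟_
    ; isEquivalence = ~-isEquivalence
    ; ⨾-cong = ~-⨟
    ; identityˡ = ~-law identityˡ
    ; identityʳ = ~-law identityʳ
    ; assoc = ~-law assoc
    }

  private
    module T = Category termCategory
  open HetProperties termCategory

  coeₜ-⨟ : ∀ {m m′ n} {t : Term S m′ n} (p : m ≡ m′) → coeₜ p ⨟ t T.≋ t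
  coeₜ-⨟ refl = T.≈⇒≋ T.identityˡ

  ⨟-coeₜ : ∀ {m n n′} {t : Term S m n} (p : n ≡ n′) → t ⨟ coeₜ p T.≋ t
  ⨟-coeₜ refl = T.≈⇒≋ T.identityʳ

  private
    square : ∀ {m m′ n n′} {t : Term S m n} {u : Term S m′ n′}
             (p : m ≡ m′) (q : n ≡ n′) →
             (t ⨟ coeₜ q) ~ (coeₜ p ⨟ u) → t T.≋ u
    square p q eq = htrans (hsym (⨟-coeₜ q)) (htrans (T.≈⇒≋ eq) (coeₜ-⨟ p))

    coeₜ~coe : ∀ {m n} (p : m ≡ n) → coeₜ p ~ T.coe p
    coeₜ~coe refl = T.≈-refl

  termSMC : StrictSMC 0ℓ s r
  termSMC = record
    { category = termCategory
    ; I = 0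
    ; _⊕₀_ = _+_
    ; ⊕₀-assoc = +-assoc
    ; ⊕₀-identityˡ = λ _ → refl
    ; ⊕₀-identityʳ = +-identityʳ
    ; _⊕₁_ = _⊗_
    ; ⊕-cong = ~-⊗
    ; ⊕-id = λ {m} {n} → ~-law (⊗-id m n)
    ; ⊕-⨾ = ~-law ⊗-⨟
    ; ⊕-assoc = λ {l} {l′} {m} {m′} {n} {n′} →
        square (+-assoc l m n) (+-assoc l′ m′ n′) (~-law ⊗-assoc)
    ; ⊕-identityˡ = T.≈⇒≋ (~-law ⊗-identityˡ)
    ; ⊕-identityʳ = λ {m} {n} →
        square (+-identityʳ m) (+-identityʳ n) (~-law ⊗-identityʳ)
    ; σ = σₜ
    ; σ-natural = ~-law σ-natural
    ; σ-involutive = λ {m} {n} → ~-law (σ-involutive m n)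
    ; σ-hexagon = λ {l} {m} {n} → htrans
        (square (sym (+-assoc l m n)) (+-assoc m n l) (~-law (σ-hexagon l m n)))
        (T.≈⇒≋ (~-⨟ T.≈-refl (~-⨟ (coeₜ~coe (+-assoc m l n)) T.≈-refl)))
    }

  open SMCProperties termSMC
  open StrictSMC termSMC using (mid; mid-eq; ⊕₀-identityˡ)
  open ComonoidProperties termSMC
  open MonoidProperties termSMC

  id₁~id : id₁ ~ idₜ 1
  id₁~id = ≋⇒≈ (hsym (StrictSMC.⊕-identityʳ termSMC))

  id-⨟≋ : ∀ {k l m n} {t : Term S k m} {u : Term S m n} →
          t T.≋ idₜ l → t ⨟ u T.≋ u
  id-⨟≋ (T.≈⇒≋ p) = T.≈⇒≋ (T.≈-trans (~-⨟ p T.≈-refl) T.identityˡ)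

  σₜ≋σ₁ : ∀ n → σₜ 1 n T.≋ σ₁ n
  σₜ≋σ₁ n = htrans
    (id-⨟≋ (htrans (⊕≋ (T.≈⇒≋ id₁~id) (htrans (T.≈⇒≋ (coeₜ~coe p)) (coe≋id p)))
      (id⊕id≋ {1} {n})))
    (htrans (⨟-coeₜ (+-assoc n 1 0)) (StrictSMC.⊕-identityʳ termSMC))
    where
    p : n ≡ n + 0
    p = sym (+-identityʳ n)

  σₜ~σ₁₁ : σₜ 1 1 ~ σ₁₁
  σₜ~σ₁₁ = T.≈-trans (≋⇒≈ (σₜ≋σ₁ 1)) (T.≈-trans
    (~-⨟ (≋⇒≈ (StrictSMC.⊕-identityʳ termSMC))
         (T.≈-trans (~-⊗ id₁~id id₁~id) (~-law (⊗-id 1 1))))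
    T.identityʳ)

  Δₙ-suc : ∀ δ n → Δₙ δ (suc n) ~ (δ ⊕Δ Δₙ δ n)
  Δₙ-suc δ n = ~-⨟ T.≈-refl (≋⇒≈ (htrans
    (⨟-coeₜ (cong suc (+-assoc n 1 n)))
    (htrans (⊕≋ (T.≈⇒≋ id₁~id) hrefl) (hsym (mid≋ {1} {1} {n} {n})))))

  ∇ₙ-suc : ∀ μ n → ∇ₙ μ (suc n) ~ (μ ⊕∇ ∇ₙ μ n)
  ∇ₙ-suc μ n = T.≈-trans (T.≈-sym T.assoc) (~-⨟ (≋⇒≈ (htrans
    (coeₜ-⨟ (cong suc (sym (+-assoc n 1 n))))
    (htrans (⊕≋ (T.≈⇒≋ id₁~id) hrefl) (hsym (mid≋ {1} {n} {1} {n}))))) T.≈-refl)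

  !ₙ-suc : ∀ ε n → !ₙ ε (suc n) ~ (ε ⊕! !ₙ ε n)
  !ₙ-suc ε n = T.≈-sym T.identityʳ

  ¿ₙ-suc : ∀ η n → ¿ₙ η (suc n) ~ (η ⊕¿ ¿ₙ η n)
  ¿ₙ-suc η n = T.≈-sym T.identityˡ

  Δₙ-one : ∀ δ → Δₙ δ 1 ~ δ
  Δₙ-one δ = T.≈-trans (Δₙ-suc δ 0) (≋⇒≈ (htrans
    (⨾-id≋ (mid-unitʳ {1} {1})) (StrictSMC.⊕-identityʳ termSMC)))

  !ₙ-one : ∀ ε → !ₙ ε 1 ~ ε
  !ₙ-one ε = ≋⇒≈ (StrictSMC.⊕-identityʳ termSMC)

  Δₙ-+ : ∀ δ m n → Δₙ δ (m + n) ~ (Δₙ δ m ⊕Δ Δₙ δ n)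
  Δₙ-+ δ zero n = ≋⇒≈ (hsym (htrans (⨾-id≋ (mid-unitˡ {n} {n}))
    (StrictSMC.⊕-identityˡ termSMC)))
  Δₙ-+ δ (suc m) n = T.≈-trans (Δₙ-suc δ (m + n))
    (T.≈-trans (⊕Δ-cong T.≈-refl (Δₙ-+ δ m n))
    (T.≈-trans (≋⇒≈ (⊕Δ-assoc {1} {m} {n}))
    (⊕Δ-cong (T.≈-sym (Δₙ-suc δ m)) T.≈-refl)))

  ∇ₙ-+ : ∀ μ m n → ∇ₙ μ (m + n) ~ (∇ₙ μ m ⊕∇ ∇ₙ μ n)
  ∇ₙ-+ μ zero n = ≋⇒≈ (hsym (htrans (id-⨟≋ (mid-unit₁′ {n}))
    (StrictSMC.⊕-identityˡ termSMC)))
    where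
    mid-unit₁′ : ∀ {n} → mid 0 n 0 n T.≋ idₜ (n + n)
    mid-unit₁′ {n} = htrans (mid≋ {0} {n} {0} {n})
      (htrans (StrictSMC.⊕-identityˡ termSMC)
      (htrans (⊕≋ (σ-identityʳ {n}) hrefl) (id⊕id≋ {n} {n})))
  ∇ₙ-+ μ (suc m) n = T.≈-trans (∇ₙ-suc μ (m + n))
    (T.≈-trans (⊕∇-cong T.≈-refl (∇ₙ-+ μ m n))
    (T.≈-trans (≋⇒≈ (⊕∇-assoc {1} {m} {n}))
    (⊕∇-cong (T.≈-sym (∇ₙ-suc μ m)) T.≈-refl)))

  !ₙ-+ : ∀ ε m n → !ₙ ε (m + n) T.≋ !ₙ ε m ⊗ !ₙ ε n
  !ₙ-+ ε zero n = hsym (StrictSMC.⊕-identityˡ termSMC)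
  !ₙ-+ ε (suc m) n = htrans (⊕≋ hrefl (!ₙ-+ ε m n))
    (hsym (StrictSMC.⊕-assoc termSMC))

  ¿ₙ-+ : ∀ η m n → ¿ₙ η (m + n) T.≋ ¿ₙ η m ⊗ ¿ₙ η n
  ¿ₙ-+ η zero n = hsym (StrictSMC.⊕-identityˡ termSMC)
  ¿ₙ-+ η (suc m) n = htrans (⊕≋ hrefl (¿ₙ-+ η m n))
    (hsym (StrictSMC.⊕-assoc termSMC))

data ComonoidLaw {S : Signature s} (δ : Term S 1 2) (ε : Term S 1 0) :
                 ∀ {m n} → Term S m n → Term S m n → Set s where
  Δ-assoc     : ComonoidLaw δ ε (δ ⨟ (δ ⊗ id₁)) (δ ⨟ (id₁ ⊗ δ))
  Δ-identityˡ : ComonoidLaw δ ε (δ ⨟ (ε ⊗ id₁)) id₁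
  Δ-identityʳ : ComonoidLaw δ ε (δ ⨟ (id₁ ⊗ ε)) id₁
  Δ-comm      : ComonoidLaw δ ε (δ ⨟ σ₁₁) δ

data MonoidLaw {S : Signature s} (μ : Term S 2 1) (η : Term S 0 1) :
               ∀ {m n} → Term S m n → Term S m n → Set s where
  ∇-assoc     : MonoidLaw μ η ((μ ⊗ id₁) ⨟ μ) ((id₁ ⊗ μ) ⨟ μ)
  ∇-identityˡ : MonoidLaw μ η ((η ⊗ id₁) ⨟ μ) id₁
  ∇-identityʳ : MonoidLaw μ η ((id₁ ⊗ η) ⨟ μ) id₁
  ∇-comm      : MonoidLaw μ η (σ₁₁ ⨟ μ) μ

data FrobeniusLaw {S : Signature s} (δ : Term S 1 2) (μ : Term S 2 1) :
                  ∀ {m n} → Term S m n → Term S m n → Set s where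
  frobeniusˡ : FrobeniusLaw δ μ ((δ ⊗ id₁) ⨟ (id₁ ⊗ μ)) (μ ⨟ δ)
  frobeniusʳ : FrobeniusLaw δ μ ((id₁ ⊗ δ) ⨟ (μ ⊗ id₁)) (μ ⨟ δ)

data AdjointLaw {S : Signature s} (δ : Term S 1 2) (ε : Term S 1 0)
                (μ : Term S 2 1) (η : Term S 0 1) :
                ∀ {m n} → Term S m n → Term S m n → Set s where
  ∇Δ≤id : AdjointLaw δ ε μ η (μ ⨟ δ) (idₜ 2)
  id≤Δ∇ : AdjointLaw δ ε μ η id₁ (δ ⨟ μ)
  ¿!≤id : AdjointLaw δ ε μ η (η ⨟ ε) id₀
  id≤!¿ : AdjointLaw δ ε μ η id₁ (ε ⨟ η)

data Both {S : Signature s} (R : TermRel S r) :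
          ∀ {m n} → Term S m n → Term S m n → Set (s ⊔ r) where
  forward  : ∀ {m n} {t u : Term S m n} → R t u → Both R t u
  backward : ∀ {m n} {t u : Term S m n} → R u t → Both R t u

data CarGen (Op : ℕ → Set s) : Signature s where
  op      : ∀ {n} → Op n → CarGen Op n 1
  copy    : CarGen Op 1 2
  discard : CarGen Op 1 0

record CartesianTheory (s e : Level) : Set (lsuc (s ⊔ e)) where
  field
    Op  : ℕ → Set s
    -- pairs of arrows n → 1 of the free prop, given by representative terms
    Eqn : ∀ {n} → Term (CarGen Op) n 1 → Term (CarGen Op) n 1 → Set e

data CarAxiom (T : CartesianTheory s e) :
              TermRel (CarGen (CartesianTheory.Op T)) (s ⊔ e) where
  comonoid : ∀ {m n} {t u : Term _ m n} →
             ComonoidLaw (gen copy) (gen discard) t u → CarAxiom T t u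
  op-Δ     : ∀ {n} (f : CartesianTheory.Op T n) →
             CarAxiom T (gen (op f) ⨟ gen copy)
                        (Δₙ (gen copy) n ⨟ (gen (op f) ⊗ gen (op f)))
  op-!     : ∀ {n} (f : CartesianTheory.Op T n) →
             CarAxiom T (gen (op f) ⨟ gen discard) (!ₙ (gen discard) n)
  eqn      : ∀ {n} {t u : Term _ n 1} →
             CartesianTheory.Eqn T t u → CarAxiom T t u

data FrobGen (Sig : Signature s) : Signature s where
  op      : ∀ {m n} → Sig m n → FrobGen Sig m n
  copy    : FrobGen Sig 1 2
  discard : FrobGen Sig 1 0
  merge   : FrobGen Sig 2 1
  create  : FrobGen Sig 0 1

record FrobeniusTheory (s i : Level) : Set (lsuc (s ⊔ i)) where
  field
    Sig  : Signature s
    Ineq : TermRel (FrobGen Sig) i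

data FrobAxiom (T : FrobeniusTheory s i) :
               TermRel (FrobGen (FrobeniusTheory.Sig T)) (s ⊔ i) where
  comonoid  : ∀ {m n} {t u : Term _ m n} →
              Both (ComonoidLaw (gen copy) (gen discard)) t u → FrobAxiom T t u
  monoid    : ∀ {m n} {t u : Term _ m n} →
              Both (MonoidLaw (gen merge) (gen create)) t u → FrobAxiom T t u
  frobenius : ∀ {m n} {t u : Term _ m n} →
              Both (FrobeniusLaw (gen copy) (gen merge)) t u → FrobAxiom T t u
  adjoint   : ∀ {m n} {t u : Term _ m n} →
              AdjointLaw (gen copy) (gen discard) (gen merge) (gen create) t u →
              FrobAxiom T t u
  op-Δ      : ∀ {n m} (f : FrobeniusTheory.Sig T n m) →
              FrobAxiom T (gen (op f) ⨟ Δₙ (gen copy) m)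
                          (Δₙ (gen copy) n ⨟ (gen (op f) ⊗ gen (op f)))
  op-!      : ∀ {n m} (f : FrobeniusTheory.Sig T n m) →
              FrobAxiom T (gen (op f) ⨟ !ₙ (gen discard) m) (!ₙ (gen discard) n)
  ineq      : ∀ {m n} {t u : Term _ m n} →
              FrobeniusTheory.Ineq T t u → FrobAxiom T t u

module CartesianSyntax {s e : Level} (T : CartesianTheory s e) where
  open CartesianTheory T

  private
    δ : Term (CarGen Op) 1 2
    δ = gen copy
    ε : Term (CarGen Op) 1 0
    ε = gen discard

    Equal-isEquivalence : ∀ {m n} → IsEquivalence (Equal (CarAxiom T) {m} {n})
    Equal-isEquivalence = record
      { refl = ≈-refl ; sym = ≈-sym ; trans = ≈-trans }

  module P = Presented (CarGen Op) (Equal (CarAxiom T)) Equal-isEquivalence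
    ⨟-cong ⊗-cong law

  private
    module S = StrictSMC P.termSMC
  open HetProperties S.category hiding (_≈⟨_⟩_)
  open SMCProperties P.termSMC
  open ComonoidProperties P.termSMC
  open MonoidProperties P.termSMC using (resp-comonoid)

  comonoid₁ : Comonoid P.termSMC 1
  comonoid₁ = record
    { Δ = δ
    ; ! = ε
    ; Δ-assoc = S.≈⇒≋ (S.≈-trans (⨟-cong ≈-refl (⊗-cong ≈-refl (S.≈-sym P.id₁~id)))
        (S.≈-trans (base (comonoid Δ-assoc))
        (⨟-cong ≈-refl (⊗-cong P.id₁~id ≈-refl))))
    ; Δ-identityˡ = S.≈⇒≋ (S.≈-trans
        (⨟-cong ≈-refl (⊗-cong ≈-refl (S.≈-sym P.id₁~id)))
        (S.≈-trans (base (comonoid Δ-identityˡ)) P.id₁~id))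
    ; Δ-identityʳ = S.≈⇒≋ (S.≈-trans
        (⨟-cong ≈-refl (⊗-cong (S.≈-sym P.id₁~id) ≈-refl))
        (S.≈-trans (base (comonoid Δ-identityʳ)) P.id₁~id))
    ; Δ-comm = S.≈-trans (⨟-cong ≈-refl P.σₜ~σ₁₁) (base (comonoid Δ-comm))
    }

  private
    powers : ∀ n → Comonoid P.termSMC n
    powers zero    = unitComonoid
    powers (suc n) = comonoid₁ ⊕-comonoid powers n

    Δ-powers : ∀ n → Δₙ δ n S.≈ Comonoid.Δ (powers n)
    Δ-powers zero    = ≈-refl
    Δ-powers (suc n) =
      S.≈-trans (P.Δₙ-suc δ n) (⊕Δ-cong ≈-refl (Δ-powers n))

    !-powers : ∀ n → !ₙ ε n S.≈ Comonoid.! (powers n)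
    !-powers zero    = ≈-refl
    !-powers (suc n) = S.≈-trans (P.!ₙ-suc ε n)
      (⨟-cong (⊗-cong ≈-refl (!-powers n)) ≈-refl)

  comonoidₙ : ∀ n → Comonoid P.termSMC n
  comonoidₙ n = resp-comonoid (powers n) {δ = Δₙ δ n} {ε = !ₙ ε n}
    (Δ-powers n) (!-powers n)

  Δ-natural : ∀ {m n} (t : Term (CarGen Op) m n) →
              t ⨟ Δₙ δ n S.≈ Δₙ δ m ⨟ (t ⊗ t)
  Δ-natural (gen (op f)) =
    S.≈-trans (⨟-cong ≈-refl (P.Δₙ-one δ)) (base (op-Δ f))
  Δ-natural (gen copy) = S.≈-trans
    (⨟-cong ≈-refl (S.≈-trans (P.Δₙ-suc δ 1) (⊕Δ-cong ≈-refl (P.Δₙ-one δ))))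
    (S.≈-trans (Δ-copy comonoid₁) (⨟-cong (S.≈-sym (P.Δₙ-one δ)) ≈-refl))
  Δ-natural (gen discard) = S.≈-trans S.identityʳ (S.≈-sym (S.≈-trans
    (⨟-cong (P.Δₙ-one δ) ≈-refl) (≋⇒≈ (Δ-discard comonoid₁))))
  Δ-natural id₀ = ⨟-cong ≈-refl (S.≈-sym S.⊕-id)
  Δ-natural id₁ = S.≈-trans (⨟-cong P.id₁~id ≈-refl) (S.≈-trans S.identityˡ
    (S.≈-sym (S.≈-trans (⨟-cong ≈-refl (S.≈-trans (⊗-cong P.id₁~id P.id₁~id)
    (law (⊗-id 1 1)))) S.identityʳ)))
  Δ-natural σ₁₁ = S.≈-trans (⨟-cong (S.≈-sym P.σₜ~σ₁₁) (P.Δₙ-+ δ 1 1))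
    (S.≈-trans (σ-copy (comonoidₙ 1) (comonoidₙ 1))
    (⨟-cong (S.≈-sym (P.Δₙ-+ δ 1 1)) (⊗-cong P.σₜ~σ₁₁ P.σₜ~σ₁₁)))
  Δ-natural (t ⨟ u) = S.≈-trans S.assoc
    (S.≈-trans (⨟-cong ≈-refl (Δ-natural u)) (S.≈-trans (exchange (Δ-natural t))
    (⨟-cong ≈-refl (S.≈-sym S.⊕-⨾))))
  Δ-natural (_⊗_ {m} {n} {p} {q} t u) = S.≈-trans (⨟-cong ≈-refl (P.Δₙ-+ δ n q))
    (S.≈-trans (pull (S.≈-trans (S.≈-sym S.⊕-⨾) (S.≈-trans
      (⊗-cong (Δ-natural t) (Δ-natural u)) S.⊕-⨾)))
    (S.≈-trans S.assoc (S.≈-trans (⨟-cong ≈-refl mid-natural)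
    (S.≈-trans (S.≈-sym S.assoc) (⨟-cong (S.≈-sym (P.Δₙ-+ δ m p)) ≈-refl)))))

  !-natural : ∀ {m n} (t : Term (CarGen Op) m n) → t ⨟ !ₙ ε n S.≈ !ₙ ε m
  !-natural (gen (op f)) =
    S.≈-trans (⨟-cong ≈-refl (P.!ₙ-one ε)) (base (op-! f))
  !-natural (gen copy) = S.≈-trans
    (⨟-cong ≈-refl (⊗-cong ≈-refl (P.!ₙ-one ε)))
    (S.≈-trans (≋⇒≈ (Δ-discard comonoid₁)) (S.≈-sym (P.!ₙ-one ε)))
  !-natural (gen discard) = S.≈-trans S.identityʳ (S.≈-sym (P.!ₙ-one ε))
  !-natural id₀ = S.identityʳ
  !-natural id₁ = S.≈-trans (⨟-cong P.id₁~id ≈-refl) S.identityˡ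
  !-natural σ₁₁ = S.≈-trans
    (⨟-cong (S.≈-sym P.σₜ~σ₁₁) (⊗-cong (S.≈-sym (P.!ₙ-one ε)) ≈-refl))
    (S.≈-trans (S.≈-sym S.σ-natural) (S.≈-trans
      (≋⇒≈ (⨾-id≋ (σ-identityʳ {0})))
      (⊗-cong (P.!ₙ-one ε) ≈-refl)))
  !-natural (t ⨟ u) = S.≈-trans S.assoc
    (S.≈-trans (⨟-cong ≈-refl (!-natural u)) (!-natural t))
  !-natural (_⊗_ {m} {n} {p} {q} t u) =
    S.≈-trans (⨟-cong ≈-refl (≋⇒≈ (P.!ₙ-+ ε n q)))
    (S.≈-trans (S.≈-sym S.⊕-⨾) (S.≈-trans (⊗-cong (!-natural t) (!-natural u))
    (S.≈-sym (≋⇒≈ (P.!ₙ-+ ε m p)))))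

  category : CartesianCategory 0ℓ s (s ⊔ e)
  category = record
    { smc = P.termSMC
    ; isCartesian = Fox.cartesian P.termSMC comonoidₙ
        (P.Δₙ-+ δ) Δ-natural !-natural
    }

𝓛 : CartesianTheory s e → CartesianCategory 0ℓ s (s ⊔ e)
𝓛 T = CartesianSyntax.category T

module FrobeniusSyntax {s i : Level} (T : FrobeniusTheory s i) where
  open FrobeniusTheory T

  private
    G : Signature s
    G = FrobGen Sig
    δ : Term G 1 2
    δ = gen copy
    ε : Term G 1 0
    ε = gen discard
    μ : Term G 2 1
    μ = gen merge
    η : Term G 0 1
    η = gen create

  _⊑_ : TermRel G (s ⊔ i)
  _⊑_ = Below (FrobAxiom T)

  _≃_ : TermRel G (s ⊔ i)
  t ≃ u = (t ⊑ u) × (u ⊑ t)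

  private
    ≃-isEquivalence : ∀ {m n} → IsEquivalence (_≃_ {m} {n})
    ≃-isEquivalence = record
      { refl  = smc ≈-refl , smc ≈-refl
      ; sym   = λ (p , q) → q , p
      ; trans = λ (p , q) (p′ , q′) → ≤-trans p p′ , ≤-trans q′ q
      }

    ≃-⨟ : ∀ {l m n} {t t′ : Term G l m} {u u′ : Term G m n} →
          t ≃ t′ → u ≃ u′ → (t ⨟ u) ≃ (t′ ⨟ u′)
    ≃-⨟ (p , q) (p′ , q′) = ⨟-mono p p′ , ⨟-mono q q′

    ≃-⊗ : ∀ {m n p q} {t t′ : Term G m n} {u u′ : Term G p q} →
          t ≃ t′ → u ≃ u′ → (t ⊗ u) ≃ (t′ ⊗ u′)
    ≃-⊗ (p , q) (p′ , q′) = ⊗-mono p p′ , ⊗-mono q q′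

    ≃-law : ∀ {m n} {t u : Term G m n} → SMCLaw t u → t ≃ u
    ≃-law p = smc (law p) , smc (≈-sym (law p))

    both : ∀ {r} {R : TermRel G r} →
           (∀ {m n} {t u : Term G m n} → Both R t u → FrobAxiom T t u) →
           ∀ {m n} {t u : Term G m n} → R t u → t ≃ u
    both h p = base (h (forward p)) , base (h (backward p))

  module P = Presented G _≃_ ≃-isEquivalence ≃-⨟ ≃-⊗ ≃-law

  orderedSMC : OrderedSMC 0ℓ s (s ⊔ i) (s ⊔ i)
  orderedSMC = record
    { smc = P.termSMC
    ; _≤_ = _⊑_
    ; isPartialOrder = record
        { isPreorder = record
            { isEquivalence = ≃-isEquivalence
            ; reflexive = proj₁
            ; trans = ≤-trans
            }
        ; antisym = _,_
        }
    ; ⨾-mono = ⨟-mono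
    ; ⊕-mono = ⊗-mono
    }

  private
    module S = OrderedSMC orderedSMC
  open HetProperties S.category hiding (_≈⟨_⟩_)
  open SMCProperties P.termSMC
  open ComonoidProperties P.termSMC
  open MonoidProperties P.termSMC
  open FrobeniusProperties orderedSMC

  private
    id₁≃ : id₁ ≃ idₜ 1
    id₁≃ = P.id₁~id

    id₁⊗ : ∀ {m n} {t : Term G m n} → (idₜ 1 ⊗ t) ≃ (id₁ ⊗ t)
    id₁⊗ = ≃-⊗ (S.≈-sym id₁≃) S.≈-refl

    ⊗id₁ : ∀ {m n} {t : Term G m n} → (t ⊗ idₜ 1) ≃ (t ⊗ id₁)
    ⊗id₁ = ≃-⊗ S.≈-refl (S.≈-sym id₁≃)

  comonoid₁ : Comonoid P.termSMC 1
  comonoid₁ = record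
    { Δ = δ
    ; ! = ε
    ; Δ-assoc = S.≈⇒≋ (S.≈-trans (⨾-congˡ ⊗id₁)
        (S.≈-trans (both comonoid Δ-assoc) (⨾-congˡ (S.≈-sym id₁⊗))))
    ; Δ-identityˡ = S.≈⇒≋ (S.≈-trans (⨾-congˡ ⊗id₁)
        (S.≈-trans (both comonoid Δ-identityˡ) id₁≃))
    ; Δ-identityʳ = S.≈⇒≋ (S.≈-trans (⨾-congˡ id₁⊗)
        (S.≈-trans (both comonoid Δ-identityʳ) id₁≃))
    ; Δ-comm = S.≈-trans (⨾-congˡ P.σₜ~σ₁₁) (both comonoid Δ-comm)
    }

  monoid₁ : Monoid P.termSMC 1
  monoid₁ = record
    { ∇ = μ
    ; ¿ = η
    ; ∇-assoc = S.≈⇒≋ (S.≈-trans (⨾-congʳ ⊗id₁)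
        (S.≈-trans (both monoid ∇-assoc) (⨾-congʳ (S.≈-sym id₁⊗))))
    ; ∇-identityˡ = S.≈⇒≋ (S.≈-trans (⨾-congʳ ⊗id₁)
        (S.≈-trans (both monoid ∇-identityˡ) id₁≃))
    ; ∇-identityʳ = S.≈⇒≋ (S.≈-trans (⨾-congʳ id₁⊗)
        (S.≈-trans (both monoid ∇-identityʳ) id₁≃))
    ; ∇-comm = S.≈-trans (⨾-congʳ P.σₜ~σ₁₁) (both monoid ∇-comm)
    }

  frobenius₁ : FrobeniusStructure orderedSMC 1
  frobenius₁ = record
    { comonoid = comonoid₁
    ; monoid = monoid₁
    ; ∇Δ≤id = base (adjoint ∇Δ≤id)
    ; id≤Δ∇ = ≤-respˡ (S.≈-sym id₁≃) (base (adjoint id≤Δ∇))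
    ; ¿!≤id = base (adjoint ¿!≤id)
    ; id≤!¿ = ≤-respˡ (S.≈-sym id₁≃) (base (adjoint id≤!¿))
    ; frobeniusˡ = S.≈-trans (≃-⨟ ⊗id₁ (S.≈-trans S.identityˡ id₁⊗))
        (both frobenius frobeniusˡ)
    ; frobeniusʳ = S.≈-trans (≃-⨟ id₁⊗ (S.≈-trans S.identityˡ ⊗id₁))
        (both frobenius frobeniusʳ)
    }

  private
    powers : ∀ n → FrobeniusStructure orderedSMC n
    powers zero    = unitFrobenius
    powers (suc n) = frobenius₁ ⊕-frobenius powers n

    Δ-powers : ∀ n → Δₙ δ n ≃ FrobeniusStructure.Δ (powers n)
    Δ-powers zero    = S.≈-refl
    Δ-powers (suc n) =
      S.≈-trans (P.Δₙ-suc δ n) (⊕Δ-cong S.≈-refl (Δ-powers n))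

    !-powers : ∀ n → !ₙ ε n ≃ FrobeniusStructure.! (powers n)
    !-powers zero    = S.≈-refl
    !-powers (suc n) =
      S.≈-trans (P.!ₙ-suc ε n) (⨾-congʳ (≃-⊗ S.≈-refl (!-powers n)))

    ∇-powers : ∀ n → ∇ₙ μ n ≃ FrobeniusStructure.∇ (powers n)
    ∇-powers zero    = S.≈-refl
    ∇-powers (suc n) =
      S.≈-trans (P.∇ₙ-suc μ n) (⊕∇-cong S.≈-refl (∇-powers n))

    ¿-powers : ∀ n → ¿ₙ η n ≃ FrobeniusStructure.¿ (powers n)
    ¿-powers zero    = S.≈-refl
    ¿-powers (suc n) =
      S.≈-trans (P.¿ₙ-suc η n) (⨾-congˡ (≃-⊗ S.≈-refl (¿-powers n)))

  frobeniusₙ : ∀ n → FrobeniusStructure orderedSMC n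
  frobeniusₙ n = resp-frobenius (powers n)
    {δ = Δₙ δ n} {ε = !ₙ ε n} {μ = ∇ₙ μ n} {η = ¿ₙ η n}
    (Δ-powers n) (!-powers n) (∇-powers n) (¿-powers n)

  private
    Δ₂ : Δₙ δ 2 ≃ (δ ⊕Δ δ)
    Δ₂ = S.≈-trans (P.Δₙ-suc δ 1) (⊕Δ-cong S.≈-refl (P.Δₙ-one δ))

    !₂ : !ₙ ε 2 ≃ (ε ⊕! ε)
    !₂ = S.≈-trans (P.!ₙ-suc ε 1) (⨾-congʳ (≃-⊗ S.≈-refl (P.!ₙ-one ε)))

  Δ-lax : ∀ {m n} (t : Term G m n) → (t ⨟ Δₙ δ n) ⊑ (Δₙ δ m ⨟ (t ⊗ t))
  Δ-lax (gen (op f)) = base (op-Δ f)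
  Δ-lax (gen copy) = proj₁ (S.≈-trans (⨾-congˡ Δ₂)
    (S.≈-trans (Δ-copy comonoid₁) (⨾-congʳ (S.≈-sym (P.Δₙ-one δ)))))
  Δ-lax (gen discard) = proj₁ (S.≈-trans S.identityʳ (S.≈-sym (S.≈-trans
    (⨾-congʳ (P.Δₙ-one δ)) (≋⇒≈ (Δ-discard comonoid₁)))))
  Δ-lax (gen merge) = ≤-respˡ (⨾-congˡ (P.Δₙ-one δ))
    (≤-respʳ (∇-Δ-lax frobenius₁) (⨾-congʳ Δ₂))
  Δ-lax (gen create) = ≤-respˡ (⨾-congˡ (P.Δₙ-one δ)) (¿-Δ-lax frobenius₁)
  Δ-lax id₀ = proj₁ (⨾-congˡ (S.≈-sym S.⊕-id))
  Δ-lax id₁ = proj₁ (S.≈-trans (⨾-congʳ id₁≃) (S.≈-trans S.identityˡ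
    (S.≈-sym (S.≈-trans (⨾-congˡ (S.≈-trans (≃-⊗ id₁≃ id₁≃)
    (≃-law (⊗-id 1 1)))) S.identityʳ))))
  Δ-lax σ₁₁ = proj₁ (S.≈-trans (≃-⨟ (S.≈-sym P.σₜ~σ₁₁) Δ₂)
    (S.≈-trans (σ-copy comonoid₁ comonoid₁)
    (≃-⨟ (S.≈-sym Δ₂) (≃-⊗ P.σₜ~σ₁₁ P.σₜ~σ₁₁))))
  Δ-lax (t ⨟ u) = ≤-respˡ S.assoc (≤-trans (⨾-monoˡ (Δ-lax u))
    (≤-respˡ (S.≈-sym S.assoc) (≤-trans (⨾-monoʳ (Δ-lax t))
    (proj₁ (S.≈-trans S.assoc (⨾-congˡ (S.≈-sym S.⊕-⨾)))))))
  Δ-lax (_⊗_ {m} {n} {p} {q} t u) =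
    ≤-respˡ (S.≈-trans (⨾-congˡ (P.Δₙ-+ δ n q)) (pull (S.≈-sym S.⊕-⨾)))
    (≤-trans (⨾-monoʳ (⊗-mono (Δ-lax t) (Δ-lax u)))
    (proj₁ (S.≈-trans (⨾-congʳ S.⊕-⨾) (S.≈-trans S.assoc
      (S.≈-trans (⨾-congˡ mid-natural) (S.≈-trans (S.≈-sym S.assoc)
      (⨾-congʳ (S.≈-sym (P.Δₙ-+ δ m p)))))))))

  !-lax : ∀ {m n} (t : Term G m n) → (t ⨟ !ₙ ε n) ⊑ !ₙ ε m
  !-lax (gen (op f)) = base (op-! f)
  !-lax (gen copy) = proj₁ (S.≈-trans
    (⨾-congˡ (≃-⊗ S.≈-refl (P.!ₙ-one ε)))
    (S.≈-trans (≋⇒≈ (Δ-discard comonoid₁)) (S.≈-sym (P.!ₙ-one ε))))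
  !-lax (gen discard) = proj₁ (S.≈-trans S.identityʳ (S.≈-sym (P.!ₙ-one ε)))
  !-lax (gen merge) = ≤-respˡ (⨾-congˡ (P.!ₙ-one ε))
    (≤-respʳ (∇-!-lax frobenius₁) !₂)
  !-lax (gen create) = ≤-respˡ (⨾-congˡ (P.!ₙ-one ε)) (base (adjoint ¿!≤id))
  !-lax id₀ = proj₁ S.identityʳ
  !-lax id₁ = proj₁ (S.≈-trans (⨾-congʳ id₁≃) S.identityˡ)
  !-lax σ₁₁ = proj₁ (S.≈-trans
    (≃-⨟ (S.≈-sym P.σₜ~σ₁₁) (≃-⊗ (S.≈-sym (P.!ₙ-one ε)) S.≈-refl))
    (S.≈-trans (S.≈-sym S.σ-natural) (S.≈-trans
      (≋⇒≈ (⨾-id≋ (σ-identityʳ {0})))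
      (≃-⊗ (P.!ₙ-one ε) S.≈-refl))))
  !-lax (t ⨟ u) = ≤-respˡ S.assoc (≤-trans (⨾-monoˡ (!-lax u)) (!-lax t))
  !-lax (_⊗_ {m} {n} {p} {q} t u) =
    ≤-respˡ (S.≈-trans (⨾-congˡ (≋⇒≈ (P.!ₙ-+ ε n q))) (S.≈-sym S.⊕-⨾))
    (≤-trans (⊗-mono (!-lax t) (!-lax u))
    (proj₁ (≋⇒≈ (hsym (P.!ₙ-+ ε m p)))))

  bicategory : CartesianBicategory 0ℓ s (s ⊔ i) (s ⊔ i)
  bicategory = record
    { orderedSMC = orderedSMC
    ; frobenius = frobeniusₙ
    ; Δ-⊕ = P.Δₙ-+ δ
    ; !-⊕ = P.!ₙ-+ ε
    ; ∇-⊕ = P.∇ₙ-+ μ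
    ; ¿-⊕ = P.¿ₙ-+ η
    ; Δ-lax = Δ-lax
    ; !-lax = !-lax
    }

𝓕 : FrobeniusTheory s i → CartesianBicategory 0ℓ s (s ⊔ i) (s ⊔ i)
𝓕 T = FrobeniusSyntax.bicategory T

record StrictMonoidalFunctor (S : StrictSMC o ℓ e) (D : StrictSMC o′ ℓ′ e′) :
                             Set (o ⊔ ℓ ⊔ e ⊔ o′ ⊔ ℓ′ ⊔ e′) where
  private
    module S = StrictSMC S
    module D = StrictSMC D
  field
    F₀     : S.Obj → D.Obj
    F₁     : ∀ {A B} → S.Hom A B → D.Hom (F₀ A) (F₀ B)
    F-cong : ∀ {A B} {f g : S.Hom A B} → f S.≈ g → F₁ f D.≈ F₁ g
    F-id   : ∀ {A} → F₁ (S.id {A}) D.≈ D.id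
    F-⨾    : ∀ {A B C} {f : S.Hom A B} {g : S.Hom B C} →
             F₁ (f S.⨾ g) D.≈ F₁ f D.⨾ F₁ g
    F-I    : F₀ S.I ≡ D.I
    F-⊕₀   : ∀ A B → F₀ (A S.⊕₀ B) ≡ F₀ A D.⊕₀ F₀ B
    F-⊕₁   : ∀ {A B A′ B′} {f : S.Hom A B} {g : S.Hom A′ B′} →
             F₁ (f S.⊕₁ g) D.≋ F₁ f D.⊕₁ F₁ g
    F-σ    : ∀ {A B} → F₁ (S.σ A B) D.≋ D.σ (F₀ A) (F₀ B)

record _≗_ {S : StrictSMC o ℓ e} {D : StrictSMC o′ ℓ′ e′}
           (F G : StrictMonoidalFunctor S D) :
           Set (o ⊔ ℓ ⊔ o′ ⊔ ℓ′ ⊔ e′) where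
  private
    module S = StrictSMC S
    module D = StrictSMC D
    module F = StrictMonoidalFunctor F
    module G = StrictMonoidalFunctor G
  field
    F₀≡ : ∀ A → F.F₀ A ≡ G.F₀ A
    F₁≋ : ∀ {A B} (f : S.Hom A B) → F.F₁ f D.≋ G.F₁ f

-- Strict preservation of the chosen products A ⊕₀ B, their projections, and the
-- terminal object I.
record ProductPreservingFunctor
         (L : CartesianCategory o ℓ e) (D : CartesianCategory o′ ℓ′ e′) :
         Set (o ⊔ ℓ ⊔ e ⊔ o′ ⊔ ℓ′ ⊔ e′) where
  private
    module L = CartesianCategory L
    module D = CartesianCategory D
  field
    functor : StrictMonoidalFunctor L.smc D.smc
  open StrictMonoidalFunctor functor public
  field
    F-π₁ : ∀ A B → F₁ (L.π₁ A B) D.≋ D.π₁ (F₀ A) (F₀ B)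
    F-π₂ : ∀ A B → F₁ (L.π₂ A B) D.≋ D.π₂ (F₀ A) (F₀ B)

record CartesianBifunctor
         (B : CartesianBicategory o ℓ e r) (C : CartesianBicategory o′ ℓ′ e′ r′) :
         Set (o ⊔ ℓ ⊔ e ⊔ r ⊔ o′ ⊔ ℓ′ ⊔ e′ ⊔ r′) where
  private
    module B = CartesianBicategory B
    module C = CartesianBicategory C
  field
    functor : StrictMonoidalFunctor B.smc C.smc
  open StrictMonoidalFunctor functor public
  field
    F-mono : ∀ {X Y} {f g : B.Hom X Y} → f B.≤ g → F₁ f C.≤ F₁ g
    F-Δ    : ∀ X → F₁ (B.Δ X) C.≋ C.Δ (F₀ X)
    F-!    : ∀ X → F₁ (B.! X) C.≋ C.! (F₀ X)

record MonoidalTransformation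
         {S : StrictSMC o ℓ e} {D : StrictSMC o′ ℓ′ e′}
         (F G : StrictMonoidalFunctor S D) : Set (o ⊔ ℓ ⊔ ℓ′ ⊔ e′) where
  private
    module S = StrictSMC S
    module D = StrictSMC D
    module F = StrictMonoidalFunctor F
    module G = StrictMonoidalFunctor G
  field
    α       : ∀ A → D.Hom (F.F₀ A) (G.F₀ A)
    natural : ∀ {A B} (f : S.Hom A B) → F.F₁ f D.⨾ α B D.≈ α A D.⨾ G.F₁ f
    α-⊕     : ∀ A B → α (A S.⊕₀ B) D.≋ α A D.⊕₁ α B
    α-I     : α S.I D.≋ D.id {D.I}

record LaxTransformation
         {B : CartesianBicategory o ℓ e r} {C : CartesianBicategory o′ ℓ′ e′ r′}
         (F G : CartesianBifunctor B C) : Set (o ⊔ ℓ ⊔ ℓ′ ⊔ e′ ⊔ r′) where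
  private
    module B = CartesianBicategory B
    module C = CartesianBicategory C
    module F = CartesianBifunctor F
    module G = CartesianBifunctor G
  field
    α   : ∀ X → C.Hom (F.F₀ X) (G.F₀ X)
    lax : ∀ {X Y} (f : B.Hom X Y) → F.F₁ f C.⨾ α Y C.≤ α X C.⨾ G.F₁ f
    α-⊕ : ∀ X Y → α (X B.⊕₀ Y) C.≋ α X C.⊕₁ α Y
    α-I : α B.I C.≋ C.id {C.I}

-- Isomorphism of categories refers to equality of objects.  For categories of
-- functors this is pointwise equality `_≗_`, which without function
-- extensionality is not `_≡_`.  So categories are equipped with an equality of
-- objects, together with coherent identity arrows `τ p` along it.
record Category⁼ (o ℓ e h : Level) : Set (lsuc (o ⊔ ℓ ⊔ e ⊔ h)) where
  infix 4 _≃_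
  field
    category : Category o ℓ e
  open Category category public
  field
    _≃_             : Obj → Obj → Set h
    ≃-isEquivalence : IsEquivalence _≃_
    τ    : ∀ {A B} → A ≃ B → Hom A B
    τ-id : ∀ {A} (p : A ≃ A) → τ p ≈ id
    τ-⨾  : ∀ {A B C} (p : A ≃ B) (q : B ≃ C) (r : A ≃ C) → τ p ⨾ τ q ≈ τ r

record Functor⁼ (𝓐 : Category⁼ o ℓ e h) (𝓑 : Category⁼ o′ ℓ′ e′ h′) :
                Set (o ⊔ ℓ ⊔ e ⊔ h ⊔ o′ ⊔ ℓ′ ⊔ e′ ⊔ h′) where
  private
    module 𝓐 = Category⁼ 𝓐
    module 𝓑 = Category⁼ 𝓑
  field
    F₀     : 𝓐.Obj → 𝓑.Obj
    F₁     : ∀ {A B} → 𝓐.Hom A B → 𝓑.Hom (F₀ A) (F₀ B)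
    F-cong : ∀ {A B} {f g : 𝓐.Hom A B} → f 𝓐.≈ g → F₁ f 𝓑.≈ F₁ g
    F-id   : ∀ {A} → F₁ (𝓐.id {A}) 𝓑.≈ 𝓑.id
    F-⨾    : ∀ {A B C} {f : 𝓐.Hom A B} {g : 𝓐.Hom B C} →
             F₁ (f 𝓐.⨾ g) 𝓑.≈ F₁ f 𝓑.⨾ F₁ g
    F-≃    : ∀ {A B} → A 𝓐.≃ B → F₀ A 𝓑.≃ F₀ B
    F-τ    : ∀ {A B} (p : A 𝓐.≃ B) → F₁ (𝓐.τ p) 𝓑.≈ 𝓑.τ (F-≃ p)

-- G ∘ F equals the identity functor, on objects and on arrows
record IsRetraction {𝓐 : Category⁼ o ℓ e h} {𝓑 : Category⁼ o′ ℓ′ e′ h′}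
                    (F : Functor⁼ 𝓐 𝓑) (G : Functor⁼ 𝓑 𝓐) :
                    Set (o ⊔ ℓ ⊔ e ⊔ h) where
  private
    module 𝓐 = Category⁼ 𝓐
    module F = Functor⁼ F
    module G = Functor⁼ G
  field
    obj : ∀ A → G.F₀ (F.F₀ A) 𝓐.≃ A
    hom : ∀ {A B} (f : 𝓐.Hom A B) →
          G.F₁ (F.F₁ f) 𝓐.⨾ 𝓐.τ (obj B) 𝓐.≈ 𝓐.τ (obj A) 𝓐.⨾ f

record _≅_ (𝓐 : Category⁼ o ℓ e h) (𝓑 : Category⁼ o′ ℓ′ e′ h′) :
           Set (o ⊔ ℓ ⊔ e ⊔ h ⊔ o′ ⊔ ℓ′ ⊔ e′ ⊔ h′) where
  field
    to      : Functor⁼ 𝓐 𝓑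
    from    : Functor⁼ 𝓑 𝓐
    from∘to : IsRetraction to from
    to∘from : IsRetraction from to

module _ {S : StrictSMC o ℓ e} {D : StrictSMC o′ ℓ′ e′} where
  private
    module S = StrictSMC S
    module D = StrictSMC D
  open HetProperties D.category
  open StrictMonoidalFunctor
  open _≗_

  ≗-isEquivalence : IsEquivalence (_≗_ {S = S} {D = D})
  ≗-isEquivalence = record
    { refl  = record { F₀≡ = λ _ → refl ; F₁≋ = λ _ → hrefl }
    ; sym   = λ p → record
        { F₀≡ = λ A → sym (F₀≡ p A) ; F₁≋ = λ f → hsym (F₁≋ p f) }
    ; trans = λ p q → record
        { F₀≡ = λ A → trans (F₀≡ p A) (F₀≡ q A)
        ; F₁≋ = λ f → htrans (F₁≋ p f) (F₁≋ q f)
        }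
    }

  module _ {F G : StrictMonoidalFunctor S D} (p : F ≗ G) where

    coe-natural : ∀ {A B} (f : S.Hom A B) →
                  F₁ F f D.⨾ D.coe (F₀≡ p B) D.≈ D.coe (F₀≡ p A) D.⨾ F₁ G f
    coe-natural {A} {B} f = ≋⇒≈ (htrans (⨾-coe (F₀≡ p B))
      (htrans (F₁≋ p f) (hsym (coe-⨾ (F₀≡ p A)))))

    coe-⊕≋ : ∀ A B → D.coe (F₀≡ p (A S.⊕₀ B)) D.≋
                     D.coe (F₀≡ p A) D.⊕₁ D.coe (F₀≡ p B)
    coe-⊕≋ A B = htrans (coe≋id (F₀≡ p (A S.⊕₀ B)))
      (htrans (id≋ (F-⊕₀ F A B)) (htrans (hsym id⊕id≋)
      (hsym (⊕≋ (coe≋id (F₀≡ p A)) (coe≋id (F₀≡ p B))))))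
      where open SMCProperties D

    coe-I≋ : D.coe (F₀≡ p S.I) D.≋ D.id {D.I}
    coe-I≋ = htrans (coe≋id (F₀≡ p S.I)) (id≋ (F-I F))

  id-I≋ : (F : StrictMonoidalFunctor S D) → D.id {F₀ F S.I} D.≋ D.id {D.I}
  id-I≋ F = id≋ (F-I F)

  id-⊕≋ : (F : StrictMonoidalFunctor S D) → ∀ A B →
          D.id {F₀ F (A S.⊕₀ B)} D.≋ D.id {F₀ F A} D.⊕₁ D.id {F₀ F B}
  id-⊕≋ F A B = htrans (id≋ (F-⊕₀ F A B)) (≈⇒≋ (D.≈-sym D.⊕-id))
    where open D

  coe-self : ∀ {A} (p : A ≡ A) → D.coe p D.≈ D.id
  coe-self refl = D.≈-refl

  coe-trans : ∀ {A B C} (p : A ≡ B) (q : B ≡ C) (r : A ≡ C) →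
              D.coe p D.⨾ D.coe q D.≈ D.coe r
  coe-trans refl refl refl = D.identityˡ

ProductPreservingFunctors :
  CartesianCategory o ℓ e → CartesianCategory o′ ℓ′ e′ →
  Category⁼ (o ⊔ ℓ ⊔ e ⊔ o′ ⊔ ℓ′ ⊔ e′) (o ⊔ ℓ ⊔ ℓ′ ⊔ e′) (o ⊔ e′)
            (o ⊔ ℓ ⊔ o′ ⊔ ℓ′ ⊔ e′)
ProductPreservingFunctors L D = record
  { category = record
      { Obj = ProductPreservingFunctor L D
      ; Hom = λ F G → MonoidalTransformation (functor F) (functor G)
      ; _≈_ = λ φ ψ → ∀ A → α φ A D.≈ α ψ A
      ; id = λ {F} → record
          { α = λ _ → D.id
          ; natural = λ _ → D.≈-trans D.identityʳ (D.≈-sym D.identityˡ)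
          ; α-⊕ = id-⊕≋ (functor F)
          ; α-I = id-I≋ (functor F)
          }
      ; _⨾_ = λ φ ψ → record
          { α = λ A → α φ A D.⨾ α ψ A
          ; natural = λ f → D.≈-trans (pull (natural φ f)) (D.≈-trans D.assoc
              (D.≈-trans (⨾-congˡ (natural ψ f)) (D.≈-sym D.assoc)))
          ; α-⊕ = λ A B → htrans (⨾-cong≋ (α-⊕ φ A B) (α-⊕ ψ A B))
              (D.≈⇒≋ (D.≈-sym D.⊕-⨾))
          ; α-I = htrans (⨾-cong≋ (α-I φ) (α-I ψ)) (D.≈⇒≋ D.identityˡ)
          }
      ; isEquivalence = record
          { refl = λ _ → D.≈-refl
          ; sym = λ p A → D.≈-sym (p A)
          ; trans = λ p q A → D.≈-trans (p A) (q A)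
          }
      ; ⨾-cong = λ p q A → D.⨾-cong (p A) (q A)
      ; identityˡ = λ _ → D.identityˡ
      ; identityʳ = λ _ → D.identityʳ
      ; assoc = λ _ → D.assoc
      }
  ; _≃_ = λ F G → functor F ≗ functor G
  ; ≃-isEquivalence = record
      { refl = IsEquivalence.refl ≗-isEquivalence
      ; sym = IsEquivalence.sym ≗-isEquivalence
      ; trans = IsEquivalence.trans ≗-isEquivalence
      }
  ; τ = λ p → record
      { α = λ A → D.coe (_≗_.F₀≡ p A)
      ; natural = coe-natural p
      ; α-⊕ = coe-⊕≋ p
      ; α-I = coe-I≋ p
      }
  ; τ-id = λ p A → coe-self {S = L.smc} {D = D.smc} (_≗_.F₀≡ p A)
  ; τ-⨾ = λ p q r A → coe-trans {S = L.smc} {D = D.smc}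
      (_≗_.F₀≡ p A) (_≗_.F₀≡ q A) (_≗_.F₀≡ r A)
  }
  where
  module L = CartesianCategory L
  module D = CartesianCategory D
  open ProductPreservingFunctor using (functor)
  open MonoidalTransformation
  open HetProperties D.category
  open SMCProperties D.smc

CartesianBifunctors :
  CartesianBicategory o ℓ e r → CartesianBicategory o′ ℓ′ e′ r′ →
  Category⁼ (o ⊔ ℓ ⊔ e ⊔ r ⊔ o′ ⊔ ℓ′ ⊔ e′ ⊔ r′) (o ⊔ ℓ ⊔ ℓ′ ⊔ e′ ⊔ r′) (o ⊔ e′)
            (o ⊔ ℓ ⊔ o′ ⊔ ℓ′ ⊔ e′)
CartesianBifunctors B C = record
  { category = record
      { Obj = CartesianBifunctor B C
      ; Hom = LaxTransformation
      ; _≈_ = λ φ ψ → ∀ A → α φ A C.≈ α ψ A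
      ; id = λ {F} → record
          { α = λ _ → C.id
          ; lax = λ _ → C.≈⇒≤ (C.≈-trans C.identityʳ (C.≈-sym C.identityˡ))
          ; α-⊕ = id-⊕≋ (functor F)
          ; α-I = id-I≋ (functor F)
          }
      ; _⨾_ = λ φ ψ → record
          { α = λ A → α φ A C.⨾ α ψ A
          ; lax = λ f → ≤-respˡ (C.≈-sym C.assoc) (C.≤-trans
              (⨾-monoʳ (lax φ f)) (≤-respˡ C.assoc
              (≤-respʳ (⨾-monoˡ (lax ψ f)) C.assoc)))
          ; α-⊕ = λ A B → htrans (⨾-cong≋ (α-⊕ φ A B) (α-⊕ ψ A B))
              (C.≈⇒≋ (C.≈-sym C.⊕-⨾))
          ; α-I = htrans (⨾-cong≋ (α-I φ) (α-I ψ)) (C.≈⇒≋ C.identityˡ)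
          }
      ; isEquivalence = record
          { refl = λ _ → C.≈-refl
          ; sym = λ p A → C.≈-sym (p A)
          ; trans = λ p q A → C.≈-trans (p A) (q A)
          }
      ; ⨾-cong = λ p q A → C.⨾-cong (p A) (q A)
      ; identityˡ = λ _ → C.identityˡ
      ; identityʳ = λ _ → C.identityʳ
      ; assoc = λ _ → C.assoc
      }
  ; _≃_ = λ F G → functor F ≗ functor G
  ; ≃-isEquivalence = record
      { refl = IsEquivalence.refl ≗-isEquivalence
      ; sym = IsEquivalence.sym ≗-isEquivalence
      ; trans = IsEquivalence.trans ≗-isEquivalence
      }
  ; τ = λ p → record
      { α = λ A → C.coe (_≗_.F₀≡ p A)
      ; lax = λ f → C.≈⇒≤ (coe-natural p f)
      ; α-⊕ = coe-⊕≋ p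
      ; α-I = coe-I≋ p
      }
  ; τ-id = λ p A → coe-self {S = B.smc} {D = C.smc} (_≗_.F₀≡ p A)
  ; τ-⨾ = λ p q r A → coe-trans {S = B.smc} {D = C.smc}
      (_≗_.F₀≡ p A) (_≗_.F₀≡ q A) (_≗_.F₀≡ r A)
  }
  where
  module B = CartesianBicategory B
  module C = CartesianBicategory C
  open CartesianBifunctor using (functor)
  open LaxTransformation
  open HetProperties C.category
  open FrobeniusProperties C.orderedSMC using (⨾-monoˡ; ⨾-monoʳ; ≤-respˡ; ≤-respʳ)

Mod-CAR : (T : CartesianTheory s i) (D : CartesianCategory o ℓ e) →
          Category⁼ (s ⊔ i ⊔ o ⊔ ℓ ⊔ e) (s ⊔ ℓ ⊔ e) e (s ⊔ o ⊔ ℓ ⊔ e)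
Mod-CAR T D = ProductPreservingFunctors (𝓛 T) D

Mod-FROB : (T : FrobeniusTheory s i) (C : CartesianBicategory o ℓ e r) →
           Category⁼ (s ⊔ i ⊔ o ⊔ ℓ ⊔ e ⊔ r) (s ⊔ ℓ ⊔ e ⊔ r) e (s ⊔ o ⊔ ℓ ⊔ e)
Mod-FROB T C = CartesianBifunctors (𝓕 T) C

data OpSig (Op : ℕ → Set s) : Signature s where
  op : ∀ {n} → Op n → OpSig Op n 1

embedGen : ∀ {Op : ℕ → Set s} {m n} → CarGen Op m n → FrobGen (OpSig Op) m n
embedGen (op f)  = op (op f)
embedGen copy    = copy
embedGen discard = discard

embed : ∀ {Op : ℕ → Set s} {m n} →
        Term (CarGen Op) m n → Term (FrobGen (OpSig Op)) m n
embed = mapTerm embedGen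

-- E ⊎ Eᵒᵖ ⊎ I_OLCH; E is transported along the inclusion of terms without ∇, ¿.
data PlusIneq (T : CartesianTheory s i) :
              TermRel (FrobGen (OpSig (CartesianTheory.Op T))) (s ⊔ i) where
  eqn    : ∀ {n} {t u : Term _ n 1} → CartesianTheory.Eqn T t u →
           PlusIneq T (embed t) (embed u)
  eqn-op : ∀ {n} {t u : Term _ n 1} → CartesianTheory.Eqn T t u →
           PlusIneq T (embed u) (embed t)
  olch-! : ∀ {n} (f : CartesianTheory.Op T n) →
           PlusIneq T (!ₙ (gen discard) n) (gen (op (op f)) ⨟ gen discard)
  olch-Δ : ∀ {n} (f : CartesianTheory.Op T n) →
           PlusIneq T (Δₙ (gen copy) n ⨟ (gen (op (op f)) ⊗ gen (op (op f))))
                      (gen (op (op f)) ⨟ gen copy)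

_⁺ : CartesianTheory s i → FrobeniusTheory s (s ⊔ i)
T ⁺ = record { Sig = OpSig (CartesianTheory.Op T) ; Ineq = PlusIneq T }

{-# OPTIONS --safe #-}
module Submission where

-- In a cartesian bicategory of relations the order between maps is discrete, by
-- the Frobenius law.  A Frobenius model of T⁺ takes the cartesian terms to maps:
-- I_OLCH turns the lax comonoid inequations for the generators into equations.
-- A lax transformation has maps as components, since it is lax at Δ and !, so
-- its naturality squares at cartesian terms are inequalities of maps, hence
-- equations.  Conversely a cartesian model extends to all Frobenius terms, in
-- only one way since ∇ and ¿ are right adjoint to Δ and !, and naturality at
-- cartesian terms implies laxness at ∇ and ¿ because the components are maps.

open import Level using (Level; _⊔_)
open import Data.Nat using (ℕ; zero; suc; _+_)
open import Data.Nat.Properties using (+-assoc; +-identityʳ)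
open import Data.Product using (_,_; proj₁; proj₂)
open import Relation.Binary.PropositionalEquality
  using (_≡_; refl; sym; trans; cong)
open import Defs

private
  variable
    s i o ℓ e r : Level

-- Interpretations of terms in a strict symmetric monoidal category.

record Interpretation (S : Signature s) (D : StrictSMC o ℓ e) :
                      Set (s ⊔ o ⊔ ℓ ⊔ e) where
  open StrictSMC D hiding (σ-natural; σ-involutive; ≈-refl; ≈-sym; ≈-trans)
  field
    ob    : ℕ → Obj
    ob-0  : ob 0 ≡ I
    ob-+  : ∀ m n → ob (m + n) ≡ ob m ⊕₀ ob n
    ⟦_⟧   : ∀ {m n} → Term S m n → Hom (ob m) (ob n)
    ⟦id₀⟧ : ⟦ id₀ ⟧ ≈ id
    ⟦id₁⟧ : ⟦ id₁ ⟧ ≈ id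
    ⟦σ₁₁⟧ : ⟦ σ₁₁ ⟧ ≋ σ (ob 1) (ob 1)
    ⟦⨟⟧   : ∀ {l m n} (t : Term S l m) (u : Term S m n) →
            ⟦ t ⨟ u ⟧ ≈ ⟦ t ⟧ ⨾ ⟦ u ⟧
    ⟦⊗⟧   : ∀ {m n p q} (t : Term S m n) (u : Term S p q) →
            ⟦ t ⊗ u ⟧ ≋ ⟦ t ⟧ ⊕₁ ⟦ u ⟧

  open HetProperties category
  open SMCProperties D

  -- The arrows `f` and `g` may live on tensor products rather than on images of `ob`, so their
  -- middle objects need an equality of their own.
  ⟦⨟⟧-cong : ∀ {l m n A B B₁ E} (t : Term S l m) (u : Term S m n)
             {f : Hom A B} {g : Hom B₁ E} (p : B ≡ B₁) →
             ⟦ t ⟧ ≋ f → ⟦ u ⟧ ≋ g → ⟦ t ⨟ u ⟧ ≋ f ⨾⟦ p ⟧ g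
  ⟦⨟⟧-cong t u p q q′ =
    htrans (≈⇒≋ (⟦⨟⟧ t u)) (htrans ⨾≋⨾⟦⟧ (⨾⟦⟧-cong′ refl p q q′))

  ⟦⨟⟧-cong′ : ∀ {l m n A B E} (t : Term S l m) (u : Term S m n)
              {f : Hom A B} {g : Hom B E} →
              ⟦ t ⟧ ≋ f → ⟦ u ⟧ ≋ g → ⟦ t ⨟ u ⟧ ≋ f ⨾ g
  ⟦⨟⟧-cong′ t u q q′ = htrans (≈⇒≋ (⟦⨟⟧ t u)) (⨾-cong≋ q q′)

  ⟦⊗⟧-cong : ∀ {m n p q A B A′ B′} (t : Term S m n) (u : Term S p q)
             {f : Hom A B} {g : Hom A′ B′} →
             ⟦ t ⟧ ≋ f → ⟦ u ⟧ ≋ g → ⟦ t ⊗ u ⟧ ≋ f ⊕₁ g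
  ⟦⊗⟧-cong t u q q′ = htrans (⟦⊗⟧ t u) (⊕≋ q q′)

  ⟦id₁⟧≋ : ⟦ id₁ ⟧ ≋ id {ob 1}
  ⟦id₁⟧≋ = ≈⇒≋ ⟦id₁⟧

  ⟦idₜ⟧ : ∀ n → ⟦ idₜ n ⟧ ≋ id {ob n}
  ⟦idₜ⟧ zero    = ≈⇒≋ ⟦id₀⟧
  ⟦idₜ⟧ (suc n) = htrans (⟦⊗⟧-cong id₁ (idₜ n) ⟦id₁⟧≋ (⟦idₜ⟧ n))
    (htrans id⊕id≋ (id≋ (sym (ob-+ 1 n))))

  ⟦coeₜ⟧ : ∀ {m n} (p : m ≡ n) → ⟦ coeₜ p ⟧ ≋ id {ob n}
  ⟦coeₜ⟧ {m} refl = ⟦idₜ⟧ m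

  ⟦⨟coeₜ⟧ : ∀ {m n n′} (t : Term S m n) (p : n ≡ n′) →
            ⟦ t ⨟ coeₜ p ⟧ ≋ ⟦ t ⟧
  ⟦⨟coeₜ⟧ t p = htrans (⟦⨟⟧-cong t (coeₜ p) (cong ob p) hrefl (⟦coeₜ⟧ p)) idʳ≋

  ⟦coeₜ⨟⟧ : ∀ {m m′ n} (t : Term S m′ n) (p : m ≡ m′) →
            ⟦ coeₜ p ⨟ t ⟧ ≋ ⟦ t ⟧
  ⟦coeₜ⨟⟧ t p = htrans (⟦⨟⟧-cong (coeₜ p) t refl (⟦coeₜ⟧ p) hrefl) idˡ≋

  ⟦σ₁⟧ : ∀ n → ⟦ σ₁ n ⟧ ≋ σ (ob 1) (ob n)
  ⟦σ₁⟧ zero    = htrans ⟦id₁⟧≋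
    (hsym (htrans (σ≋ refl ob-0) (σ-identityʳ {ob 1})))
  ⟦σ₁⟧ (suc n) = htrans
    (⟦⨟⟧-cong (σ₁₁ ⊗ idₜ n) (id₁ ⊗ σ₁ n) (⊕₀-assoc (ob 1) (ob 1) (ob n))
      (⟦⊗⟧-cong σ₁₁ (idₜ n) ⟦σ₁₁⟧ (⟦idₜ⟧ n))
      (⟦⊗⟧-cong id₁ (σ₁ n) ⟦id₁⟧≋ (⟦σ₁⟧ n)))
    (htrans (hsym σ-hexagon⟦⟧) (σ≋ refl (sym (ob-+ 1 n))))

  -- The recursion of `σ₁` is the hexagon in the second argument and that of `σₜ` the hexagon in the
  -- first, so the value on `σ₁₁` determines all symmetries.
  ⟦σₜ⟧ : ∀ m n → ⟦ σₜ m n ⟧ ≋ σ (ob m) (ob n)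
  ⟦σₜ⟧ zero    n = htrans (⟦coeₜ⟧ (sym (+-identityʳ n)))
    (htrans (id≋ (cong ob (+-identityʳ n)))
    (hsym (htrans (σ≋ ob-0 refl) σ-identityˡ)))
  ⟦σₜ⟧ (suc m) n = htrans
    (⟦⨟⟧-cong (id₁ ⊗ σₜ m n) ((σ₁ n ⊗ idₜ m) ⨟ coeₜ (+-assoc n 1 m))
      (sym (⊕₀-assoc (ob 1) (ob n) (ob m)))
      (⟦⊗⟧-cong id₁ (σₜ m n) ⟦id₁⟧≋ (⟦σₜ⟧ m n))
      (htrans (⟦⨟coeₜ⟧ (σ₁ n ⊗ idₜ m) (+-assoc n 1 m))
        (⟦⊗⟧-cong (σ₁ n) (idₜ m) (⟦σ₁⟧ n) (⟦idₜ⟧ m))))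
    (htrans (hsym σ-hexagon′) (σ≋ (sym (ob-+ 1 m)) refl))

  -- An interpretation is only required to respect the term formers. Each law then follows from the
  -- same law in `D`, once the coercions on both sides are removed.
  ⟦⟧-law : ∀ {m n} {t u : Term S m n} → SMCLaw t u → ⟦ t ⟧ ≈ ⟦ u ⟧
  ⟦⟧-law (identityˡ {m} {t = t}) = ≋⇒≈
    (htrans (⟦⨟⟧-cong (idₜ m) t refl (⟦idₜ⟧ m) hrefl) idˡ≋)
  ⟦⟧-law (identityʳ {n = n} {t}) = ≋⇒≈
    (htrans (⟦⨟⟧-cong t (idₜ n) refl hrefl (⟦idₜ⟧ n)) idʳ≋)
  ⟦⟧-law (assoc {t = t} {u} {v}) = ≋⇒≈ (htrans
    (⟦⨟⟧-cong (t ⨟ u) v refl (⟦⨟⟧-cong t u refl hrefl hrefl) hrefl)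
    (htrans ⨾⟦⟧-assoc
    (hsym (⟦⨟⟧-cong t (u ⨟ v) refl hrefl (⟦⨟⟧-cong u v refl hrefl hrefl)))))
  ⟦⟧-law (⊗-id m n) = ≋⇒≈ (htrans
    (⟦⊗⟧-cong (idₜ m) (idₜ n) (⟦idₜ⟧ m) (⟦idₜ⟧ n))
    (htrans id⊕id≋ (htrans (id≋ (sym (ob-+ m n))) (hsym (⟦idₜ⟧ (m + n))))))
  ⟦⟧-law (⊗-⨟ {t = t} {u} {t′} {u′}) = ≋⇒≈ (htrans
    (⟦⊗⟧-cong (t ⨟ u) (t′ ⨟ u′) (≈⇒≋ (⟦⨟⟧ t u)) (≈⇒≋ (⟦⨟⟧ t′ u′)))
    (htrans (≈⇒≋ ⊕-⨾)
    (hsym (⟦⨟⟧-cong′ (t ⊗ t′) (u ⊗ u′) (⟦⊗⟧ t t′) (⟦⊗⟧ u u′)))))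
  ⟦⟧-law (⊗-assoc {l} {l′} {m} {m′} {n} {n′} {t} {u} {v}) = ≋⇒≈ (htrans
    (⟦⨟coeₜ⟧ ((t ⊗ u) ⊗ v) (+-assoc l′ m′ n′))
    (htrans (⟦⊗⟧-cong (t ⊗ u) v (⟦⊗⟧ t u) hrefl)
    (htrans ⊕-assoc
    (hsym (htrans (⟦coeₜ⨟⟧ (t ⊗ (u ⊗ v)) (+-assoc l m n))
      (⟦⊗⟧-cong t (u ⊗ v) hrefl (⟦⊗⟧ u v)))))))
  ⟦⟧-law (⊗-identityˡ {t = t}) = ≋⇒≈ (htrans
    (⟦⊗⟧-cong id₀ t (htrans (≈⇒≋ ⟦id₀⟧) (id≋ ob-0)) hrefl) ⊕-identityˡ)
  ⟦⟧-law (⊗-identityʳ {m} {n} {t}) = ≋⇒≈ (htrans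
    (⟦⨟coeₜ⟧ (t ⊗ id₀) (+-identityʳ n))
    (htrans (⟦⊗⟧-cong t id₀ hrefl (htrans (≈⇒≋ ⟦id₀⟧) (id≋ ob-0)))
    (htrans ⊕-identityʳ (hsym (⟦coeₜ⨟⟧ t (+-identityʳ m))))))
  ⟦⟧-law (σ-natural {m} {m′} {n} {n′} {t} {u}) = ≋⇒≈ (htrans
    (⟦⨟⟧-cong′ (t ⊗ u) (σₜ m′ n′) (⟦⊗⟧ t u) (⟦σₜ⟧ m′ n′))
    (htrans (≈⇒≋ (StrictSMC.σ-natural D))
    (hsym (⟦⨟⟧-cong′ (σₜ m n) (u ⊗ t) (⟦σₜ⟧ m n) (⟦⊗⟧ u t)))))
  ⟦⟧-law (σ-involutive m n) = ≋⇒≈ (htrans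
    (⟦⨟⟧-cong′ (σₜ m n) (σₜ n m) (⟦σₜ⟧ m n) (⟦σₜ⟧ n m))
    (htrans (≈⇒≋ (StrictSMC.σ-involutive D))
    (htrans (id≋ (sym (ob-+ m n))) (hsym (⟦idₜ⟧ (m + n))))))
  ⟦⟧-law (σ-hexagon l m n) = ≋⇒≈ (htrans
    (⟦⨟coeₜ⟧ (σₜ l (m + n)) (+-assoc m n l))
    (htrans (⟦σₜ⟧ l (m + n))
    (htrans (σ≋ refl (ob-+ m n))
    (htrans σ-hexagon⟦⟧
    (hsym (htrans (⟦coeₜ⨟⟧ ((σₜ l m ⊗ idₜ n) ⨟ right) (sym (+-assoc l m n)))
    (⟦⨟⟧-cong (σₜ l m ⊗ idₜ n) right (⊕₀-assoc (ob m) (ob l) (ob n))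
      (⟦⊗⟧-cong (σₜ l m) (idₜ n) (⟦σₜ⟧ l m) (⟦idₜ⟧ n))
      (htrans (⟦coeₜ⨟⟧ (idₜ m ⊗ σₜ l n) (+-assoc m l n))
        (⟦⊗⟧-cong (idₜ m) (σₜ l n) (⟦idₜ⟧ m) (⟦σₜ⟧ l n))))))))))
    where
    right : Term S ((m + l) + n) (m + (n + l))
    right = coeₜ (+-assoc m l n) ⨟ (idₜ m ⊗ σₜ l n)

  module _ {R : TermRel S r}
           (⟦⟧-base : ∀ {m n} {t u : Term S m n} → R t u → ⟦ t ⟧ ≈ ⟦ u ⟧) where

    -- Besides the cartesian prop this serves the ordered one, whose `smc` steps are the case of an
    -- empty base relation.
    ⟦⟧-Equal : ∀ {m n} {t u : Term S m n} → Equal R t u → ⟦ t ⟧ ≈ ⟦ u ⟧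
    ⟦⟧-Equal (law p)       = ⟦⟧-law p
    ⟦⟧-Equal (base p)      = ⟦⟧-base p
    ⟦⟧-Equal ≈-refl        = StrictSMC.≈-refl D
    ⟦⟧-Equal (≈-sym p)     = StrictSMC.≈-sym D (⟦⟧-Equal p)
    ⟦⟧-Equal (≈-trans p q) = StrictSMC.≈-trans D (⟦⟧-Equal p) (⟦⟧-Equal q)
    ⟦⟧-Equal (⨟-cong {t = t} {t′} {u} {u′} p q) = ≋⇒≈ (htrans
      (⟦⨟⟧-cong′ t u (≈⇒≋ (⟦⟧-Equal p)) (≈⇒≋ (⟦⟧-Equal q)))
      (hsym (≈⇒≋ (⟦⨟⟧ t′ u′))))
    ⟦⟧-Equal (⊗-cong {t = t} {t′} {u} {u′} p q) = ≋⇒≈ (htrans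
      (⟦⊗⟧-cong t u (≈⇒≋ (⟦⟧-Equal p)) (≈⇒≋ (⟦⟧-Equal q)))
      (hsym (⟦⊗⟧ t′ u′)))

module _ {S : Signature s} {D : StrictSMC o ℓ e} (J K : Interpretation S D) where
  private
    module J = Interpretation J
    module K = Interpretation K
  open StrictSMC D using (_≋_; ≈⇒≋)
  open HetProperties (StrictSMC.category D)
  open SMCProperties D

  -- The uniqueness half of the universal property of the free prop. It replaces inductions on terms
  -- wherever two models or functors are compared.
  interpretation-unique :
    (∀ n → J.ob n ≡ K.ob n) →
    (∀ {m n} (g : S m n) → J.⟦ gen g ⟧ ≋ K.⟦ gen g ⟧) →
    ∀ {m n} (t : Term S m n) → J.⟦ t ⟧ ≋ K.⟦ t ⟧
  interpretation-unique p q = go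
    where
    go : ∀ {m n} (t : Term S m n) → J.⟦ t ⟧ ≋ K.⟦ t ⟧
    go (gen g) = q g
    go id₀     = htrans (≈⇒≋ J.⟦id₀⟧) (htrans (id≋ (p 0)) (hsym (≈⇒≋ K.⟦id₀⟧)))
    go id₁     = htrans J.⟦id₁⟧≋ (htrans (id≋ (p 1)) (hsym K.⟦id₁⟧≋))
    go σ₁₁     = htrans J.⟦σ₁₁⟧ (htrans (σ≋ (p 1) (p 1)) (hsym K.⟦σ₁₁⟧))
    go (t ⨟ u) = htrans (J.⟦⨟⟧-cong′ t u (go t) (go u)) (hsym (≈⇒≋ (K.⟦⨟⟧ t u)))
    go (t ⊗ u) = htrans (J.⟦⊗⟧-cong t u (go t) (go u)) (hsym (K.⟦⊗⟧ t u))

restrict : ∀ {s′} {S : Signature s} {S′ : Signature s′} {D : StrictSMC o ℓ e} →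
           (∀ {m n} → S m n → S′ m n) → Interpretation S′ D → Interpretation S D
restrict h J = record
  { ob    = ob
  ; ob-0  = ob-0
  ; ob-+  = ob-+
  ; ⟦_⟧   = λ t → ⟦ mapTerm h t ⟧
  ; ⟦id₀⟧ = ⟦id₀⟧
  ; ⟦id₁⟧ = ⟦id₁⟧
  ; ⟦σ₁₁⟧ = ⟦σ₁₁⟧
  ; ⟦⨟⟧   = λ t u → ⟦⨟⟧ (mapTerm h t) (mapTerm h u)
  ; ⟦⊗⟧   = λ t u → ⟦⊗⟧ (mapTerm h t) (mapTerm h u)
  }
  where
  open Interpretation J

module _ {o′ ℓ′ e′} {S : Signature s} {D : StrictSMC o ℓ e}
         {E : StrictSMC o′ ℓ′ e′} where
  private
    module D = StrictSMC D
    module E = StrictSMC E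
  open HetProperties E.category

  compose : StrictMonoidalFunctor D E → Interpretation S D → Interpretation S E
  compose F J = record
    { ob    = λ n → F₀ (ob n)
    ; ob-0  = trans (cong F₀ ob-0) F-I
    ; ob-+  = λ m n → trans (cong F₀ (ob-+ m n)) (F-⊕₀ (ob m) (ob n))
    ; ⟦_⟧   = λ t → F₁ ⟦ t ⟧
    ; ⟦id₀⟧ = E.≈-trans (F-cong ⟦id₀⟧) F-id
    ; ⟦id₁⟧ = E.≈-trans (F-cong ⟦id₁⟧) F-id
    ; ⟦σ₁₁⟧ = htrans (F-cong≋ ⟦σ₁₁⟧) F-σ
    ; ⟦⨟⟧   = λ t u → E.≈-trans (F-cong (⟦⨟⟧ t u)) F-⨾
    ; ⟦⊗⟧   = λ t u → htrans (F-cong≋ (⟦⊗⟧ t u)) F-⊕₁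
    }
    where
    open Interpretation J
    open StrictMonoidalFunctor F
    F-cong≋ : ∀ {A B A′ B′} {f : D.Hom A B} {g : D.Hom A′ B′} →
              f D.≋ g → F₁ f E.≋ F₁ g
    F-cong≋ (D.≈⇒≋ p) = E.≈⇒≋ (F-cong p)

-- Maps and adjoints in a cartesian bicategory.

module BicategoryProperties (C : CartesianBicategory o ℓ e r) where
  private
    module C = CartesianBicategory C
    module Fr = C.Frobenius
  open CartesianBicategory C
  open HetProperties category
  open SMCProperties C.smc
  open FrobeniusProperties orderedSMC
  open Maps C
  open IsMap

  ≤-resp≋ : ∀ {A B A′ B′} {f g : Hom A B} {f′ g′ : Hom A′ B′} →
            f ≋ f′ → g ≋ g′ → f ≤ g → f′ ≤ g′
  ≤-resp≋ (≈⇒≋ p) (≈⇒≋ q) f≤g = ≤-respˡ (C.≈-sym p) (≤-respʳ f≤g (C.≈-sym q))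

  IsMap-resp≋ : ∀ {A B A′ B′} {f : Hom A B} {g : Hom A′ B′} →
                f ≋ g → IsMap f → IsMap g
  IsMap-resp≋ (≈⇒≋ p) m = record
    { Δ-hom = C.≈-trans (⨾-congʳ (C.≈-sym p))
        (C.≈-trans (Δ-hom m) (⨾-congˡ (⊕-cong p p)))
    ; !-hom = C.≈-trans (⨾-congʳ (C.≈-sym p)) (!-hom m)
    }

  Δ≋ : ∀ {A B} → A ≡ B → Δ A ≋ Δ B
  Δ≋ refl = hrefl

  !≋ : ∀ {A B} → A ≡ B → ! A ≋ ! B
  !≋ refl = hrefl

  ∇≋ : ∀ {A B} → A ≡ B → ∇ A ≋ ∇ B
  ∇≋ refl = hrefl

  ¿≋ : ∀ {A B} → A ≡ B → ¿ A ≋ ¿ B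
  ¿≋ refl = hrefl

  -- The unit object is terminal among the maps, and the identity is a map.
  !-I : ! I ≈ id
  !-I = C.≈-sym (IsCartesian.!-unique mapCartesian (id , id-map))

  Δ-I : Δ I ≋ id {I}
  Δ-I = htrans (hsym (⨾-id≋ (htrans (≈⇒≋ (⊕-cong !-I C.≈-refl)) id⊕id≋)))
    (Fr.Δ-identityˡ I)

  -- `R ≤ R ⨾ L ⨾ R′ ≤ R′`, and symmetrically. This pins down the images of ∇ and ¿, whose
  -- preservation is not among the fields of a cartesian bifunctor.
  rightAdjoint-unique : ∀ {A B} {L : Hom A B} {R R′ : Hom B A} →
    id ≤ L ⨾ R → R ⨾ L ≤ id → id ≤ L ⨾ R′ → R′ ⨾ L ≤ id → R ≈ R′
  rightAdjoint-unique u c u′ c′ = ≤-antisym (below c u′) (below c′ u)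
    where
    below : ∀ {A B} {L : Hom A B} {R R′ : Hom B A} →
            R ⨾ L ≤ id → id ≤ L ⨾ R′ → R ≤ R′
    below counit unit = ≤-respˡ (C.≈-sym C.identityʳ) (C.≤-trans (⨾-monoˡ unit)
      (≤-respˡ (C.≈-sym C.assoc) (C.≤-trans (⨾-monoʳ counit) (≈⇒≤ C.identityˡ))))

  -- The hypothesis concerns the discarded leg: its `!` slides back to `A`, where the counit law
  -- removes it.
  fork-fst : ∀ {A B D} {f : Hom A B} {g : Hom A D} → g ⨾ ! D ≈ ! A →
             (Δ A ⨾ (f ⊕₁ g)) ⨾ (id ⊕₁ ! D) ≋ f
  fork-fst {A} p =
    _ ≋⟨ ≈⇒≋ (C.≈-trans C.assoc (⨾-congˡ (C.≈-trans (C.≈-sym ⊕-⨾)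
           (C.≈-trans (⊕-cong C.identityʳ p) (C.≈-sym split₂))))) ⟩
    _ ≋˘⟨ ≈⇒≋ C.assoc ⟩
    _ ≋⟨ ⨾-cong≋ (Fr.Δ-identityʳ A) ⊕-identityʳ ⟩
    _ ≋⟨ ≈⇒≋ C.identityˡ ⟩
    _ ∎

  fork-snd : ∀ {A B D} {f : Hom A B} {g : Hom A D} → f ⨾ ! B ≈ ! A →
             (Δ A ⨾ (f ⊕₁ g)) ⨾ (! B ⊕₁ id) ≋ g
  fork-snd {A} p =
    _ ≋⟨ ≈⇒≋ (C.≈-trans C.assoc (⨾-congˡ (C.≈-trans (C.≈-sym ⊕-⨾)
           (C.≈-trans (⊕-cong p C.identityʳ) (C.≈-sym split₁))))) ⟩
    _ ≋˘⟨ ≈⇒≋ C.assoc ⟩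
    _ ≋⟨ ⨾-cong≋ (Fr.Δ-identityˡ A) ⊕-identityˡ ⟩
    _ ≋⟨ ≈⇒≋ C.identityˡ ⟩
    _ ∎

  -- For f ≤ g the pairing h = Δ ⨾ (g ⊕ f) is contained in the diagonal,
  -- h ≤ h ⨾ ∇ ⨾ Δ, by the Frobenius law; its projections g and f thus agree.
  module _ {A B : Obj} {f g : Hom A B} (f-map : IsMap f) (g-map : IsMap g)
           (f≤g : f ≤ g) where
    private
      h : Hom A (B ⊕₀ B)
      h = Δ A ⨾ (g ⊕₁ f)

      -- `f ≤ f ⨾ Δ ⨾ ∇ = Δ ⨾ (f ⊕ f) ⨾ ∇`, and then `f ≤ g` is applied to the first leg.
      f≤h∇ : f ≤ h ⨾ ∇ B
      f≤h∇ = ≤-respˡ (C.≈-sym C.identityʳ) (C.≤-trans (⨾-monoˡ (Fr.id≤Δ∇ B))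
        (≤-respˡ (C.≈-sym C.assoc) (⨾-monoʳ (≤-respˡ (Δ-hom f-map)
        (⨾-monoˡ (⊕-mono f≤g ≤-refl))))))

      -- Coassociativity lets the two copies of `g` come from a single one, since `g` is a map; the
      -- Frobenius law then turns the remaining Δ and ∇ into `∇ ⨾ Δ`.
      rebracket : Δ A ⨾ (g ⊕₁ (h ⨾ ∇ B)) ≋ h ⨾ (∇ B ⨾ Δ B)
      rebracket =
        _ ≋˘⟨ ≈⇒≋ (C.≈-trans C.assoc (C.≈-trans (⨾-congˡ (C.≈-sym ⊕-⨾)) (⨾-congˡ
                (⊕-cong (C.≈-trans (⨾-congʳ C.identityˡ) C.identityʳ) C.≈-refl)))) ⟩
        (Δ A ⨾ ((id ⨾ g) ⊕₁ h)) ⨾ (id ⊕₁ ∇ B)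
          ≋⟨ ≈⇒≋ (⨾-congʳ (C.≈-trans (⨾-congˡ ⊕-⨾) (C.≈-sym C.assoc))) ⟩
        ((Δ A ⨾ (id ⊕₁ Δ A)) ⨾ (g ⊕₁ (g ⊕₁ f))) ⨾ (id ⊕₁ ∇ B)
          ≋⟨ ⨾≋⨾⟦⟧ ⟩
        _ ≋⟨ ⨾⟦⟧-cong′ refl (⊕₀-assoc B B B)
               (⨾-cong≋ (hsym (Fr.Δ-assoc A)) (hsym ⊕-assoc)) hrefl ⟩
        ((Δ A ⨾ (Δ A ⊕₁ id)) ⨾ ((g ⊕₁ g) ⊕₁ f))
            ⨾⟦ ⊕₀-assoc B B B ⟧ (id ⊕₁ ∇ B)
          ≋⟨ ⨾⟦⟧-cong′ (⊕₀-assoc B B B) (⊕₀-assoc B B B) (≈⇒≋ copy-first) hrefl ⟩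
        (h ⨾ (Δ B ⊕₁ id)) ⨾⟦ ⊕₀-assoc B B B ⟧ (id ⊕₁ ∇ B)
          ≋⟨ ⨾⟦⟧≋⨾[] ⟩
        _ ≋⟨ ≈⇒≋ (C.≈-trans C.assoc (⨾-congˡ (Fr.frobeniusˡ B))) ⟩
        h ⨾ (∇ B ⨾ Δ B) ∎
        where
        copy-first : (Δ A ⨾ (Δ A ⊕₁ id)) ⨾ ((g ⊕₁ g) ⊕₁ f) ≈ h ⨾ (Δ B ⊕₁ id)
        copy-first = C.≈-trans C.assoc (C.≈-trans (⨾-congˡ (C.≈-trans (C.≈-sym ⊕-⨾)
          (C.≈-trans (⊕-cong (C.≈-sym (Δ-hom g-map))
            (C.≈-trans C.identityˡ (C.≈-sym C.identityʳ))) ⊕-⨾))) (C.≈-sym C.assoc))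

      h≤h∇Δ : h ≤ h ⨾ (∇ B ⨾ Δ B)
      h≤h∇Δ = ≤-respʳ (⨾-monoˡ (⊕-mono ≤-refl f≤h∇)) (C.≈-sym (≋⇒≈ rebracket))

      -- Discard the second output in `h≤h∇Δ`: the left side becomes `g` because `f` preserves `!`,
      -- the right side `h ⨾ ∇` by the counit law.
      g≤h∇ : g ≤ h ⨾ ∇ B
      g≤h∇ = ≤-resp≋ (fork-fst (!-hom f-map))
        (htrans (≈⇒≋ (C.≈-trans C.assoc (⨾-congˡ C.assoc)))
          (htrans (⨾-cong≋ hrefl (⨾-id≋ (Fr.Δ-identityʳ B))) hrefl))
        (⨾-monoʳ h≤h∇Δ)

      -- Discard the first output in `h ⨾ ∇ ⨾ Δ ≤ h`; the right side becomes `f` because `g`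
      -- preserves `!`.
      h∇≤f : h ⨾ ∇ B ≤ f
      h∇≤f = ≤-resp≋
        (htrans (≈⇒≋ (⨾-congˡ C.assoc)) (⨾-cong≋ hrefl (⨾-id≋ (Fr.Δ-identityˡ B))))
        (htrans (≈⇒≋ (⨾-congˡ C.identityˡ)) (fork-snd (!-hom g-map)))
        (⨾-monoˡ {f = h} (⨾-monoʳ {g = ! B ⊕₁ id} (Fr.∇Δ≤id B)))

    map-≤⇒≈ : f ≈ g
    map-≤⇒≈ = ≤-antisym f≤g (C.≤-trans g≤h∇ h∇≤f)

  module _ {A B : Obj} {f : Hom A B} (f-map : IsMap f) where

    -- The mate of `Δ-hom` under the adjunctions Δ ⊣ ∇: insert the unit at `B`, move Δ through `f`,
    -- cancel with the counit at `A`. The same argument for ! ⊣ ¿ gives `¿-lax`.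
    ∇-lax : ∇ A ⨾ f ≤ (f ⊕₁ f) ⨾ ∇ B
    ∇-lax = ≤-respˡ (C.≈-sym C.identityʳ) (C.≤-trans (⨾-monoˡ (Fr.id≤Δ∇ B))
      (≤-respˡ (C.≈-trans (C.≈-sym C.assoc) (⨾-congʳ (C.≈-trans C.assoc
        (C.≈-trans (⨾-congˡ (Δ-hom f-map)) (C.≈-sym C.assoc)))))
      (⨾-monoʳ (C.≤-trans (⨾-monoʳ (Fr.∇Δ≤id A)) (≈⇒≤ C.identityˡ)))))

    ¿-lax : ¿ A ⨾ f ≤ ¿ B
    ¿-lax = ≤-respˡ (C.≈-sym C.identityʳ) (C.≤-trans (⨾-monoˡ (Fr.id≤!¿ B))
      (≤-respˡ (C.≈-trans (C.≈-sym C.assoc) (⨾-congʳ (C.≈-trans C.assoc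
        (⨾-congˡ (!-hom f-map)))))
      (C.≤-trans (⨾-monoʳ (Fr.¿!≤id A)) (≈⇒≤ C.identityˡ))))

-- Interpretation of the comonoid structure.

module ComonoidInterpretation
  (C : CartesianBicategory o ℓ e r) {S : Signature s}
  (J : Interpretation S (CartesianBicategory.smc C))
  {δ : Term S 1 2} {ε : Term S 1 0}
  (⟦δ⟧ : CartesianBicategory._≋_ C (Interpretation.⟦_⟧ J δ)
           (CartesianBicategory.Δ C (Interpretation.ob J 1)))
  (⟦ε⟧ : CartesianBicategory._≋_ C (Interpretation.⟦_⟧ J ε)
           (CartesianBicategory.! C (Interpretation.ob J 1)))
  where
  private
    module C = CartesianBicategory C
  open CartesianBicategory C using (_≈_; _≋_; ≈⇒≋; Δ; !)
  open HetProperties C.category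
  open SMCProperties C.smc
  open BicategoryProperties C
  open Interpretation J

  -- The recursion of `Δₙ` is `Δ-⊕` at `ob 1` and `ob n`, with the crossing in the role of `mid`;
  -- `Δ-I` starts the induction. As `δ` is any term with value Δ, this covers the cartesian and the
  -- Frobenius signature.
  ⟦Δₙ⟧ : ∀ n → ⟦ Δₙ δ n ⟧ ≋ Δ (ob n)
  ⟦Δₙ⟧ zero    = htrans (≈⇒≋ ⟦id₀⟧)
    (htrans (id≋ ob-0) (hsym (htrans (Δ≋ ob-0) Δ-I)))
  ⟦Δₙ⟧ (suc n) =
    _ ≋⟨ ⟦⨟⟧-cong (δ ⊗ Δₙ δ n) (crossing ⨟ coeₜ (cong suc (+-assoc n 1 n)))
           (C.mid-eq (ob 1) (ob 1) (ob n) (ob n))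
           (⟦⊗⟧-cong δ (Δₙ δ n) ⟦δ⟧ (⟦Δₙ⟧ n))
           (htrans (⟦⨟coeₜ⟧ crossing (cong suc (+-assoc n 1 n)))
             (⟦⊗⟧-cong id₁ (σₜ 1 n ⊗ idₜ n) ⟦id₁⟧≋
               (⟦⊗⟧-cong (σₜ 1 n) (idₜ n) (⟦σₜ⟧ 1 n) (⟦idₜ⟧ n)))) ⟩
    _ ≋⟨ ⨾⟦⟧-cong′ _ refl hrefl (hsym mid≋) ⟩
    _ ≋˘⟨ ⨾≋⨾⟦⟧ ⟩
    _ ≋˘⟨ ≈⇒≋ (C.Δ-⊕ (ob 1) (ob n)) ⟩
    _ ≋⟨ Δ≋ (sym (ob-+ 1 n)) ⟩
    Δ (ob (suc n)) ∎
    where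
    crossing : Term S (1 + ((1 + n) + n)) (1 + ((n + 1) + n))
    crossing = id₁ ⊗ (σₜ 1 n ⊗ idₜ n)

  ⟦!ₙ⟧ : ∀ n → ⟦ !ₙ ε n ⟧ ≋ ! (ob n)
  ⟦!ₙ⟧ zero    = htrans (≈⇒≋ ⟦id₀⟧)
    (htrans (id≋ ob-0) (hsym (htrans (!≋ ob-0) (≈⇒≋ !-I))))
  ⟦!ₙ⟧ (suc n) = htrans (⟦⊗⟧-cong ε (!ₙ ε n) ⟦ε⟧ (⟦!ₙ⟧ n))
    (htrans (hsym (C.!-⊕ (ob 1) (ob n))) (!≋ (sym (ob-+ 1 n))))

  ⟦⟧-comonoidLaw : ∀ {m n} {t u : Term S m n} →
                   ComonoidLaw δ ε t u → ⟦ t ⟧ ≈ ⟦ u ⟧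
  ⟦⟧-comonoidLaw Δ-assoc = ≋⇒≈ (htrans
    (⟦⨟⟧-cong′ δ (δ ⊗ id₁) ⟦δ⟧ (⟦⊗⟧-cong δ id₁ ⟦δ⟧ ⟦id₁⟧≋))
    (htrans (C.Frobenius.Δ-assoc (ob 1))
    (hsym (⟦⨟⟧-cong′ δ (id₁ ⊗ δ) ⟦δ⟧ (⟦⊗⟧-cong id₁ δ ⟦id₁⟧≋ ⟦δ⟧)))))
  ⟦⟧-comonoidLaw Δ-identityˡ = ≋⇒≈ (htrans
    (⟦⨟⟧-cong′ δ (ε ⊗ id₁) ⟦δ⟧ (⟦⊗⟧-cong ε id₁ ⟦ε⟧ ⟦id₁⟧≋))
    (htrans (C.Frobenius.Δ-identityˡ (ob 1)) (hsym ⟦id₁⟧≋)))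
  ⟦⟧-comonoidLaw Δ-identityʳ = ≋⇒≈ (htrans
    (⟦⨟⟧-cong′ δ (id₁ ⊗ ε) ⟦δ⟧ (⟦⊗⟧-cong id₁ ε ⟦id₁⟧≋ ⟦ε⟧))
    (htrans (C.Frobenius.Δ-identityʳ (ob 1)) (hsym ⟦id₁⟧≋)))
  ⟦⟧-comonoidLaw Δ-comm = ≋⇒≈ (htrans (⟦⨟⟧-cong′ δ σ₁₁ ⟦δ⟧ ⟦σ₁₁⟧)
    (htrans (≈⇒≋ (C.Frobenius.Δ-comm (ob 1))) (hsym ⟦δ⟧)))

-- Cartesian models as interpretations by maps.

-- Both kinds of models amount to this data.
record MapModel (T : CartesianTheory s i) (C : CartesianBicategory o ℓ e r) :
                Set (s ⊔ i ⊔ o ⊔ ℓ ⊔ e) where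
  open CartesianTheory T
  open CartesianBicategory C using (_≈_; _≋_; Δ; !)
  field
    interpretation : Interpretation (CarGen Op) (CartesianBicategory.smc C)
  open Interpretation interpretation public
  field
    ⟦op⟧-map  : ∀ {n} (f : Op n) → Maps.IsMap C ⟦ gen (op f) ⟧
    ⟦copy⟧    : ⟦ gen copy ⟧ ≋ Δ (ob 1)
    ⟦discard⟧ : ⟦ gen discard ⟧ ≋ ! (ob 1)
    ⟦eqn⟧     : ∀ {n} {t u : Term (CarGen Op) n 1} → Eqn t u → ⟦ t ⟧ ≈ ⟦ u ⟧

module MapModelProperties
  (T : CartesianTheory s i) (C : CartesianBicategory o ℓ e r)
  (𝓜 : MapModel T C) where
  open CartesianTheory T
  private
    module C = CartesianBicategory C
    module L = CartesianCategory (𝓛 T)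
    module M = CartesianCategory (Map C)
  open CartesianBicategory C using (_≈_; _≋_; _≤_; ≈⇒≋; Δ; !; ∇; ¿; Hom; coe)
  open HetProperties C.category
  open SMCProperties C.smc
  open FrobeniusProperties C.orderedSMC
  open BicategoryProperties C
  open Maps C
  open MapModel 𝓜
  private
    module CarInt = ComonoidInterpretation C interpretation ⟦copy⟧ ⟦discard⟧

  -- Maps contain the structural arrows and are closed under composition and tensor, so a model need
  -- only ask this of the operations.
  ⟦⟧-map : ∀ {m n} (t : Term (CarGen Op) m n) → IsMap ⟦ t ⟧
  ⟦⟧-map (gen (op f))  = ⟦op⟧-map f
  ⟦⟧-map (gen copy)    = IsMap-resp≋ (hsym ⟦copy⟧) Δ-map
  ⟦⟧-map (gen discard) = IsMap-resp≋ (hsym ⟦discard⟧) !-map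
  ⟦⟧-map id₀           = IsMap-resp≋ (hsym (≈⇒≋ ⟦id₀⟧)) id-map
  ⟦⟧-map id₁           = IsMap-resp≋ (hsym ⟦id₁⟧≋) id-map
  ⟦⟧-map σ₁₁           = IsMap-resp≋ (hsym ⟦σ₁₁⟧) σ-map
  ⟦⟧-map (t ⨟ u) =
    IsMap-resp≋ (hsym (≈⇒≋ (⟦⨟⟧ t u))) (⨾-map (⟦⟧-map t) (⟦⟧-map u))
  ⟦⟧-map (t ⊗ u) =
    IsMap-resp≋ (hsym (⟦⊗⟧ t u)) (⊕-map (⟦⟧-map t) (⟦⟧-map u))

  ⟦op⟧-Δ : ∀ {n} (f : Op n) →
           ⟦ gen (op f) ⨟ gen copy ⟧ ≈
           ⟦ Δₙ (gen copy) n ⨟ (gen (op f) ⊗ gen (op f)) ⟧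
  ⟦op⟧-Δ {n} f = ≋⇒≈ (htrans
    (⟦⨟⟧-cong′ (gen (op f)) (gen copy) hrefl ⟦copy⟧)
    (htrans (≈⇒≋ (IsMap.Δ-hom (⟦op⟧-map f)))
    (hsym (⟦⨟⟧-cong′ (Δₙ (gen copy) n) (gen (op f) ⊗ gen (op f))
      (CarInt.⟦Δₙ⟧ n) (⟦⊗⟧ (gen (op f)) (gen (op f)))))))

  ⟦op⟧-! : ∀ {n} (f : Op n) →
           ⟦ gen (op f) ⨟ gen discard ⟧ ≈ ⟦ !ₙ (gen discard) n ⟧
  ⟦op⟧-! {n} f = ≋⇒≈ (htrans (⟦⨟⟧-cong (gen (op f)) (gen discard) refl hrefl ⟦discard⟧)
    (htrans (hsym ⨾≋⨾⟦⟧) (htrans (≈⇒≋ (IsMap.!-hom (⟦op⟧-map f)))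
    (hsym (CarInt.⟦!ₙ⟧ n)))))

  ⟦⟧-axiom : ∀ {m n} {t u : Term (CarGen Op) m n} →
             CarAxiom T t u → ⟦ t ⟧ ≈ ⟦ u ⟧
  ⟦⟧-axiom (comonoid p) = CarInt.⟦⟧-comonoidLaw p
  ⟦⟧-axiom (op-Δ f)     = ⟦op⟧-Δ f
  ⟦⟧-axiom (op-! f)     = ⟦op⟧-! f
  ⟦⟧-axiom (eqn p)      = ⟦eqn⟧ p

  productPreservingFunctor : ProductPreservingFunctor (𝓛 T) (Map C)
  productPreservingFunctor = record
    { functor = record
        { F₀     = ob
        ; F₁     = λ t → ⟦ t ⟧ , ⟦⟧-map t
        ; F-cong = ⟦⟧-Equal ⟦⟧-axiom
        ; F-id   = λ {n} → ≋⇒≈ (⟦idₜ⟧ n)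
        ; F-⨾    = λ {f = t} {u} → ⟦⨟⟧ t u
        ; F-I    = ob-0
        ; F-⊕₀   = ob-+
        ; F-⊕₁   = λ {f = t} {u} → lift≋ (⟦⊗⟧ t u)
        ; F-σ    = λ {m} {n} → lift≋ (⟦σₜ⟧ m n)
        }
    -- A projection discards one factor, so its preservation comes down to that of `!ₙ`; the unit
    -- laws contribute only coercions.
    ; F-π₁ = λ m n → lift≋ (htrans
        (⟦⨟coe⟧ (idₜ m ⊗ !ₙ (gen discard) n) (+-identityʳ m)
          (htrans (⟦⊗⟧-cong (idₜ m) (!ₙ (gen discard) n) (⟦idₜ⟧ m) (CarInt.⟦!ₙ⟧ n))
            hrefl))
        (hsym (⨾-coeᴹ (C.⊕₀-identityʳ (ob m)))))
    ; F-π₂ = λ m n → lift≋ (htrans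
        (⟦⨟coe⟧ (!ₙ (gen discard) m ⊗ idₜ n) refl
          (⟦⊗⟧-cong (!ₙ (gen discard) m) (idₜ n) (CarInt.⟦!ₙ⟧ m) (⟦idₜ⟧ n)))
        (hsym (⨾-coeᴹ (C.⊕₀-identityˡ (ob n)))))
    }
    where
    ⟦⨟coe⟧ : ∀ {m n n′ A B} (t : Term (CarGen Op) m n) (p : n ≡ n′)
             {f : Hom A B} → ⟦ t ⟧ ≋ f → ⟦ t ⨟ L.coe p ⟧ ≋ f
    ⟦⨟coe⟧ t refl q = htrans (⟦⨟coeₜ⟧ t refl) q
    ⨾-coeᴹ : ∀ {A B B′} {f : Hom A B} (p : B ≡ B′) →
             f C.⨾ proj₁ (M.coe p) ≋ f
    ⨾-coeᴹ refl = ≈⇒≋ C.identityʳ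

  -- Extension of a map model to Frobenius terms.

  private
    FGen : Signature _
    FGen = FrobGen (OpSig Op)

  -- The values at `merge` and `create` are forced, being right adjoint to those at `copy` and
  -- `discard`. The coercions are there because `ob` is additive only up to propositional equality.
  eval : ∀ {m n} → Term FGen m n → Hom (ob m) (ob n)
  eval (gen (op (op f))) = ⟦ gen (op f) ⟧
  eval (gen copy)        = ⟦ gen copy ⟧
  eval (gen discard)     = ⟦ gen discard ⟧
  eval (gen merge)       = coe (ob-+ 1 1) C.⨾ ∇ (ob 1)
  eval (gen create)      = coe ob-0 C.⨾ ¿ (ob 1)
  eval id₀               = ⟦ id₀ ⟧
  eval id₁               = ⟦ id₁ ⟧
  eval σ₁₁               = ⟦ σ₁₁ ⟧
  eval (t ⨟ u)           = eval t C.⨾ eval u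
  eval (_⊗_ {m} {n} {p} {q} t u) =
    coe (ob-+ m p) C.⨾ ((eval t C.⊕₁ eval u) C.⨾ coe (sym (ob-+ n q)))

  extension : Interpretation FGen C.smc
  extension = record
    { ob    = ob
    ; ob-0  = ob-0
    ; ob-+  = ob-+
    ; ⟦_⟧   = eval
    ; ⟦id₀⟧ = ⟦id₀⟧
    ; ⟦id₁⟧ = ⟦id₁⟧
    ; ⟦σ₁₁⟧ = ⟦σ₁₁⟧
    ; ⟦⨟⟧   = λ _ _ → C.≈-refl
    ; ⟦⊗⟧   = λ {m} {n} {p} {q} _ _ →
        htrans (coe-⨾ (ob-+ m p)) (⨾-coe (sym (ob-+ n q)))
    }

  private
    module X = Interpretation extension
    module FrobInt = ComonoidInterpretation C extension
      {gen copy} {gen discard} ⟦copy⟧ ⟦discard⟧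

  eval-merge : eval (gen merge) ≋ ∇ (ob 1)
  eval-merge = coe-⨾ (ob-+ 1 1)

  eval-create : eval (gen create) ≋ ¿ (ob 1)
  eval-create = coe-⨾ ob-0

  -- This is not definitional, since the given model may interpret `⨟` and `⊗` otherwise than `eval`
  -- does; but the two interpretations agree on generators.
  eval-embed : ∀ {m n} (t : Term (CarGen Op) m n) → eval (embed t) ≋ ⟦ t ⟧
  eval-embed = interpretation-unique (restrict embedGen extension) interpretation
    (λ _ → refl)
    λ { (op _) → hrefl ; copy → hrefl ; discard → hrefl }

  private
    μ : Term FGen 2 1
    μ = gen merge
    η : Term FGen 0 1
    η = gen create
    δ : Term FGen 1 2
    δ = gen copy
    ε : Term FGen 1 0
    ε = gen discard

  eval-monoidLaw : ∀ {m n} {t u : Term FGen m n} →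
                   MonoidLaw μ η t u → eval t ≈ eval u
  eval-monoidLaw ∇-assoc = ≋⇒≈ (htrans
    (X.⟦⨟⟧-cong′ (μ ⊗ id₁) μ (X.⟦⊗⟧-cong μ id₁ eval-merge ⟦id₁⟧≋) eval-merge)
    (htrans (C.Frobenius.∇-assoc (ob 1))
    (hsym (X.⟦⨟⟧-cong′ (id₁ ⊗ μ) μ
      (X.⟦⊗⟧-cong id₁ μ ⟦id₁⟧≋ eval-merge) eval-merge))))
  eval-monoidLaw ∇-identityˡ = ≋⇒≈ (htrans
    (X.⟦⨟⟧-cong′ (η ⊗ id₁) μ (X.⟦⊗⟧-cong η id₁ eval-create ⟦id₁⟧≋) eval-merge)
    (htrans (C.Frobenius.∇-identityˡ (ob 1)) (hsym ⟦id₁⟧≋)))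
  eval-monoidLaw ∇-identityʳ = ≋⇒≈ (htrans
    (X.⟦⨟⟧-cong′ (id₁ ⊗ η) μ (X.⟦⊗⟧-cong id₁ η ⟦id₁⟧≋ eval-create) eval-merge)
    (htrans (C.Frobenius.∇-identityʳ (ob 1)) (hsym ⟦id₁⟧≋)))
  eval-monoidLaw ∇-comm = ≋⇒≈ (htrans (X.⟦⨟⟧-cong′ σ₁₁ μ ⟦σ₁₁⟧ eval-merge)
    (htrans (≈⇒≋ (C.Frobenius.∇-comm (ob 1))) (hsym eval-merge)))

  private
    eval-μδ : eval (μ ⨟ δ) ≋ ∇ (ob 1) C.⨾ Δ (ob 1)
    eval-μδ = X.⟦⨟⟧-cong′ μ δ eval-merge ⟦copy⟧

  eval-frobeniusLaw : ∀ {m n} {t u : Term FGen m n} →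
                      FrobeniusLaw δ μ t u → eval t ≈ eval u
  eval-frobeniusLaw frobeniusˡ = ≋⇒≈ (htrans
    -- The object 3 stands for both bracketings of the triple tensor of `ob 1`, and associativity
    -- joins them.
    (X.⟦⨟⟧-cong (δ ⊗ id₁) (id₁ ⊗ μ) (C.⊕₀-assoc (ob 1) (ob 1) (ob 1))
      (X.⟦⊗⟧-cong δ id₁ ⟦copy⟧ ⟦id₁⟧≋) (X.⟦⊗⟧-cong id₁ μ ⟦id₁⟧≋ eval-merge))
    (htrans ⨾⟦⟧≋⨾[] (htrans (≈⇒≋ (C.Frobenius.frobeniusˡ (ob 1)))
    (hsym eval-μδ))))
  eval-frobeniusLaw frobeniusʳ = ≋⇒≈ (htrans
    (X.⟦⨟⟧-cong (id₁ ⊗ δ) (μ ⊗ id₁) (sym (C.⊕₀-assoc (ob 1) (ob 1) (ob 1)))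
      (X.⟦⊗⟧-cong id₁ δ ⟦id₁⟧≋ ⟦copy⟧) (X.⟦⊗⟧-cong μ id₁ eval-merge ⟦id₁⟧≋))
    (htrans ⨾⟦⟧≋⨾[] (htrans (≈⇒≋ (C.Frobenius.frobeniusʳ (ob 1)))
    (hsym eval-μδ))))

  eval-adjointLaw : ∀ {m n} {t u : Term FGen m n} →
                    AdjointLaw δ ε μ η t u → eval t ≤ eval u
  eval-adjointLaw ∇Δ≤id = ≤-resp≋ (hsym eval-μδ)
    (htrans (id≋ (sym (ob-+ 1 1))) (hsym (X.⟦idₜ⟧ 2)))
    (C.Frobenius.∇Δ≤id (ob 1))
  eval-adjointLaw id≤Δ∇ = ≤-resp≋ (hsym ⟦id₁⟧≋)
    (hsym (X.⟦⨟⟧-cong′ δ μ ⟦copy⟧ eval-merge))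
    (C.Frobenius.id≤Δ∇ (ob 1))
  eval-adjointLaw ¿!≤id = ≤-resp≋ (hsym (X.⟦⨟⟧-cong′ η ε eval-create ⟦discard⟧))
    (htrans (id≋ (sym ob-0)) (hsym (≈⇒≋ ⟦id₀⟧)))
    (C.Frobenius.¿!≤id (ob 1))
  eval-adjointLaw id≤!¿ = ≤-resp≋ (hsym ⟦id₁⟧≋)
    (hsym (X.⟦⨟⟧-cong′ ε η ⟦discard⟧ eval-create))
    (C.Frobenius.id≤!¿ (ob 1))

  private
    eval-both : ∀ {r} {R : TermRel FGen r} →
                (∀ {m n} {t u : Term FGen m n} → R t u → eval t ≈ eval u) →
                ∀ {m n} {t u : Term FGen m n} → Both R t u → eval t ≤ eval u
    eval-both h (forward p)  = C.≈⇒≤ (h p)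
    eval-both h (backward p) = C.≈⇒≤ (C.≈-sym (h p))

    eval-eqn : ∀ {n} {t u : Term (CarGen Op) n 1} → Eqn t u →
               eval (embed t) ≈ eval (embed u)
    eval-eqn {t = t} {u} p =
      ≋⇒≈ (htrans (eval-embed t) (htrans (≈⇒≋ (⟦eqn⟧ p)) (hsym (eval-embed u))))

    eval-⨟! : ∀ {m n} (t : Term FGen m n) →
              eval (t ⨟ !ₙ ε n) ≋ eval t C.⨾ ! (ob n)
    eval-⨟! {n = n} t = X.⟦⨟⟧-cong′ t (!ₙ ε n) hrefl (FrobInt.⟦!ₙ⟧ n)

    eval-⨟Δ : ∀ {m n} (t : Term FGen m n) →
              eval (t ⨟ Δₙ δ n) ≋ eval t C.⨾ Δ (ob n)
    eval-⨟Δ {n = n} t = X.⟦⨟⟧-cong′ t (Δₙ δ n) hrefl (FrobInt.⟦Δₙ⟧ n)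

    eval-Δ⨟ : ∀ {m n} (t : Term FGen m n) →
              eval (Δₙ δ m ⨟ (t ⊗ t)) ≋ Δ (ob m) C.⨾ (eval t C.⊕₁ eval t)
    eval-Δ⨟ {m = m} t =
      X.⟦⨟⟧-cong′ (Δₙ δ m) (t ⊗ t) (FrobInt.⟦Δₙ⟧ m) (X.⟦⊗⟧ t t)

  -- The two families of I_OLCH are the reverse halves of `Δ-hom` and `!-hom` for the operations.
  eval-ineq : ∀ {m n} {t u : Term FGen m n} → PlusIneq T t u → eval t ≤ eval u
  eval-ineq (eqn p)    = C.≈⇒≤ (eval-eqn p)
  eval-ineq (eqn-op p) = C.≈⇒≤ (C.≈-sym (eval-eqn p))
  eval-ineq (olch-! {n} f) = ≤-resp≋ (hsym (FrobInt.⟦!ₙ⟧ n))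
    (hsym (X.⟦⨟⟧-cong′ (gen (op (op f))) ε hrefl ⟦discard⟧))
    (C.≈⇒≤ (C.≈-sym (IsMap.!-hom (⟦op⟧-map f))))
  eval-ineq (olch-Δ f) = ≤-resp≋ (hsym (eval-Δ⨟ (gen (op (op f)))))
    (hsym (X.⟦⨟⟧-cong′ (gen (op (op f))) δ hrefl ⟦copy⟧))
    (C.≈⇒≤ (C.≈-sym (IsMap.Δ-hom (⟦op⟧-map f))))

  eval-axiom : ∀ {m n} {t u : Term FGen m n} →
               FrobAxiom (T ⁺) t u → eval t ≤ eval u
  eval-axiom (comonoid p)  = eval-both FrobInt.⟦⟧-comonoidLaw p
  eval-axiom (monoid p)    = eval-both eval-monoidLaw p
  eval-axiom (frobenius p) = eval-both eval-frobeniusLaw p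
  eval-axiom (adjoint p)   = eval-adjointLaw p
  -- The lax comonoid inequations of the generators are instances of those that every arrow of `C`
  -- satisfies.
  eval-axiom (op-Δ f)      = ≤-resp≋ (hsym (eval-⨟Δ (gen (op f))))
    (hsym (eval-Δ⨟ (gen (op f)))) (C.Δ-lax (eval (gen (op f))))
  eval-axiom (op-! {n} f)  = ≤-resp≋ (hsym (eval-⨟! (gen (op f))))
    (hsym (FrobInt.⟦!ₙ⟧ n)) (C.!-lax (eval (gen (op f))))
  eval-axiom (ineq p)      = eval-ineq p

  eval-mono : ∀ {m n} {t u : Term FGen m n} →
              Below (FrobAxiom (T ⁺)) t u → eval t ≤ eval u
  eval-mono (smc p)       = C.≈⇒≤ (X.⟦⟧-Equal (λ ()) p)
  eval-mono (base p)      = eval-axiom p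
  eval-mono (≤-trans p q) = C.≤-trans (eval-mono p) (eval-mono q)
  eval-mono (⨟-mono p q)  = C.⨾-mono (eval-mono p) (eval-mono q)
  eval-mono (⊗-mono p q)  =
    ⨾-monoˡ (⨾-monoʳ (C.⊕-mono (eval-mono p) (eval-mono q)))

  cartesianBifunctor : CartesianBifunctor (𝓕 (T ⁺)) C
  cartesianBifunctor = record
    { functor = record
        { F₀     = ob
        ; F₁     = eval
        ; F-cong = λ (p , q) → C.≤-antisym (eval-mono p) (eval-mono q)
        ; F-id   = λ {n} → ≋⇒≈ (X.⟦idₜ⟧ n)
        ; F-⨾    = C.≈-refl
        ; F-I    = ob-0
        ; F-⊕₀   = ob-+
        ; F-⊕₁   = λ {f = t} {u} → X.⟦⊗⟧ t u
        ; F-σ    = λ {m} {n} → X.⟦σₜ⟧ m n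
        }
    ; F-mono = eval-mono
    ; F-Δ    = FrobInt.⟦Δₙ⟧
    ; F-!    = FrobInt.⟦!ₙ⟧
    }

-- Generic interpretations and product-preserving functors.

syntactic-𝓛 : (T : CartesianTheory s i) →
              Interpretation (CarGen (CartesianTheory.Op T)) (CartesianCategory.smc (𝓛 T))
syntactic-𝓛 T = record
  { ob    = λ n → n
  ; ob-0  = refl
  ; ob-+  = λ _ _ → refl
  -- As each term is its own value, composing with a functor presents that functor as an
  -- interpretation.
  ; ⟦_⟧   = λ t → t
  ; ⟦id₀⟧ = L.≈-refl
  -- The identity on 1 is by definition `id₁ ⊗ id₀`, which equals `id₁` only modulo the laws.
  ; ⟦id₁⟧ = P.id₁~id
  ; ⟦σ₁₁⟧ = L.≈⇒≋ (L.≈-sym P.σₜ~σ₁₁)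
  ; ⟦⨟⟧   = λ _ _ → L.≈-refl
  ; ⟦⊗⟧   = λ _ _ → L.≈⇒≋ L.≈-refl
  }
  where
  module L = CartesianCategory (𝓛 T)
  open CartesianSyntax T using (module P)

syntactic-𝓕 : (T : FrobeniusTheory s i) →
              Interpretation (FrobGen (FrobeniusTheory.Sig T))
                             (CartesianBicategory.smc (𝓕 T))
syntactic-𝓕 T = record
  { ob    = λ n → n
  ; ob-0  = refl
  ; ob-+  = λ _ _ → refl
  ; ⟦_⟧   = λ t → t
  ; ⟦id₀⟧ = B.≈-refl
  ; ⟦id₁⟧ = P.id₁~id
  ; ⟦σ₁₁⟧ = B.≈⇒≋ (B.≈-sym P.σₜ~σ₁₁)
  ; ⟦⨟⟧   = λ _ _ → B.≈-refl
  ; ⟦⊗⟧   = λ _ _ → B.≈⇒≋ B.≈-refl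
  }
  where
  module B = CartesianBicategory (𝓕 T)
  open FrobeniusSyntax T using (module P)

module ProductPreservingProperties
  {o′ ℓ′ e′} {L : CartesianCategory o ℓ e} {D : CartesianCategory o′ ℓ′ e′}
  (G : ProductPreservingFunctor L D) where
  private
    module L = CartesianCategory L
    module D = CartesianCategory D
  open ProductPreservingFunctor G
  open HetProperties D.category

  preserves-! : ∀ A → F₁ (L.! {A}) D.≋ D.! {F₀ A}
  preserves-! A = htrans (hsym (⨾-coe F-I)) (D.≈⇒≋ (D.!-unique _))

  -- Pairings are determined by their projections, which are preserved. Since Δ is the pairing of
  -- two identities, Δ is preserved as well.
  preserves-⟨,⟩ : ∀ {X A B} (f : L.Hom X A) (g : L.Hom X B) →
                  F₁ L.⟨ f , g ⟩ D.≋ D.⟨ F₁ f , F₁ g ⟩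
  preserves-⟨,⟩ {A = A} {B} f g = htrans (hsym (⨾-coe q)) (D.≈⇒≋
    (D.unique (F₁ f) (F₁ g) (F₁ L.⟨ f , g ⟩ D.⨾ D.coe q)
      (project (F-π₁ A B) (L.project₁ f g)) (project (F-π₂ A B) (L.project₂ f g))))
    where
    q : F₀ (A L.⊕₀ B) ≡ F₀ A D.⊕₀ F₀ B
    q = F-⊕₀ A B
    project : ∀ {E} {π : L.Hom (A L.⊕₀ B) E} {π′ : D.Hom (F₀ A D.⊕₀ F₀ B) (F₀ E)}
              {h : L.Hom _ E} → F₁ π D.≋ π′ → L.⟨ f , g ⟩ L.⨾ π L.≈ h →
              (F₁ L.⟨ f , g ⟩ D.⨾ D.coe q) D.⨾ π′ D.≈ F₁ h
    project p r = ≋⇒≈ (htrans (⨾-cong≋ (⨾-coe q) (hsym p))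
      (D.≈⇒≋ (D.≈-trans (D.≈-sym F-⨾) (F-cong r))))

inclusion : (C : CartesianBicategory o ℓ e r) →
            StrictMonoidalFunctor (Maps.mapSMC C) (CartesianBicategory.smc C)
inclusion C = record
  { F₀     = λ A → A
  ; F₁     = proj₁
  ; F-cong = λ p → p
  ; F-id   = C.≈-refl
  ; F-⨾    = C.≈-refl
  ; F-I    = refl
  ; F-⊕₀   = λ _ _ → refl
  ; F-⊕₁   = C.≈⇒≋ C.≈-refl
  ; F-σ    = C.≈⇒≋ C.≈-refl
  }
  where
  module C = CartesianBicategory C

-- Passage from models of either kind to map models.

module _ (T : CartesianTheory s i) (C : CartesianBicategory o ℓ e r) where
  open CartesianTheory T
  private
    module C = CartesianBicategory C
    module L = CartesianCategory (𝓛 T)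
    module B = CartesianBicategory (𝓕 (T ⁺))
  open HetProperties C.category
  open SMCProperties C.smc using (⨾-id≋)
  open FrobeniusProperties C.orderedSMC
    using (⨾-monoˡ; ⨾-monoʳ; ≤-respˡ; ≤-respʳ)
  open BicategoryProperties C
  open Maps C

  fromProductPreserving : ProductPreservingFunctor (𝓛 T) (Map C) → MapModel T C
  fromProductPreserving G = record
    { interpretation = compose (inclusion C) (compose functor (syntactic-𝓛 T))
    ; ⟦op⟧-map  = λ f → proj₂ (F₁ (gen (op f)))
    -- In `Map C` the pairing of two identities is `Δ ⨾ (id ⊕ id)`, which is Δ.
    ; ⟦copy⟧    = htrans (C.≈⇒≋ (F-cong copy≈))
        (htrans (lower≋ (preserves-⟨,⟩ (L.id {1}) L.id)) (C.≈⇒≋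
        (C.≈-trans (C.⨾-cong C.≈-refl (C.≈-trans (C.⊕-cong F-id F-id) C.⊕-id))
          C.identityʳ)))
    ; ⟦discard⟧ = htrans (C.≈⇒≋ (F-cong (L.≈-sym (P.!ₙ-one (gen discard)))))
        (lower≋ (preserves-! 1))
    ; ⟦eqn⟧     = λ p → F-cong (base (eqn p))
    }
    where
    open ProductPreservingFunctor G
    open ProductPreservingProperties G
    open CartesianSyntax T using (module P)
    copy≈ : gen copy L.≈ L.⟨ L.id {1} , L.id {1} ⟩
    copy≈ = L.≈-trans (L.≈-sym (P.Δₙ-one (gen copy)))
      (L.≈-sym (L.≈-trans (L.⨾-cong L.≈-refl (L.⊕-id {1} {1})) L.identityʳ))

  module _ (F : CartesianBifunctor (𝓕 (T ⁺)) C) where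
    open CartesianBifunctor F
    open FrobeniusSyntax (T ⁺) using (module P)
    private
      J : Interpretation (FrobGen (OpSig Op)) C.smc
      J = compose functor (syntactic-𝓕 (T ⁺))
      g : ∀ {n} → Op n → Term (FrobGen (OpSig Op)) n 1
      g f = gen (op (op f))
    open Interpretation J

    F-copy : F₁ (gen copy) C.≋ C.Δ (F₀ 1)
    F-copy = htrans (C.≈⇒≋ (F-cong (B.≈-sym (P.Δₙ-one (gen copy))))) (F-Δ 1)

    F-discard : F₁ (gen discard) C.≋ C.! (F₀ 1)
    F-discard = htrans (C.≈⇒≋ (F-cong (B.≈-sym (P.!ₙ-one (gen discard))))) (F-! 1)

    -- A monotone functor preserves the unit and counit of Δ ⊣ ∇, so the image of ∇ is again a right
    -- adjoint of Δ.
    F-merge : F₁ (gen merge) C.≋ C.∇ (F₀ 1)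
    F-merge = htrans (hsym merge′≋) (C.≈⇒≋ (rightAdjoint-unique
      (≤-resp≋ ⟦id₁⟧≋ (⟦⨟⟧-cong′ (gen copy) (gen merge) F-copy (hsym merge′≋))
        (F-mono (base (adjoint id≤Δ∇))))
      (≤-resp≋ (⟦⨟⟧-cong′ (gen merge) (gen copy) (hsym merge′≋) F-copy)
        (htrans (⟦idₜ⟧ 2) (id≋ (ob-+ 1 1))) (F-mono (base (adjoint ∇Δ≤id))))
      (C.Frobenius.id≤Δ∇ (F₀ 1)) (C.Frobenius.∇Δ≤id (F₀ 1))))
      where
      -- Moving the domain from `F₀ 2` to `F₀ 1 ⊕ F₀ 1` makes the two right adjoints parallel
      -- arrows.
      merge′≋ : C.coe (sym (ob-+ 1 1)) C.⨾ F₁ (gen merge) C.≋ F₁ (gen merge)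
      merge′≋ = coe-⨾ (sym (ob-+ 1 1))

    F-create : F₁ (gen create) C.≋ C.¿ (F₀ 1)
    F-create = htrans (hsym create′≋) (C.≈⇒≋ (rightAdjoint-unique
      (≤-resp≋ ⟦id₁⟧≋ (⟦⨟⟧-cong′ (gen discard) (gen create) F-discard (hsym create′≋))
        (F-mono (base (adjoint id≤!¿))))
      (≤-resp≋ (⟦⨟⟧-cong′ (gen create) (gen discard) (hsym create′≋) F-discard)
        (htrans (C.≈⇒≋ ⟦id₀⟧) (id≋ ob-0)) (F-mono (base (adjoint ¿!≤id))))
      (C.Frobenius.id≤!¿ (F₀ 1)) (C.Frobenius.¿!≤id (F₀ 1))))
      where
      create′≋ : C.coe (sym ob-0) C.⨾ F₁ (gen create) C.≋ F₁ (gen create)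
      create′≋ = coe-⨾ (sym ob-0)

    fromBifunctor : MapModel T C
    fromBifunctor = record
      { interpretation = restrict embedGen J
      ; ⟦op⟧-map  = λ {n} f → record
          -- One half holds for every arrow of `C`; the other is the image of I_OLCH.
          { Δ-hom = C.≤-antisym (C.Δ-lax (F₁ (gen (op (op f)))))
              (≤-resp≋
                (⟦⨟⟧-cong′ (Δₙ (gen copy) n) (g f ⊗ g f) (F-Δ n) (⟦⊗⟧ (g f) (g f)))
                (⟦⨟⟧-cong′ (g f) (gen copy) hrefl F-copy)
                (F-mono (base (ineq (olch-Δ f)))))
          ; !-hom = C.≤-antisym (C.!-lax (F₁ (gen (op (op f)))))
              (≤-resp≋ (F-! n)
                (⟦⨟⟧-cong′ (g f) (gen discard) hrefl F-discard)
                (F-mono (base (ineq (olch-! f)))))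
          }
      ; ⟦copy⟧    = F-copy
      ; ⟦discard⟧ = F-discard
      ; ⟦eqn⟧     = λ p → F-cong (base (ineq (eqn p)) , base (ineq (eqn-op p)))
      }

  -- Lax transformations and natural transformations.

  module _ {F G : CartesianBifunctor (𝓕 (T ⁺)) C} (φ : LaxTransformation F G) where
    private
      module F = CartesianBifunctor F
      module G = CartesianBifunctor G
    open LaxTransformation φ

    -- Laxness at Δ reads `Δ ⨾ (α ⊕ α) ≤ α ⨾ Δ`, the converse of what all arrows satisfy. Laxness at
    -- ! does the same for discarding, `α` at 0 being the identity.
    lax-map : ∀ n → IsMap (α n)
    lax-map n = record
      { Δ-hom = C.≤-antisym (C.Δ-lax (α n))
          (≤-resp≋ (⨾-cong≋ (F.F-Δ n) (α-⊕ n n)) (⨾-cong≋ hrefl (G.F-Δ n))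
            (lax (B.Δ n)))
      ; !-hom = C.≤-antisym (C.!-lax (α n))
          (≤-resp≋ (htrans (⨾-id≋ α-I) (F.F-! n))
            (⨾-cong≋ hrefl (G.F-! n)) (lax (B.! n)))
      }

    -- Both sides are maps, and between maps an inequality is an equality.
    lax-natural : ∀ {m n} (t : Term (CarGen Op) m n) →
                  F.F₁ (embed t) C.⨾ α n C.≈ α m C.⨾ G.F₁ (embed t)
    lax-natural {m} {n} t = map-≤⇒≈
      (⨾-map (MapModelProperties.⟦⟧-map T C (fromBifunctor F) t) (lax-map n))
      (⨾-map (lax-map m) (MapModelProperties.⟦⟧-map T C (fromBifunctor G) t))
      (lax (embed t))

  module _ (𝓜 𝓝 : MapModel T C) where
    private
      module 𝓜 where
        open MapModel 𝓜 public
        open MapModelProperties T C 𝓜 public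
      module 𝓝 where
        open MapModel 𝓝 public
        open MapModelProperties T C 𝓝 public

    module _ (α : ∀ n → C.Hom (𝓜.ob n) (𝓝.ob n)) (α-map : ∀ n → IsMap (α n))
             (α-⊕ : ∀ m n → α (m + n) C.≋ α m C.⊕₁ α n) (α-I : α 0 C.≋ C.id {C.I})
             (α-natural : ∀ {m n} (t : Term (CarGen Op) m n) →
                          𝓜.⟦ t ⟧ C.⨾ α n C.≈ α m C.⨾ 𝓝.⟦ t ⟧) where

      -- At ∇ and ¿, where naturality is not given, the inequality is the mate of the component at 1
      -- being a map. Lax squares then paste along `⨟` and `⊗`.
      natural⇒lax : ∀ {m n} (t : Term (FrobGen (OpSig Op)) m n) →
                    𝓜.eval t C.⨾ α n C.≤ α m C.⨾ 𝓝.eval t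
      natural⇒lax (gen (op (op f))) = C.≈⇒≤ (α-natural (gen (op f)))
      natural⇒lax (gen copy)        = C.≈⇒≤ (α-natural (gen copy))
      natural⇒lax (gen discard)     = C.≈⇒≤ (α-natural (gen discard))
      natural⇒lax (gen merge)       = ≤-resp≋
        (⨾-cong≋ (hsym 𝓜.eval-merge) hrefl)
        (⨾-cong≋ (hsym (α-⊕ 1 1)) (hsym 𝓝.eval-merge))
        (∇-lax (α-map 1))
      natural⇒lax (gen create)      = ≤-resp≋
        (⨾-cong≋ (hsym 𝓜.eval-create) hrefl)
        (htrans (C.≈⇒≋ (C.≈-sym C.identityˡ))
          (⨾-cong≋ (hsym α-I) (hsym 𝓝.eval-create)))
        (¿-lax (α-map 1))
      natural⇒lax id₀ = C.≈⇒≤ (α-natural id₀)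
      natural⇒lax id₁ = C.≈⇒≤ (α-natural id₁)
      natural⇒lax σ₁₁ = C.≈⇒≤ (α-natural σ₁₁)
      natural⇒lax (t ⨟ u) = ≤-respˡ C.assoc (C.≤-trans
        (⨾-monoˡ (natural⇒lax u)) (≤-respˡ (C.≈-sym C.assoc)
        (≤-respʳ (⨾-monoʳ (natural⇒lax t)) (C.≈-sym C.assoc))))
      natural⇒lax (_⊗_ {m} {n} {p} {q} t u) = ≤-resp≋
        (htrans (C.≈⇒≋ C.⊕-⨾) (⨾-cong≋
          (hsym (Interpretation.⟦⊗⟧ 𝓜.extension t u)) (hsym (α-⊕ n q))))
        (htrans (C.≈⇒≋ C.⊕-⨾) (⨾-cong≋
          (hsym (α-⊕ m p)) (hsym (Interpretation.⟦⊗⟧ 𝓝.extension t u))))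
        (C.⊕-mono (natural⇒lax t) (natural⇒lax u))

    -- Both evaluations send `merge` and `create` to the ∇ and ¿ of `C`, so only the cartesian
    -- generators can tell them apart.
    eval-cong : (∀ n → 𝓜.ob n ≡ 𝓝.ob n) →
                (∀ {m n} (t : Term (CarGen Op) m n) → 𝓜.⟦ t ⟧ C.≋ 𝓝.⟦ t ⟧) →
                ∀ {m n} (t : Term (FrobGen (OpSig Op)) m n) →
                𝓜.eval t C.≋ 𝓝.eval t
    eval-cong p q = interpretation-unique 𝓜.extension 𝓝.extension p λ
      { (op (op f)) → q (gen (op f))
      ; copy        → q (gen copy)
      ; discard     → q (gen discard)
      ; merge       → htrans 𝓜.eval-merge
                        (htrans (∇≋ (p 1)) (hsym 𝓝.eval-merge))
      ; create      → htrans 𝓜.eval-create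
                        (htrans (¿≋ (p 1)) (hsym 𝓝.eval-create))
      }

  -- The two functors and their round trips.

  toMap : CartesianBifunctor (𝓕 (T ⁺)) C → ProductPreservingFunctor (𝓛 T) (Map C)
  toMap F = MapModelProperties.productPreservingFunctor T C (fromBifunctor F)

  fromMap : ProductPreservingFunctor (𝓛 T) (Map C) → CartesianBifunctor (𝓕 (T ⁺)) C
  fromMap G = MapModelProperties.cartesianBifunctor T C (fromProductPreserving G)

  toMap-transformation :
    ∀ {F G} → LaxTransformation F G →
    MonoidalTransformation (ProductPreservingFunctor.functor (toMap F))
                           (ProductPreservingFunctor.functor (toMap G))
  toMap-transformation φ = record
    { α       = λ n → α n , lax-map φ n
    ; natural = lax-natural φ
    ; α-⊕     = λ m n → lift≋ (α-⊕ m n)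
    ; α-I     = lift≋ α-I
    }
    where
    open LaxTransformation φ

  toMap-≗ : ∀ F G →
            CartesianBifunctor.functor F ≗ CartesianBifunctor.functor G →
            ProductPreservingFunctor.functor (toMap F) ≗
            ProductPreservingFunctor.functor (toMap G)
  toMap-≗ F G p = record
    { F₀≡ = F₀≡
    ; F₁≋ = λ t → lift≋ (F₁≋ (embed t))
    }
    where
    open _≗_ p

  toMap-functor : Functor⁼ (Mod-FROB (T ⁺) C) (Mod-CAR T (Map C))
  toMap-functor = record
    { F₀     = toMap
    ; F₁     = toMap-transformation
    ; F-cong = λ p → p
    ; F-id   = λ _ → C.≈-refl
    ; F-⨾    = λ _ → C.≈-refl
    ; F-≃    = λ {F} {G} → toMap-≗ F G
    ; F-τ    = λ p n → C.≈-sym (proj₁-coe (_≗_.F₀≡ p n))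
    }

  fromMap-transformation :
    ∀ G H → MonoidalTransformation (ProductPreservingFunctor.functor G)
                                   (ProductPreservingFunctor.functor H) →
    LaxTransformation (fromMap G) (fromMap H)
  fromMap-transformation G H φ = record
    { α   = λ n → proj₁ (α n)
    ; lax = natural⇒lax (fromProductPreserving G) (fromProductPreserving H)
        (λ n → proj₁ (α n)) (λ n → proj₂ (α n)) (λ m n → lower≋ (α-⊕ m n))
        (lower≋ α-I) natural
    ; α-⊕ = λ m n → lower≋ (α-⊕ m n)
    ; α-I = lower≋ α-I
    }
    where
    open MonoidalTransformation φ

  fromMap-≗ : ∀ G H →
              ProductPreservingFunctor.functor G ≗
              ProductPreservingFunctor.functor H →
              CartesianBifunctor.functor (fromMap G) ≗
              CartesianBifunctor.functor (fromMap H)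
  fromMap-≗ G H p = record
    { F₀≡ = F₀≡
    ; F₁≋ = eval-cong (fromProductPreserving G) (fromProductPreserving H) F₀≡
        (λ t → lower≋ (F₁≋ t))
    }
    where
    open _≗_ p

  fromMap-functor : Functor⁼ (Mod-CAR T (Map C)) (Mod-FROB (T ⁺) C)
  fromMap-functor = record
    { F₀     = fromMap
    ; F₁     = λ {G} {H} → fromMap-transformation G H
    ; F-cong = λ p → p
    ; F-id   = λ _ → C.≈-refl
    ; F-⨾    = λ _ → C.≈-refl
    ; F-≃    = λ {G} {H} → fromMap-≗ G H
    ; F-τ    = λ p n → proj₁-coe (_≗_.F₀≡ p n)
    }

  -- Operations, Δ and ! come back by computation; at ∇ and ¿ the uniqueness of right adjoints is
  -- used.
  fromMap∘toMap : ∀ F → CartesianBifunctor.functor (fromMap (toMap F)) ≗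
                        CartesianBifunctor.functor F
  fromMap∘toMap F = record
    { F₀≡ = λ _ → refl
    ; F₁≋ = interpretation-unique
        𝓜.extension
        (compose (CartesianBifunctor.functor F) (syntactic-𝓕 (T ⁺)))
        (λ _ → refl) λ
        { (op (op f)) → hrefl
        ; copy        → hrefl
        ; discard     → hrefl
        ; merge       → htrans 𝓜.eval-merge (hsym (F-merge F))
        ; create      → htrans 𝓜.eval-create (hsym (F-create F))
        }
    }
    where
    module 𝓜 = MapModelProperties T C (fromProductPreserving (toMap F))

  toMap∘fromMap : ∀ G → ProductPreservingFunctor.functor (toMap (fromMap G)) ≗
                        ProductPreservingFunctor.functor G
  toMap∘fromMap G = record
    { F₀≡ = λ _ → refl
    ; F₁≋ = λ t → lift≋ (MapModelProperties.eval-embed T C (fromProductPreserving G) t)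
    }

theorem6p2 : ∀ {s i o ℓ e r : Level} (T : CartesianTheory s i) (C : CartesianBicategory o ℓ e r) →
    Mod-FROB (T ⁺) C ≅ Mod-CAR T (Map C)
theorem6p2 T C = record
  { to      = toMap-functor T C
  ; from    = fromMap-functor T C
  ; from∘to = record
      { obj = fromMap∘toMap T C
      -- The round trip fixes every object by `refl`, so the components of `τ` are identities, and
      -- those of the transformation return unchanged.
      ; hom = λ _ _ → C.≈-trans C.identityʳ (C.≈-sym C.identityˡ)
      }
  ; to∘from = record
      { obj = toMap∘fromMap T C
      ; hom = λ _ _ → C.≈-trans C.identityʳ (C.≈-sym C.identityˡ)
      }
  }
  where
  module C = CartesianBicategory C
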